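{- Let $n\geq 12$ be even and let $l$ be the smallest positive odd number such that $R_l>3\times 2^{\frac{n-l-1}{2}}-2$. Among all crg trees on $n$ vertices, the distance between center and subtree core is maximized by the tree $T_{rg}^{n,l}$; that is, for every odd $m$ with $3\leq m<n$, $$d_{T_{rg}^{n,m}}\big(C(T_{rg}^{n,m}),S_c(T_{rg}^{n,m})\big)\leq d_{T_{rg}^{n,l}}\big(C(T_{rg}^{n,l}),S_c(T_{rg}^{n,l})\big).$$
   Context: All graphs are finite, simple, connected and undirected. A pendant vertex is a vertex of degree $1$. A binary tree is a tree in which every non-pendant vertex has degree $3$. Center and subtree core: the eccentricity of $v\in V(T)$ is $e(v)=\max_{u}d_T(u,v)$; the center $C(T)$ is the set of vertices of minimum eccentricity. A subtree of $T$ is a (nonempty) connected subgraph of $T$; $f_T(v)$ is the number of subtrees of $T$ containing $v$; the subtree core $S_c(T)$ is the set of vertices $v$ for which $f_T(v)$ is maximum. For $X,Y\subseteq V(T)$, $d_T(X,Y)=\min\{d_T(x,y):x\in X,y\in Y\}$. Rooted binary trees: a rooted binary tree is a rooted tree whose root has degree $2$ and in which every other vertex has degree $1$ or $3$; the single-vertex rooted tree is also allowed. The height (level) of a vertex is its distance to the root. A rooted binary tree is ordered if the vertices of each level $l\ge 1$ are linearly ordered so that two vertices at level $l+1$ with different parents are ordered as their parents are at level $l$. A rooted binary tree is rgood if (i) the heights of any two of its pendant vertices differ by at most $1$, and (ii) it can be ordered so that the parents of the pendant vertices at the highest level form a final segment in the ordering of the vertices at the next-to-highest level. For each odd $l$ there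 is, up to isomorphism, exactly one rgood binary tree on $l$ vertices, denoted $T_{rg}^l$. For odd $l$, $R_l=f_{T_{rg}^l}(r)$, where $r$ is the root of $T_{rg}^l$. Crg trees: a binary caterpillar is a binary tree having a path such that every vertex not on the path is adjacent to a vertex of the path. For even $n\ge 4$ and odd $l$ with $3\le l<n$, the crg tree $T_{rg}^{n,l}$ is the tree on $n$ vertices obtained by identifying the root of $T_{rg}^l$ with a vertex of maximum eccentricity of a binary caterpillar on $n-l+1$ vertices. -}

module Defs where

open import Data.Bool.Base using (true; false)
open import Data.Fin.Base as Fin using (Fin; toℕ; fromℕ<)
open import Data.Fin.Properties using (_≟_; any?; all?; pigeonhole; toℕ≤pred[n]; toℕ-fromℕ<)
open import Data.Fin.Subset using (Subset; Nonempty) renaming (_∈_ to _∈ₛ_)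
open import Data.Fin.Subset.Properties using (nonempty?) renaming (_∈?_ to _∈ₛ?_)
open import Data.List.Base using (List; []; _∷_; _∷ʳ_; map; filter; length; allFin; cartesianProduct; cartesianProductWith)
open import Data.List.Extrema.Nat using (min; max)
open import Data.List.Membership.Propositional using (_∉_)
open import Data.List.Relation.Unary.Any using (Any)
open import Data.List.Relation.Unary.Linked using (Linked)
open import Data.List.Relation.Unary.Unique.Propositional using (Unique)
open import Data.Nat.Base using (ℕ; zero; suc; _+_; _*_; _^_; _∸_; _≤_; _<_; s≤s)
open import Data.Nat.Divisibility using (_∤_)
open import Data.Nat.DivMod using (_/_)
open import Data.Nat.Induction using (<-rec)
open import Data.Nat.Properties using (_≤?_; _<?_; ≮⇒≥; +-monoˡ-<; m+[n∸m]≡n; <-≤-trans; ≤-reflexive)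
open import Data.Product.Base using (Σ; ∃; ∃₂; _×_; _,_; proj₁)
open import Data.Sum.Base using (_⊎_)
open import Data.Vec.Base using (Vec; []; _∷_; lookup)
open import Function.Base using (_on_)
open import Function.Bundles using (_⇔_)
open import Function.Definitions using (Injective)
open import Level as L using (0ℓ)
open import Relation.Binary.Core using (Rel)
open import Relation.Binary.Definitions using (Symmetric; Irreflexive) renaming (Decidable to Decidable₂)
open import Relation.Binary.PropositionalEquality using (_≡_; _≢_; refl; sym; subst)
open import Relation.Binary.Structures using (IsStrictTotalOrder)
open import Relation.Nullary using (¬_; Dec; yes; no)
open import Relation.Nullary.Decidable using (map′; _×-dec_; _→-dec_)
open import Relation.Unary using (Pred; Decidable)

private
  variable
    n k l : ℕ

data Walk {A : Set} (R : Rel A 0ℓ) : ℕ → Rel A 0ℓ where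
  []  : ∀ {x} → Walk R zero x x
  _∷_ : ∀ {x y z k} → R x y → Walk R k y z → Walk R (suc k) x z

Joined : {A : Set} → Rel A 0ℓ → Rel A 0ℓ
Joined R x y = ∃ λ k → Walk R k x y

walk? : {R : Rel (Fin n) 0ℓ} → Decidable₂ R → ∀ k → Decidable₂ (Walk R k)
walk? R? zero    x y = map′ (λ { refl → [] }) (λ { [] → refl }) (x ≟ y)
walk? R? (suc k) x z =
  map′ (λ { (_ , e , w) → e ∷ w }) (λ { (e ∷ w) → _ , e , w })
       (any? λ y → R? x y ×-dec walk? R? k y z)

-- A shortest walk between two of n vertices has length less than n, so
-- being joined is decidable.

private
  module _ {A : Set} {R : Rel A 0ℓ} where

    append : ∀ {i j x y z} → Walk R i x y → Walk R j y z → Walk R (i + j) x z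
    append []      w = w
    append (e ∷ v) w = e ∷ append v w

    at : ∀ {x y} → Walk R k x y → Fin (suc k) → A
    at {x = x} _       Fin.zero    = x
    at         (_ ∷ w) (Fin.suc i) = at w i

    upto : ∀ {x y} (w : Walk R k x y) i → Walk R (toℕ i) x (at w i)
    upto _       Fin.zero    = []
    upto (e ∷ w) (Fin.suc i) = e ∷ upto w i

    from : ∀ {x y} (w : Walk R k x y) i → Walk R (k ∸ toℕ i) (at w i) y
    from w       Fin.zero    = w
    from (_ ∷ w) (Fin.suc i) = from w i

  shorten : {R : Rel (Fin n) 0ℓ} {x y : Fin n} →
            ∀ k → Walk R k x y → ∃ λ (j : Fin n) → Walk R (toℕ j) x y
  shorten {n} {R} {x} {y} = <-rec _ step
    where
    step : ∀ k → (∀ {i} → i < k → Walk R i x y → ∃ λ (j : Fin n) → Walk R (toℕ j) x y) →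
           Walk R k x y → ∃ λ (j : Fin n) → Walk R (toℕ j) x y
    step k rec w with k <? n
    ... | yes k<n = fromℕ< k<n , subst (λ i → Walk R i x y) (sym (toℕ-fromℕ< k<n)) w
    ... | no  k≮n with pigeonhole (s≤s (≮⇒≥ k≮n)) (at w)
    ...   | i , j , i<j , same =
      rec (<-≤-trans (+-monoˡ-< (k ∸ toℕ j) i<j)
                     (≤-reflexive (m+[n∸m]≡n (toℕ≤pred[n] j))))
          (append (upto w i) (subst (λ z → Walk R (k ∸ toℕ j) z y) (sym same) (from w j)))

joined? : {R : Rel (Fin n) 0ℓ} → Decidable₂ R → Decidable₂ (Joined R)
joined? R? x y =
  map′ (λ { (j , w) → toℕ j , w }) (λ { (k , w) → shorten k w })
       (any? λ j → walk? R? (toℕ j) x y)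

record Graph (n : ℕ) : Set₁ where
  field
    Adj    : Rel (Fin n) 0ℓ
    adj?   : Decidable₂ Adj
    symm   : Symmetric Adj
    irrefl : Irreflexive _≡_ Adj

open Graph public

Connected : Graph n → Set
Connected G = ∀ u v → Joined (Adj G) u v

IsPath : Graph n → List (Fin n) → Set
IsPath G vs = Linked (Adj G) vs × Unique vs

-- The cycle visits v, then the vertices of vs, then returns to v.
IsCycle : Graph n → Fin n → List (Fin n) → Set
IsCycle G v vs = 2 ≤ length vs × Unique (v ∷ vs) × Linked (Adj G) ((v ∷ vs) ∷ʳ v)

IsTree : Graph n → Set
IsTree G = Connected G × (∀ v vs → ¬ IsCycle G v vs)

deg : Graph n → Fin n → ℕ
deg G v = length (filter (adj? G v) (allFin _))

Pendant : Graph n → Fin n → Set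
Pendant G v = deg G v ≡ 1

IsBinary : Graph n → Set
IsBinary G = IsTree G × (∀ v → ¬ Pendant G v → deg G v ≡ 3)

-- The least i < b satisfying P, or b if there is none.
least : {P : ℕ → Set} → Decidable P → ℕ → ℕ
least P? zero    = zero
least P? (suc b) with P? zero
... | yes _ = zero
... | no  _ = suc (least (λ i → P? (suc i)) b)

-- In a connected graph every distance is less than n, so the bound in
-- dist and the default value in setDist (for nonempty X and Y) are
-- never returned.
dist : Graph n → Fin n → Fin n → ℕ
dist {n} G u v = least (λ k → walk? (adj? G) k u v) n

setDist : Graph n → {X Y : Pred (Fin n) 0ℓ} → Decidable X → Decidable Y → ℕ
setDist {n} G X? Y? =
  min n (map (λ { (x , y) → dist G x y })
             (cartesianProduct (filter X? (allFin n)) (filter Y? (allFin n))))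

ecc : Graph n → Fin n → ℕ
ecc G v = max 0 (map (λ u → dist G u v) (allFin _))

Center : Graph n → Pred (Fin n) 0ℓ
Center G v = ∀ u → ecc G v ≤ ecc G u

center? : (G : Graph n) → Decidable (Center G)
center? G v = all? λ u → ecc G v ≤? ecc G u

-- A subgraph is a set S of vertices together with a set E of edges, the
-- latter given by the rows of its adjacency matrix.
EdgeSet : ℕ → Set
EdgeSet n = Vec (Subset n) n

Edge : EdgeSet n → Rel (Fin n) 0ℓ
Edge E u v = v ∈ₛ lookup E u

edge? : (E : EdgeSet n) → Decidable₂ (Edge E)
edge? E u v = v ∈ₛ? lookup E u

IsSubgraph : Graph n → Subset n × EdgeSet n → Set
IsSubgraph G (S , E) =
  (∀ u v → Edge E u v → Edge E v u) ×
  (∀ u v → Edge E u v → u ∈ₛ S × v ∈ₛ S × Adj G u v)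

IsSubtree : Graph n → Subset n × EdgeSet n → Set
IsSubtree G (S , E) =
  IsSubgraph G (S , E) ×
  Nonempty S ×
  (∀ u v → u ∈ₛ S → v ∈ₛ S → Joined (Edge E) u v)

isSubgraph? : (G : Graph n) → Decidable (IsSubgraph G)
isSubgraph? G (S , E) =
  (all? λ u → all? λ v → edge? E u v →-dec edge? E v u) ×-dec
  (all? λ u → all? λ v → edge? E u v →-dec (u ∈ₛ? S ×-dec v ∈ₛ? S ×-dec adj? G u v))

isSubtree? : (G : Graph n) → Decidable (IsSubtree G)
isSubtree? G (S , E) =
  isSubgraph? G (S , E) ×-dec
  nonempty? S ×-dec
  (all? λ u → all? λ v → (u ∈ₛ? S) →-dec ((v ∈ₛ? S) →-dec joined? (edge? E) u v))

vectors : {A : Set} → List A → ∀ n → List (Vec A n)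
vectors xs zero    = [] ∷ []
vectors xs (suc n) = cartesianProductWith _∷_ xs (vectors xs n)

candidates : ∀ n → List (Subset n × EdgeSet n)
candidates n = cartesianProduct subsets (vectors subsets n)
  where
  subsets : List (Subset n)
  subsets = vectors (true ∷ false ∷ []) n

f : Graph n → Fin n → ℕ
f {n} G v =
  length (filter (λ H → isSubtree? G H ×-dec (v ∈ₛ? proj₁ H)) (candidates n))

Core : Graph n → Pred (Fin n) 0ℓ
Core G v = ∀ u → f G u ≤ f G v

core? : (G : Graph n) → Decidable (Core G)
core? G v = all? λ u → f G u ≤? f G v

d[C,S] : Graph n → ℕ
d[C,S] T = setDist T (center? T) (core? T)

IsRootedBinary : Graph n → Fin n → Set
IsRootedBinary {n} G r =
  IsTree G ×
  (n ≡ 1 ⊎ (deg G r ≡ 2 × (∀ v → v ≢ r → deg G v ≡ 1 ⊎ deg G v ≡ 3)))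

module Rooted (G : Graph n) (r : Fin n) where

  height : Fin n → ℕ
  height v = dist G v r

  Level : ℕ → Set
  Level k = ∃ λ v → height v ≡ k

  Parent : Rel (Fin n) 0ℓ
  Parent u v = Adj G u v × height v ≡ suc (height u)

  -- Only vertices of the same level ≥ 1 are compared; the restriction of
  -- _≺_ to other pairs is irrelevant.
  record Ordering : Set₁ where
    field
      _≺_      : Rel (Fin n) 0ℓ
      linear   : ∀ k → IsStrictTotalOrder {A = Level (suc k)} (_≡_ on proj₁) (_≺_ on proj₁)
      respects : ∀ {u v p q} → height u ≡ height v → Parent p u → Parent q v →
                 p ≢ q → u ≺ v ⇔ p ≺ q

  -- The highest level is ecc G r.
  HighestParent : Pred (Fin n) 0ℓ
  HighestParent u = ∃ λ v → Pendant G v × height v ≡ ecc G r × Parent u v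

  open Ordering

  FinalSegment : Ordering → Set
  FinalSegment o = ∀ u w → suc (height u) ≡ ecc G r → suc (height w) ≡ ecc G r →
                   HighestParent u → _≺_ o u w → HighestParent w

record IsRgood (G : Graph n) (r : Fin n) : Set₁ where
  open Rooted G r
  field
    rootedBinary : IsRootedBinary G r
    balanced     : ∀ u v → Pendant G u → Pendant G v → height u ≤ suc (height v)
    orderable    : Σ Ordering FinalSegment

-- IsR l x states that R_l = x.  The rgood tree on l vertices is determined
-- only up to isomorphism, so T_rg^l is any rgood tree on Fin l.
IsR : ℕ → ℕ → Set₁
IsR l x = Σ (Graph l) λ G → Σ (Fin l) λ r → IsRgood G r × f G r ≡ x

-- R_l > 3 × 2^((n-l-1)/2) - 2; the subtractions are exact for l < n.
Exceeds : ℕ → ℕ → Set₁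
Exceeds n l = ∃ λ x → IsR l x × 3 * 2 ^ ((n ∸ l ∸ 1) / 2) ∸ 2 < x

IsSmallestOdd : Pred ℕ (L.suc 0ℓ) → ℕ → Set₁
IsSmallestOdd P l = 2 ∤ l × P l × (∀ k → 2 ∤ k → k < l → ¬ P k)

IsBinaryCaterpillar : Graph n → Set
IsBinaryCaterpillar G =
  IsBinary G ×
  ∃ λ vs → IsPath G vs × (∀ v → v ∉ vs → Any (Adj G v) vs)

MaxEcc : Graph n → Pred (Fin n) 0ℓ
MaxEcc G v = ∀ u → ecc G u ≤ ecc G v

-- T is, up to isomorphism, the disjoint union of A and B with the vertices
-- a and b identified.
record IsIdentification (A : Graph k) (a : Fin k) (B : Graph l) (b : Fin l)
                        (T : Graph n) : Set where
  field
    ι     : Fin k → Fin n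
    κ     : Fin l → Fin n
    ι-inj : Injective _≡_ _≡_ ι
    κ-inj : Injective _≡_ _≡_ κ
    cover : ∀ z → (∃ λ x → ι x ≡ z) ⊎ (∃ λ y → κ y ≡ z)
    meet  : ∀ x y → ι x ≡ κ y ⇔ (x ≡ a × y ≡ b)
    edges : ∀ z z' → Adj T z z' ⇔
            ((∃₂ λ x x' → ι x ≡ z × ι x' ≡ z' × Adj A x x') ⊎
             (∃₂ λ y y' → κ y ≡ z × κ y' ≡ z' × Adj B y y'))

-- T is (isomorphic to) T_rg^{n,l}, for l < n.
record IsCrg (l : ℕ) (T : Graph n) : Set₁ where
  field
    A           : Graph l
    root        : Fin l
    rgood       : IsRgood A root
    B           : Graph (n ∸ l + 1)
    end         : Fin (n ∸ l + 1)
    caterpillar : IsBinaryCaterpillar B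
    maxEcc      : MaxEcc B end
    identified  : IsIdentification A root B end T

{-# OPTIONS --safe #-}

-- Let c_k = 3 · 2^k − 2, the number of subtrees containing the end of a binary
-- caterpillar with k inner vertices. Crossing an edge of a tree increases f
-- exactly when the side entered has more subtrees containing its endpoint of the
-- edge, so f can be maximized greedily. In T_rg^{n,m} the caterpillar leaves
-- k = (n − m − 1)/2 inner vertices beyond the root of the rgood tree, and f grows
-- into the caterpillar when R_m < c_k. When m increases by 2, R_m + 2 grows at
-- least by a factor of 2 and c_k + 2 is halved.
--
-- If m < l, the core therefore contains a vertex of the caterpillar at distance
-- at least (l − m)/2 from the root or meets the center, whereas passing from l
-- to m shifts the center away from the root by at most (l − m)/2. If m ≥ l and
-- the root lies in the core, the center is at most as far from the root as for l.
-- Otherwise the core contains the root of the larger subtree below the root; that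
-- subtree is itself rgood and exceeds its threshold, so l is at most its size,
-- which moves the center for l farther than the one step lost.
module Submission where

open import Data.Bool.Base using (true; false)
open import Data.Empty using (⊥; ⊥-elim)
open import Data.Fin.Base as Fin using (Fin; toℕ; fromℕ<)
open import Data.Fin.Properties using (_≟_; <-isStrictTotalOrder; toℕ<n; toℕ-injective; toℕ-fromℕ<)
open import Data.Fin.Subset using (Subset) renaming (_∈_ to _∈ₛ_)
open import Data.Fin.Subset.Properties using (⊆-antisym) renaming (_∈?_ to _∈ₛ?_)
open import Data.List.Base using (List; []; _∷_; _++_; _∷ʳ_; map; filter; length; allFin; concatMap; cartesianProduct; cartesianProductWith)
open import Data.List.Extrema.Nat using (max≤v⁺; v≤max⁺; min≤v⁺; v≤min⁺)
open import Data.List.Membership.Propositional using (_∈_; _∉_; find; lose)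
open import Data.List.Membership.Propositional.Properties
open import Data.List.Properties using (length-++; length-map; length-tabulate; map-++; ++-assoc; ++-identityʳ; concatMap-++)
open import Data.List.Relation.Binary.Permutation.Propositional as Perm using (_↭_)
open import Data.List.Relation.Binary.Permutation.Propositional.Properties using (∈-resp-↭; All-resp-↭; shift; shifts) renaming (map⁺ to ↭-map⁺; ++⁺ˡ to ↭-++⁺ˡ)
open import Data.List.Relation.Unary.All as All using (All; []; _∷_)
import Data.List.Relation.Unary.All.Properties as Allₚ
open import Data.List.Relation.Unary.AllPairs using ([]; _∷_)
open import Data.List.Relation.Unary.Any as Any using (Any; here; there)
open import Data.List.Relation.Unary.Linked using (Linked; []; [-]; _∷_)
open import Data.List.Relation.Unary.Unique.Propositional using (Unique)
import Data.List.Relation.Unary.Unique.Propositional.Properties as Uniqueₚ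
open import Data.Nat using (ℕ; zero; suc; _+_; _*_; _^_; _∸_; _⊔_; _⊓_; _≤_; _<_; z≤n; s≤s; s≤s⁻¹; z<s; ⌊_/2⌋; >-nonZero)
open import Data.Nat.Divisibility using (_∣_; _∤_; divides)
open import Data.Nat.DivMod using (_/_; m*n/n≡m)
open import Data.Nat.Logarithm using (⌊log₂_⌋; ⌊log₂⌋-mono-≤; ⌊log₂⌊n/2⌋⌋≡⌊log₂n⌋∸1)
open import Data.Nat.Properties hiding (<-isStrictTotalOrder) renaming (_≟_ to _≟ℕ_)
open import Data.Nat.Solver using (module +-*-Solver)
open import Data.Product.Base using (Σ; ∃; ∃₂; _×_; _,_; proj₁; proj₂; uncurry)
open import Data.Sum.Base as Sum using (_⊎_; inj₁; inj₂; [_,_]′)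
open import Data.Vec.Base as Vec using (Vec; []; _∷_; lookup)
import Data.Vec.Properties as Vecₚ
open import Function.Base using (_∘_; id; case_of_)
open import Function.Bundles using (_⇔_; mk⇔; Equivalence)
open import Level using (0ℓ)
import Relation.Binary.Construct.Flip.EqAndOrd as Flip
import Relation.Binary.Construct.On as On
open import Relation.Binary.Core using (Rel)
open import Relation.Binary.Definitions using (Decidable; tri<; tri≈; tri>)
open import Relation.Binary.PropositionalEquality
open import Relation.Binary.Structures using (IsStrictTotalOrder)
open import Relation.Nullary using (¬_; yes; no; does)
open import Relation.Nullary.Decidable using (_×-dec_; _⊎-dec_; dec-true)
import Relation.Unary as U
open import Defs

open Equivalence using (to; from)
open +-*-Solver using (solve; con; _:+_; _:*_; _:=_)

-- Origin of the `+ 2`: passing one vertex along the caterpillar replaces a count g by 2(1 + g), and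
-- the shift by 2 turns this into exact doubling. So the steps of a walk and the changes of m can be
-- compared as powers of 2.
--
-- No distance between center and core is computed exactly. The number `offset kₗ (H iₗ)` is a lower
-- bound for the tree belonging to l, where every center and every core vertex must be controlled,
-- and an upper bound for each crg tree on n vertices, where one center and one core vertex suffice.
--
-- Two features of the definitions shape the rest. R_l is read off from an arbitrary rgood tree, so
-- the ordering condition must be turned into a recursive shape that determines the count; and rgood
-- trees of all odd sizes must be exhibited, since otherwise minimality of l would say nothing about
-- smaller sizes. Moreover `f` filters a list of all vertex and edge sets, so graphs are converted
-- to labelled binary trees hanging from a vertex, where counting is a product and changing the
-- vertex is a rearrangement.

-- Lists, walks and distances

remove : ∀ {A : Set} {y : A} {ys} → y ∈ ys → List A
remove {ys = _ ∷ ys} (here _)  = ys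
remove {ys = x ∷ _}  (there p) = x ∷ remove p

length-remove : ∀ {A : Set} {y : A} {ys} (p : y ∈ ys) → suc (length (remove p)) ≡ length ys
length-remove (here _)  = refl
length-remove (there p) = cong suc (length-remove p)

∈-remove : ∀ {A : Set} {x y : A} {ys} (p : y ∈ ys) → x ≢ y → x ∈ ys → x ∈ remove p
∈-remove (here refl) x≢y (here refl) = ⊥-elim (x≢y refl)
∈-remove (here _)    x≢y (there q)   = q
∈-remove (there p)   x≢y (here e)    = here e
∈-remove (there p)   x≢y (there q)   = there (∈-remove p x≢y q)

unique-length-≤ : ∀ {A : Set} {xs ys : List A} → Unique xs → (∀ {z} → z ∈ xs → z ∈ ys) → length xs ≤ length ys
unique-length-≤ [] sub = z≤n
unique-length-≤ {xs = x ∷ xs} {ys} ux@(_ ∷ u) sub =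
  subst (suc (length xs) ≤_) (length-remove x∈)
    (s≤s (unique-length-≤ u λ z∈ → ∈-remove x∈ (λ { refl → Uniqueₚ.Unique[x∷xs]⇒x∉xs ux z∈ }) (sub (there z∈))))
  where x∈ = sub (here refl)

unique-length : ∀ {A : Set} {xs ys : List A} → Unique xs → Unique ys → (∀ {z} → z ∈ xs ⇔ z ∈ ys) → length xs ≡ length ys
unique-length u v e = ≤-antisym (unique-length-≤ u (to e)) (unique-length-≤ v (from e))

Unique-resp-↭ : ∀ {A : Set} {xs ys : List A} → xs ↭ ys → Unique xs → Unique ys
Unique-resp-↭ Perm.refl u = u
Unique-resp-↭ (Perm.prep x p) (x∉ ∷ u) = All-resp-↭ p x∉ ∷ Unique-resp-↭ p u
Unique-resp-↭ (Perm.swap x y p) ((x≢y ∷ x∉) ∷ y∉ ∷ u) =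
  ((x≢y ∘ sym) ∷ All-resp-↭ p y∉) ∷ All-resp-↭ p x∉ ∷ Unique-resp-↭ p u
Unique-resp-↭ (Perm.trans p q) u = Unique-resp-↭ q (Unique-resp-↭ p u)

unique-++⁻ : ∀ {A : Set} (xs : List A) {ys} → Unique (xs ++ ys) →
             Unique xs × Unique ys × (∀ {z} → z ∈ xs → z ∉ ys)
unique-++⁻ []       u        = [] , u , λ ()
unique-++⁻ (x ∷ xs) (x∉ ∷ u) with unique-++⁻ xs u
... | uxs , uys , disj = Allₚ.++⁻ˡ xs x∉ ∷ uxs , uys ,
      λ { (here refl) z∈ → All.lookup (Allₚ.++⁻ʳ xs x∉) z∈ refl ; (there p) → disj p }

module _ {A : Set} {R : Rel A 0ℓ} where

  infixr 5 _⁀_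
  _⁀_ : ∀ {i j x y z} → Walk R i x y → Walk R j y z → Walk R (i + j) x z
  []      ⁀ w = w
  (e ∷ v) ⁀ w = e ∷ (v ⁀ w)

  _∷ʳʷ_ : ∀ {k x y z} → Walk R k x y → R y z → Walk R (suc k) x z
  []      ∷ʳʷ e′ = e′ ∷ []
  (e ∷ w) ∷ʳʷ e′ = e ∷ (w ∷ʳʷ e′)

  reverse-walk : (∀ {x y} → R x y → R y x) → ∀ {k x y} → Walk R k x y → Walk R k y x
  reverse-walk s []      = []
  reverse-walk s (e ∷ w) = reverse-walk s w ∷ʳʷ s e

  data Path : A → A → List A → Set where
    [_] : ∀ x → Path x x (x ∷ [])
    cons : ∀ {x y z zs} → R x z → Path z y zs → x ∉ zs → Path x y (x ∷ zs)

  path-suffix : ∀ {x y z zs} → Path z y zs → x ∈ zs → ∃ λ xs → Path x y xs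
  path-suffix p@([ _ ])      (here refl) = _ , p
  path-suffix p@(cons _ _ _) (here refl) = _ , p
  path-suffix (cons _ p _)   (there x∈)  = path-suffix p x∈

  path-unique : ∀ {x y xs} → Path x y xs → Unique xs
  path-unique [ x ]         = [] ∷ []
  path-unique (cons _ p x∉) = Allₚ.¬Any⇒All¬ _ x∉ ∷ path-unique p

  path-walk : ∀ {x y xs} → Path x y xs → ∃ λ k → suc k ≡ length xs × Walk R k x y
  path-walk [ x ] = 0 , refl , []
  path-walk (cons e p _) with path-walk p
  ... | k , eq , w = suc k , cong suc eq , e ∷ w

walk-map : ∀ {A : Set} {R S : Rel A 0ℓ} → (∀ {x y} → R x y → S x y) → ∀ {k x y} → Walk R k x y → Walk S k x y
walk-map g []      = []
walk-map g (e ∷ w) = g e ∷ walk-map g w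

module _ {n : ℕ} {R : Rel (Fin n) 0ℓ} where

  -- Loop erasure: if the new start vertex already lies on the path, the part before that occurrence
  -- is dropped. This bounds distances by the number of vertices.
  path-erase : ∀ {k x y} → Walk R k x y → ∃ λ xs → Path {R = R} x y xs
  path-erase [] = _ , [ _ ]
  path-erase {x = x} (e ∷ w) with path-erase w
  ... | zs , p with Any.any? (x ≟_) zs
  ...   | yes x∈ = path-suffix p x∈
  ...   | no x∉  = _ , cons e p x∉

  unique-length≤n : {xs : List (Fin n)} → Unique xs → length xs ≤ n
  unique-length≤n {xs} u = ≤-trans (unique-length-≤ u λ {z} _ → ∈-allFin z) (≤-reflexive (length-tabulate id))

  short-walk : ∀ {x y} → Joined R x y → ∃ λ k → k < n × Walk R k x y
  short-walk (_ , w) = let _ , p = path-erase w ; k , eq , w′ = path-walk p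
                       in k , subst (_≤ n) (sym eq) (unique-length≤n (path-unique p)) , w′

least-≤ : ∀ {P : ℕ → Set} (P? : U.Decidable P) b {k} → P k → least P? b ≤ k
least-≤ P? zero    p = z≤n
least-≤ P? (suc b) {k} p with P? zero
... | yes _ = z≤n
least-≤ P? (suc b) {zero}  p | no ¬p = ⊥-elim (¬p p)
least-≤ P? (suc b) {suc k} p | no ¬p = s≤s (least-≤ (λ i → P? (suc i)) b p)

least-sat : ∀ {P : ℕ → Set} (P? : U.Decidable P) b {k} → k < b → P k → P (least P? b)
least-sat P? (suc b) {k} k<b p with P? zero
... | yes p₀ = p₀
least-sat P? (suc b) {zero}  k<b p | no ¬p = ⊥-elim (¬p p)
least-sat P? (suc b) {suc k} k<b p | no ¬p = least-sat (λ i → P? (suc i)) b (s≤s⁻¹ k<b) p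

module _ {n : ℕ} (G : Graph n) where

  dist-≤ : ∀ {k x y} → Walk (Adj G) k x y → dist G x y ≤ k
  dist-≤ w = least-≤ (λ k → walk? (adj? G) k _ _) n w

  dist-walk : ∀ {x y} → Joined (Adj G) x y → Walk (Adj G) (dist G x y) x y
  dist-walk {x} {y} j = let k , k<n , w = short-walk j
                        in least-sat (λ k → walk? (adj? G) k x y) n k<n w

  dist<n : ∀ {x y} → Joined (Adj G) x y → dist G x y < n
  dist<n j = let k , k<n , w = short-walk j in ≤-<-trans (dist-≤ w) k<n

  dist≤ecc : ∀ u v → dist G u v ≤ ecc G v
  dist≤ecc u v = v≤max⁺ 0 (map (λ u → dist G u v) (allFin n)) (inj₂ (lose (∈-map⁺ (λ u → dist G u v) (∈-allFin u)) ≤-refl))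

  ecc≤ : ∀ {v k} → (∀ u → dist G u v ≤ k) → ecc G v ≤ k
  ecc≤ {v} h = max≤v⁺ {xs = map (λ u → dist G u v) (allFin n)} z≤n (Allₚ.map⁺ (All.tabulate λ {u} _ → h u))

  module _ {X Y : U.Pred (Fin n) 0ℓ} (X? : U.Decidable X) (Y? : U.Decidable Y) where

    setDist-≤ : ∀ {x y k} → X x → Y y → dist G x y ≤ k → setDist G X? Y? ≤ k
    setDist-≤ {x} {y} px py le =
      min≤v⁺ n _ (inj₂ (lose (∈-map⁺ _ (∈-cartesianProduct⁺ (∈-filter⁺ X? (∈-allFin x) px)
                                                            (∈-filter⁺ Y? (∈-allFin y) py))) le))

    setDist-≥ : ∀ {k} → k ≤ n → (∀ {x y} → X x → Y y → k ≤ dist G x y) → k ≤ setDist G X? Y?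
    setDist-≥ {k} k≤n h = v≤min⁺ k≤n (Allₚ.map⁺ (All.tabulate go))
      where
      go : ∀ {xy} → xy ∈ cartesianProduct (filter X? (allFin n)) (filter Y? (allFin n)) →
           k ≤ dist G (proj₁ xy) (proj₂ xy)
      go p = let p₁ , p₂ = ∈-cartesianProduct⁻ (filter X? (allFin n)) (filter Y? (allFin n)) p
             in h (proj₂ (∈-filter⁻ X? {xs = allFin n} p₁)) (proj₂ (∈-filter⁻ Y? {xs = allFin n} p₂))

  Neighbours : Fin n → List (Fin n) → Set
  Neighbours v xs = ∀ {y} → Adj G v y ⇔ y ∈ xs

  deg≡length : ∀ {v xs} → Unique xs → Neighbours v xs → deg G v ≡ length xs
  deg≡length {v} u nb = unique-length (Uniqueₚ.filter⁺ (adj? G v) (Uniqueₚ.allFin⁺ n)) u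
    (mk⇔ (λ p → to nb (proj₂ (∈-filter⁻ (adj? G v) {xs = allFin n} p))) (λ p → ∈-filter⁺ (adj? G v) (∈-allFin _) (from nb p)))

  adjacents : Fin n → List (Fin n)
  adjacents v = filter (adj? G v) (allFin n)

  adjacents-neighbours : ∀ v → Neighbours v (adjacents v)
  adjacents-neighbours v = mk⇔ (∈-filter⁺ (adj? G v) (∈-allFin _)) (λ p → proj₂ (∈-filter⁻ (adj? G v) {xs = allFin n} p))

  adjacents-unique : ∀ v → Unique (adjacents v)
  adjacents-unique v = Uniqueₚ.filter⁺ (adj? G v) (Uniqueₚ.allFin⁺ n)

-- Trees given by their branches at a vertex

-- Apart from the vertex a tree is hung from, all degrees are 1 or 3, so each branch is a leaf or
-- splits into exactly two. The order of the two children carries no meaning.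
data LT (V : Set) : Set where
  leaf : V → LT V
  node : V → LT V → LT V → LT V

root : ∀ {V} → LT V → V
root (leaf v)     = v
root (node v _ _) = v

verts : ∀ {V} → LT V → List V
verts (leaf v)     = v ∷ []
verts (node v a b) = v ∷ verts a ++ verts b

root∈verts : ∀ {V} (t : LT V) → root t ∈ verts t
root∈verts (leaf _)     = here refl
root∈verts (node _ _ _) = here refl

-- A vertex of `t` is addressed as the subtree below it, so that its depth and what hangs from it
-- are available together.
data Occ {V : Set} : LT V → ℕ → LT V → Set where
  here  : ∀ {t} → Occ t 0 t
  left  : ∀ {v a b j s} → Occ a j s → Occ (node v a b) (suc j) s
  right : ∀ {v a b j s} → Occ b j s → Occ (node v a b) (suc j) s

occ⇒∈ : ∀ {V} {t : LT V} {j s} → Occ t j s → root s ∈ verts t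
occ⇒∈ {s = s} here = root∈verts s
occ⇒∈ (left o) = there (∈-++⁺ˡ (occ⇒∈ o))
occ⇒∈ (right o) = there (∈-++⁺ʳ _ (occ⇒∈ o))

∈⇒occ : ∀ {V} (t : LT V) {x} → x ∈ verts t → ∃₂ λ j s → Occ t j s × root s ≡ x
∈⇒occ (leaf _) (here refl) = 0 , _ , here , refl
∈⇒occ (node _ _ _) (here refl) = 0 , _ , here , refl
∈⇒occ (node _ a b) (there p) with ∈-++⁻ (verts a) p
... | inj₁ q = let j , s , o , e = ∈⇒occ a q in suc j , s , left o , e
... | inj₂ q = let j , s , o , e = ∈⇒occ b q in suc j , s , right o , e

ht : ∀ {V} → LT V → ℕ
ht (leaf _)     = 0
ht (node _ a b) = suc (ht a ⊔ ht b)

-- The number of subtrees containing the root.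
F : ∀ {V} → LT V → ℕ
F (leaf _)     = 1
F (node _ a b) = suc (F a) * suc (F b)

inner : ∀ {V} → LT V → ℕ
inner (leaf _)     = 0
inner (node _ a b) = suc (inner a + inner b)

length-verts : ∀ {V} (t : LT V) → length (verts t) ≡ suc (2 * inner t)
length-verts (leaf _) = refl
length-verts (node _ a b) = cong suc (trans (length-++ (verts a)) (trans (cong₂ _+_ (length-verts a) (length-verts b))
  (solve 2 (λ x y → con 1 :+ con 2 :* x :+ (con 1 :+ con 2 :* y) := con 2 :* (con 1 :+ (x :+ y))) refl (inner a) (inner b))))
  where open +-*-Solver

occ-ht : ∀ {V} {t : LT V} {j s} → Occ t j s → j + ht s ≤ ht t
occ-ht here      = ≤-refl
occ-ht (left o)  = s≤s (≤-trans (occ-ht o) (m≤m⊔n _ _))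
occ-ht (right o) = s≤s (≤-trans (occ-ht o) (m≤n⊔m _ _))

occ-depth : ∀ {V} {t : LT V} {j s} → Occ t j s → j ≤ ht t
occ-depth o = ≤-trans (m≤m+n _ _) (occ-ht o)

deepest : ∀ {V} (t : LT V) → ∃ λ v → Occ t (ht t) (leaf v)
deepest (leaf v) = v , here
deepest (node _ a b) with ⊔-sel (ht a) (ht b)
... | inj₁ e = let v , o = deepest a in v , subst (λ j → Occ _ (suc j) _) (sym e) (left o)
... | inj₂ e = let v , o = deepest b in v , subst (λ j → Occ _ (suc j) _) (sym e) (right o)

F-positive : ∀ {V} (t : LT V) → 1 ≤ F t
F-positive (leaf _)     = ≤-refl
F-positive (node _ _ _) = s≤s z≤n

mapLT : ∀ {V W : Set} → (V → W) → LT V → LT W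
mapLT g (leaf v)     = leaf (g v)
mapLT g (node v a b) = node (g v) (mapLT g a) (mapLT g b)

module _ {V W : Set} (g : V → W) where

  root-map : ∀ t → root (mapLT g t) ≡ g (root t)
  root-map (leaf _)     = refl
  root-map (node _ _ _) = refl

  verts-map : ∀ t → verts (mapLT g t) ≡ map g (verts t)
  verts-map (leaf _)     = refl
  verts-map (node v a b) = cong (g v ∷_) (trans (cong₂ _++_ (verts-map a) (verts-map b)) (sym (map-++ g (verts a) (verts b))))

  F-map : ∀ t → F (mapLT g t) ≡ F t
  F-map (leaf _)     = refl
  F-map (node _ a b) = cong₂ (λ x y → suc x * suc y) (F-map a) (F-map b)

  ht-map : ∀ t → ht (mapLT g t) ≡ ht t
  ht-map (leaf _)     = refl
  ht-map (node _ a b) = cong₂ (λ x y → suc (x ⊔ y)) (ht-map a) (ht-map b)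

  inner-map : ∀ t → inner (mapLT g t) ≡ inner t
  inner-map (leaf _)     = refl
  inner-map (node _ a b) = cong₂ (λ x y → suc (x + y)) (inner-map a) (inner-map b)

vertsₗ : ∀ {V} → List (LT V) → List V
vertsₗ = concatMap verts

vertsₗ-↭ : ∀ {V} {ts us : List (LT V)} → ts ↭ us → vertsₗ ts ↭ vertsₗ us
vertsₗ-↭ Perm.refl = Perm.refl
vertsₗ-↭ (Perm.prep t p) = ↭-++⁺ˡ (verts t) (vertsₗ-↭ p)
vertsₗ-↭ (Perm.swap {xs} t u p) =
  Perm.trans (shifts (verts t) (verts u) {vertsₗ xs}) (↭-++⁺ˡ (verts u) (↭-++⁺ˡ (verts t) (vertsₗ-↭ p)))
vertsₗ-↭ (Perm.trans p q) = Perm.trans (vertsₗ-↭ p) (vertsₗ-↭ q)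

∈-vertsₗ : ∀ {V} {x : V} {t ts} → t ∈ ts → x ∈ verts t → x ∈ vertsₗ ts
∈-vertsₗ t∈ x∈ = ∈-concatMap⁺ verts (lose t∈ x∈)

module _ {n : ℕ} (G : Graph n) where

  -- t is the component of G − u that contains the neighbour root t of u.
  Fits : Fin n → LT (Fin n) → Set
  Fits u (leaf v)     = Neighbours G v (u ∷ [])
  Fits u (node v a b) = Neighbours G v (u ∷ root a ∷ root b ∷ []) × Fits v a × Fits v b

  -- By `uniq` and `full` the branches partition the vertices other than `v`; with `nbrs` and `fits`
  -- the adjacency of every vertex is known. Distances, eccentricities and `f` can be read off.
  record Branches (v : Fin n) (ts : List (LT (Fin n))) : Set where
    constructor branches
    field
      nbrs : Neighbours G v (map root ts)
      fits : All (Fits v) ts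
      uniq : Unique (v ∷ vertsₗ ts)
      full : ∀ x → x ∈ v ∷ vertsₗ ts

module _ {n : ℕ} {G : Graph n} where

  permute : ∀ {v ts us} → ts ↭ us → Branches G v ts → Branches G v us
  permute p (branches nb ft (v∉ ∷ u) fl) = branches
    (mk⇔ (∈-resp-↭ p′ ∘ to nb) (from nb ∘ ∈-resp-↭ (Perm.↭-sym p′)))
    (All-resp-↭ p ft) (All-resp-↭ (vertsₗ-↭ p) v∉ ∷ Unique-resp-↭ (vertsₗ-↭ p) u)
    (λ x → ∈-resp-↭ (Perm.prep _ (vertsₗ-↭ p)) (fl x))
    where p′ = ↭-map⁺ root p

  Neighbours-↭ : ∀ {v xs ys} → xs ↭ ys → Neighbours G v xs → Neighbours G v ys
  Neighbours-↭ p nb = mk⇔ (∈-resp-↭ p ∘ to nb) (from nb ∘ ∈-resp-↭ (Perm.↭-sym p))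

  -- The edge between `r` and `v` is turned around: the old root becomes the top of a branch that
  -- carries its two other branches. Comparisons between neighbours are made this way.
  reroot : ∀ {r v a b c d} → Branches G r (node v a b ∷ c ∷ d ∷ []) → Branches G v (a ∷ b ∷ node r c d ∷ [])
  reroot {r} {v} {a} {b} {c} {d} (branches nb ((nbv , fa , fb) ∷ fc ∷ fd ∷ []) u fl) = branches
    (Neighbours-↭ (shift₃ r (root a) (root b)) nbv)
    (fa ∷ fb ∷ (nb , fc , fd) ∷ [])
    (Unique-resp-↭ σ u) (λ x → ∈-resp-↭ σ (fl x))
    where
    shift₃ : ∀ {X : Set} (x y z : X) → x ∷ y ∷ z ∷ [] ↭ y ∷ z ∷ x ∷ []
    shift₃ x y z = Perm.trans (Perm.swap x y Perm.refl) (Perm.prep y (Perm.swap x z Perm.refl))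
    A B C : List (Fin n)
    A = verts a
    B = verts b
    C = verts c ++ verts d ++ []
    σ : r ∷ (v ∷ A ++ B) ++ C ↭ v ∷ A ++ B ++ (r ∷ verts c ++ verts d) ++ []
    σ = Perm.trans (Perm.swap r v Perm.refl) (Perm.prep v (subst (r ∷ (A ++ B) ++ C ↭_) eq (Perm.↭-sym (shift r (A ++ B) C))))
      where
      eq : (A ++ B) ++ r ∷ C ≡ A ++ B ++ (r ∷ verts c ++ verts d) ++ []
      eq = trans (++-assoc A B (r ∷ C)) (cong (λ l → A ++ B ++ r ∷ l) (sym (++-assoc (verts c) (verts d) [])))

  reroot₁ : ∀ {r v a b} → Branches G r (node v a b ∷ []) → Branches G v (a ∷ b ∷ leaf r ∷ [])
  reroot₁ {r} {v} {a} {b} (branches nb ((nbv , fa , fb) ∷ []) u fl) = branches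
    (Neighbours-↭ (Perm.trans (Perm.swap r (root a) Perm.refl) (Perm.prep (root a) (Perm.swap r (root b) Perm.refl))) nbv)
    (fa ∷ fb ∷ nb ∷ [])
    (Unique-resp-↭ σ u) (λ x → ∈-resp-↭ σ (fl x))
    where
    σ : r ∷ (v ∷ verts a ++ verts b) ++ [] ↭ v ∷ verts a ++ verts b ++ r ∷ []
    σ = Perm.trans (Perm.swap r v Perm.refl) (Perm.prep v (subst (r ∷ (verts a ++ verts b) ++ [] ↭_) (++-assoc (verts a) (verts b) (r ∷ [])) (Perm.↭-sym (shift r (verts a ++ verts b) []))))

  reroot-leaf : ∀ {r v c d} → Branches G r (leaf v ∷ c ∷ d ∷ []) → Branches G v (node r c d ∷ [])
  reroot-leaf {r} {v} {c} {d} (branches nb (nbv ∷ fc ∷ fd ∷ []) u fl) = branches nbv ((nb , fc , fd) ∷ [])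
    (Unique-resp-↭ σ u) (λ x → ∈-resp-↭ σ (fl x))
    where
    σ : r ∷ v ∷ verts c ++ verts d ++ [] ↭ v ∷ (r ∷ verts c ++ verts d) ++ []
    σ = Perm.trans (Perm.swap r v Perm.refl) (Perm.prep v (Perm.prep r (Perm.↭-reflexive (sym (++-assoc (verts c) (verts d) [])))))

  swap₁₂ : ∀ {x a b ts} → Branches G x (a ∷ b ∷ ts) → Branches G x (b ∷ a ∷ ts)
  swap₁₂ {a = a} {b} = permute (Perm.swap a b Perm.refl)

  swap₂₃ : ∀ {x a b c ts} → Branches G x (a ∷ b ∷ c ∷ ts) → Branches G x (a ∷ c ∷ b ∷ ts)
  swap₂₃ {a = a} {b} {c} = permute (Perm.prep a (Perm.swap b c Perm.refl))

  to-front : ∀ {x a b c ts} → Branches G x (a ∷ b ∷ c ∷ ts) → Branches G x (c ∷ a ∷ b ∷ ts)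
  to-front = swap₁₂ ∘ swap₂₃

  root∉ : ∀ {v ts t} → Branches G v ts → t ∈ ts → v ∉ verts t
  root∉ R t∈ v∈ = Uniqueₚ.Unique[x∷xs]⇒x∉xs (Branches.uniq R) (∈-vertsₗ t∈ v∈)

  disjoint-branches : ∀ {r t u ts x} → Branches G r (t ∷ ts) → u ∈ ts → x ∈ verts t → x ∉ verts u
  disjoint-branches {t = t} (branches _ _ (_ ∷ uq) _) u∈ x∈t x∈u =
    proj₂ (proj₂ (unique-++⁻ (verts t) uq)) x∈t (∈-vertsₗ u∈ x∈u)

  rooted-size : ∀ {v ts} → Branches G v ts → suc (length (vertsₗ ts)) ≡ n
  rooted-size (branches _ _ u fl) =
    trans (unique-length u (Uniqueₚ.allFin⁺ n) (λ {z} → mk⇔ (λ _ → ∈-allFin z) (λ _ → fl z))) (length-tabulate id)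

  fits-nbr : ∀ {u t} → Fits G u t → Adj G (root t) u
  fits-nbr {t = leaf _} nb = from nb (here refl)
  fits-nbr {t = node _ _ _} (nb , _) = from nb (here refl)

  fits-exit : ∀ {u} t {x y} → Fits G u t → x ∈ verts t → Adj G x y → y ∈ verts t ⊎ (x ≡ root t × y ≡ u)
  fits-exit (leaf v) nb (here refl) e with to nb e
  ... | here y≡u = inj₂ (refl , y≡u)
  fits-exit (node v a b) (nb , _ , _) (here refl) e with to nb e
  ... | here y≡u = inj₂ (refl , y≡u)
  ... | there (here refl) = inj₁ (there (∈-++⁺ˡ (root∈verts a)))
  ... | there (there (here refl)) = inj₁ (there (∈-++⁺ʳ (verts a) (root∈verts b)))
  fits-exit (node v a b) (nb , fa , fb) (there x∈) e with ∈-++⁻ (verts a) x∈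
  ... | inj₁ x∈a with fits-exit a fa x∈a e
  ...   | inj₁ y∈ = inj₁ (there (∈-++⁺ˡ y∈))
  ...   | inj₂ (_ , refl) = inj₁ (here refl)
  fits-exit (node v a b) (nb , fa , fb) (there x∈) e | inj₂ x∈b with fits-exit b fb x∈b e
  ...   | inj₁ y∈ = inj₁ (there (∈-++⁺ʳ (verts a) y∈))
  ...   | inj₂ (_ , refl) = inj₁ (here refl)

  fits-step : ∀ {u t j s y} → Fits G u t → Occ t j s → Adj G (root s) y →
              (∃₂ λ j′ s′ → Occ t j′ s′ × root s′ ≡ y × j ≤ suc j′) ⊎ (j ≡ 0 × y ≡ u)
  fits-step {t = leaf v} nb here e with to nb e
  ... | here y≡u = inj₂ (refl , y≡u)
  fits-step {t = node v a b} (nb , _) here e with to nb e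
  ... | here y≡u = inj₂ (refl , y≡u)
  ... | there (here refl) = inj₁ (1 , a , left here , refl , z≤n)
  ... | there (there (here refl)) = inj₁ (1 , b , right here , refl , z≤n)
  fits-step {t = node v a b} (_ , fa , _) (left o) e with fits-step fa o e
  ... | inj₁ (j , s , o′ , eq , le) = inj₁ (suc j , s , left o′ , eq , s≤s le)
  ... | inj₂ (refl , refl) = inj₁ (0 , _ , here , refl , ≤-refl)
  fits-step {t = node v a b} (_ , _ , fb) (right o) e with fits-step fb o e
  ... | inj₁ (j , s , o′ , eq , le) = inj₁ (suc j , s , right o′ , eq , s≤s le)
  ... | inj₂ (refl , refl) = inj₁ (0 , _ , here , refl , ≤-refl)

  -- Depth drops by at most one per step and the branch can be left only through `u`, so at least
  -- `suc j` steps come before `u`. Lower bounds on distances are taken from this instead of from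
  -- uniqueness of paths.
  walk-exit : ∀ {u t j s k y} → Fits G u t → Occ t j s → y ∉ verts t → Walk (Adj G) k (root s) y →
              ∃ λ k′ → Walk (Adj G) k′ u y × suc j + k′ ≤ k
  walk-exit ft o y∉ [] = ⊥-elim (y∉ (occ⇒∈ o))
  walk-exit {k = suc k} ft o y∉ (e ∷ w) with fits-step ft o e
  ... | inj₂ (refl , refl) = k , w , ≤-refl
  ... | inj₁ (j′ , s′ , o′ , refl , le) with walk-exit ft o′ y∉ w
  ...   | k′ , w′ , le′ = k′ , w′ , s≤s (≤-trans (+-monoˡ-≤ k′ le) le′)

  walk-in : ∀ {u t j s} → Fits G u t → Occ t j s → Walk (Adj G) (suc j) (root s) u
  walk-in {t = t} ft here = fits-nbr {t = t} ft ∷ []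
  walk-in {t = node v a b} (nb , fa , _) (left o)  = walk-in fa o ∷ʳʷ from nb (here refl)
  walk-in {t = node v a b} (nb , _ , fb) (right o) = walk-in fb o ∷ʳʷ from nb (here refl)

  data Position (v : Fin n) (ts : List (LT (Fin n))) : Fin n → Set where
    atRoot   : Position v ts v
    inBranch : ∀ {t j s} → t ∈ ts → Occ t j s → Position v ts (root s)

  position : ∀ {v ts} → Branches G v ts → ∀ x → Position v ts x
  position {ts = ts} R x with Branches.full R x
  ... | here refl = atRoot
  ... | there x∈ with find (∈-concatMap⁻ verts {xs = ts} x∈)
  ...   | t , t∈ , x∈t with ∈⇒occ t x∈t
  ...     | _ , _ , o , refl = inBranch t∈ o

  branch-fits : ∀ {v ts t} → Branches G v ts → t ∈ ts → Fits G v t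
  branch-fits R = All.lookup (Branches.fits R)

  to-root : ∀ {v ts} → Branches G v ts → ∀ x → Joined (Adj G) x v
  to-root R x with position R x
  ... | atRoot         = 0 , []
  ... | inBranch t∈ o = _ , walk-in (branch-fits R t∈) o

  rooted-connected : ∀ {v ts} → Branches G v ts → Connected G
  rooted-connected R x y = _ , proj₂ (to-root R x) ⁀ reverse-walk (symm G) (proj₂ (to-root R y))

  dist-root : ∀ {v ts t j s} → Branches G v ts → t ∈ ts → Occ t j s → dist G (root s) v ≡ suc j
  dist-root {v} {t = t} {s = s} R t∈ o = ≤-antisym (dist-≤ G (walk-in ft o))
    (≤-trans (m≤m+n _ _) (proj₂ (proj₂ (walk-exit ft o (root∉ R t∈) (dist-walk G (rooted-connected R (root s) v))))))
    where ft = branch-fits R t∈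

  ecc-≤ : ∀ {v ts E} → Branches G v ts → All (λ t → suc (ht t) ≤ E) ts → ecc G v ≤ E
  ecc-≤ {v} {ts} {E} R hs = ecc≤ G go
    where
    go : ∀ x → dist G x v ≤ E
    go x with position R x
    ... | atRoot = ≤-trans (dist-≤ G []) z≤n
    ... | inBranch t∈ o = ≤-trans (≤-reflexive (dist-root R t∈ o)) (≤-trans (s≤s (occ-depth o)) (All.lookup hs t∈))

  ecc-≥ : ∀ {v ts t} → Branches G v ts → t ∈ ts → suc (ht t) ≤ ecc G v
  ecc-≥ {v} {t = t} R t∈ = let w , o = deepest t in
    subst (_≤ ecc G v) (dist-root R t∈ o) (dist≤ecc G w v)

  -- A walk from a deepest leaf of `t₁` through `u` to a deepest leaf of `t₂` has length at least 2E
  -- - 1, so twice `ecc G u` is at least 2E - 1, and by parity `ecc G u` is at least `E`. The outer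
  -- `suc` in the hypothesis is this slack of one.
  center : ∀ {v t₁ t₂ t₃ E} → Branches G v (t₁ ∷ t₂ ∷ t₃ ∷ []) →
           All (λ t → suc (ht t) ≤ E) (t₁ ∷ t₂ ∷ t₃ ∷ []) →
           E + E ≤ suc (suc (ht t₁) + suc (ht t₂)) → Center G v
  center {v} {t₁} {t₂} {E = E} R hs dm u = ≤-trans (ecc-≤ R hs) (≮⇒≥ λ lt → <-irrefl refl (contra lt))
    where
    x₁ = proj₁ (deepest t₁)
    x₂ = proj₁ (deepest t₂)
    o₁ = proj₂ (deepest t₁)
    o₂ = proj₂ (deepest t₂)
    w₁ : Walk (Adj G) (dist G x₁ u) x₁ u
    w₁ = dist-walk G (rooted-connected R x₁ u)
    w₂ : Walk (Adj G) (dist G x₂ u) x₂ u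
    w₂ = dist-walk G (rooted-connected R x₂ u)
    f₁ : Fits G v t₁
    f₁ = branch-fits R (here refl)
    f₂ : Fits G v t₂
    f₂ = branch-fits R (there (here refl))
    sum≤ : suc (ht t₁) + suc (ht t₂) ≤ ecc G u + ecc G u
    sum≤ with walk-exit f₁ o₁ (λ x∈ → disjoint-branches R (here refl) x∈ (occ⇒∈ o₂)) (w₁ ⁀ reverse-walk (symm G) w₂)
    ... | k , w , le with walk-exit f₂ o₂ (root∉ R (there (here refl))) (reverse-walk (symm G) w)
    ...   | k′ , _ , le′ = begin
      suc (ht t₁) + suc (ht t₂) ≤⟨ +-monoʳ-≤ (suc (ht t₁)) (≤-trans (m≤m+n _ k′) le′) ⟩
      suc (ht t₁) + k           ≤⟨ le ⟩
      dist G x₁ u + dist G x₂ u ≤⟨ +-mono-≤ (dist≤ecc G x₁ u) (dist≤ecc G x₂ u) ⟩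
      ecc G u + ecc G u ∎
      where open ≤-Reasoning
    contra : ecc G u < E → E + E < E + E
    contra lt = begin-strict
      E + E ≤⟨ dm ⟩
      suc (suc (ht t₁) + suc (ht t₂)) ≤⟨ s≤s sum≤ ⟩
      suc (ecc G u + ecc G u) <⟨ s≤s (≤-reflexive (sym (+-suc (ecc G u) (ecc G u)))) ⟩
      suc (ecc G u) + suc (ecc G u) ≤⟨ +-mono-≤ lt lt ⟩
      E + E ∎
      where open ≤-Reasoning

-- Counting subtrees

length-cartesianProductWith : ∀ {A B C : Set} (g : A → B → C) xs ys →
                              length (cartesianProductWith g xs ys) ≡ length xs * length ys
length-cartesianProductWith g []       ys = refl
length-cartesianProductWith g (x ∷ xs) ys = trans (length-++ (map (g x) ys))
  (cong₂ _+_ (length-map (g x) ys) (length-cartesianProductWith g xs ys))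

vectors-unique : ∀ {A : Set} {xs : List A} → Unique xs → ∀ n → Unique (vectors xs n)
vectors-unique u zero    = [] ∷ []
vectors-unique u (suc n) = Uniqueₚ.cartesianProductWith⁺ Vec._∷_ (λ { refl → refl , refl }) u (vectors-unique u n)

vectors-complete : ∀ {A : Set} {xs : List A} → (∀ x → x ∈ xs) → ∀ {n} (v : Vec A n) → v ∈ vectors xs n
vectors-complete c []      = here refl
vectors-complete c (x ∷ v) = ∈-cartesianProductWith⁺ Vec._∷_ (c x) (vectors-complete c v)

candidates-unique : ∀ n → Unique (candidates n)
candidates-unique n = Uniqueₚ.cartesianProduct⁺ us (vectors-unique us n)
  where
  us : Unique (vectors (true ∷ false ∷ []) n)
  us = vectors-unique (((λ ()) ∷ []) ∷ [] ∷ []) n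

candidates-complete : ∀ {n} (H : Subset n × EdgeSet n) → H ∈ candidates n
candidates-complete (S , E) = ∈-cartesianProduct⁺ (cs S) (vectors-complete cs E)
  where
  cs : ∀ {n} (S : Subset n) → S ∈ vectors (true ∷ false ∷ []) n
  cs = vectors-complete λ { true → here refl ; false → there (here refl) }

⟦_⟧ : ∀ {n} → List (Fin n) → Subset n
⟦ xs ⟧ = Vec.tabulate λ x → does (Any.any? (x ≟_) xs)

∈⟦⟧ : ∀ {n} {xs : List (Fin n)} {x} → x ∈ₛ ⟦ xs ⟧ ⇔ x ∈ xs
∈⟦⟧ {xs = xs} {x} = mk⇔ ⇒ (λ p → Vecₚ.lookup⇒[]= x ⟦ xs ⟧ (trans (Vecₚ.lookup∘tabulate _ x) (dec-true (Any.any? (x ≟_) xs) p)))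
  where
  ⇒ : x ∈ₛ ⟦ xs ⟧ → x ∈ xs
  ⇒ p with Any.any? (x ≟_) xs | trans (sym (Vecₚ.lookup∘tabulate (λ x → does (Any.any? (x ≟_) xs)) x)) (Vecₚ.[]=⇒lookup p)
  ... | yes q | _ = q
  ... | no _  | ()

module _ {n : ℕ} (G : Graph n) where

  induced? : (S : Subset n) → Decidable (λ u w → u ∈ₛ S × w ∈ₛ S × Adj G u w)
  induced? S u w = (u ∈ₛ? S) ×-dec (w ∈ₛ? S) ×-dec adj? G u w

  induced : Subset n → EdgeSet n
  induced S = Vec.tabulate λ u → ⟦ filter (induced? S u) (allFin n) ⟧

  edge-induced : ∀ {S u w} → Edge (induced S) u w ⇔ (u ∈ₛ S × w ∈ₛ S × Adj G u w)
  edge-induced {S} {u} {w} = mk⇔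
    (λ p → proj₂ (∈-filter⁻ (induced? S u) {xs = allFin n} (to ∈⟦⟧ (subst (w ∈ₛ_) eq p))))
    (λ p → subst (w ∈ₛ_) (sym eq) (from ∈⟦⟧ (∈-filter⁺ (induced? S u) (∈-allFin w) p)))
    where eq = Vecₚ.lookup∘tabulate (λ u → ⟦ filter (induced? S u) (allFin n) ⟧) u

edgeSet-ext : ∀ {n} {E E′ : EdgeSet n} → (∀ {u w} → Edge E u w ⇔ Edge E′ u w) → E ≡ E′
edgeSet-ext {E = E} {E′} h = trans (sym (Vecₚ.tabulate∘lookup E)) (trans (Vecₚ.tabulate-cong λ u →
  ⊆-antisym (λ p → to (h {u}) p) (λ p → from (h {u}) p)) (Vecₚ.tabulate∘lookup E′))

-- The connected vertex sets that are contained in t and, unless empty,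
-- contain its root.
data Pruning {V : Set} : LT V → Set where
  none : ∀ {t} → Pruning t
  leaf : ∀ {v} → Pruning (leaf v)
  node : ∀ {v a b} → Pruning a → Pruning b → Pruning (node v a b)

module _ {V : Set} where

  kept : {t : LT V} → Pruning t → List V
  kept none = []
  kept {leaf v} leaf = v ∷ []
  kept {node v _ _} (node p q) = v ∷ kept p ++ kept q

  keptₗ : {ts : List (LT V)} → All Pruning ts → List V
  keptₗ []       = []
  keptₗ (p ∷ ps) = kept p ++ keptₗ ps

  prunings : (t : LT V) → List (Pruning t)
  prunings (leaf v)     = none ∷ leaf ∷ []
  prunings (node v a b) = none ∷ cartesianProductWith node (prunings a) (prunings b)

  pruningsₗ : (ts : List (LT V)) → List (All Pruning ts)
  pruningsₗ []       = [] ∷ []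
  pruningsₗ (t ∷ ts) = cartesianProductWith _∷_ (prunings t) (pruningsₗ ts)

  Fₗ : List (LT V) → ℕ
  Fₗ []       = 1
  Fₗ (t ∷ ts) = suc (F t) * Fₗ ts

  length-prunings : ∀ t → length (prunings t) ≡ suc (F t)
  length-prunings (leaf v) = refl
  length-prunings (node v a b) = cong suc (trans (length-cartesianProductWith node (prunings a) (prunings b))
    (cong₂ _*_ (length-prunings a) (length-prunings b)))

  length-pruningsₗ : ∀ ts → length (pruningsₗ ts) ≡ Fₗ ts
  length-pruningsₗ [] = refl
  length-pruningsₗ (t ∷ ts) = trans (length-cartesianProductWith All._∷_ (prunings t) (pruningsₗ ts))
    (cong₂ _*_ (length-prunings t) (length-pruningsₗ ts))

  prunings-unique : ∀ t → Unique (prunings t)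
  prunings-unique (leaf v) = ((λ ()) ∷ []) ∷ [] ∷ []
  prunings-unique (node v a b) =
    All.tabulate (λ {z} p e → case ∈-cartesianProductWith⁻ node (prunings a) (prunings b) p of λ { (_ , _ , _ , _ , refl) → case e of λ () })
    ∷ Uniqueₚ.cartesianProductWith⁺ node (λ { refl → refl , refl }) (prunings-unique a) (prunings-unique b)

  pruningsₗ-unique : ∀ ts → Unique (pruningsₗ ts)
  pruningsₗ-unique [] = [] ∷ []
  pruningsₗ-unique (t ∷ ts) = Uniqueₚ.cartesianProductWith⁺ All._∷_ (λ { refl → refl , refl }) (prunings-unique t) (pruningsₗ-unique ts)

  prunings-complete : ∀ {t} (p : Pruning t) → p ∈ prunings t
  prunings-complete {leaf _} none = here refl
  prunings-complete {leaf _} leaf = there (here refl)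
  prunings-complete {node _ _ _} none = here refl
  prunings-complete {node _ _ _} (node p q) = there (∈-cartesianProductWith⁺ node (prunings-complete p) (prunings-complete q))

  pruningsₗ-complete : ∀ {ts} (ps : All Pruning ts) → ps ∈ pruningsₗ ts
  pruningsₗ-complete [] = here refl
  pruningsₗ-complete (p ∷ ps) = ∈-cartesianProductWith⁺ All._∷_ (prunings-complete p) (pruningsₗ-complete ps)

  kept⊆verts : ∀ {t} (p : Pruning t) {x} → x ∈ kept p → x ∈ verts t
  kept⊆verts {leaf _} leaf x∈ = x∈
  kept⊆verts {node _ _ _} (node p q) (here e) = here e
  kept⊆verts {node _ a _} (node p q) (there x∈) with ∈-++⁻ (kept p) x∈
  ... | inj₁ y = there (∈-++⁺ˡ (kept⊆verts p y))
  ... | inj₂ y = there (∈-++⁺ʳ (verts a) (kept⊆verts q y))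

  keptₗ⊆vertsₗ : ∀ {ts} (ps : All Pruning ts) {x} → x ∈ keptₗ ps → x ∈ vertsₗ ts
  keptₗ⊆vertsₗ {t ∷ _} (p ∷ ps) x∈ with ∈-++⁻ (kept p) x∈
  ... | inj₁ y = ∈-++⁺ˡ (kept⊆verts p y)
  ... | inj₂ y = ∈-++⁺ʳ (verts t) (keptₗ⊆vertsₗ ps y)

  split-same : ∀ {as bs xs xs′ ys ys′ : List V} → (∀ {z} → z ∈ as → z ∉ bs) →
               (∀ {z} → z ∈ xs → z ∈ as) → (∀ {z} → z ∈ xs′ → z ∈ as) →
               (∀ {z} → z ∈ ys → z ∈ bs) → (∀ {z} → z ∈ ys′ → z ∈ bs) →
               (∀ {z} → z ∈ xs ++ ys → z ∈ xs′ ++ ys′) →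
               (∀ {z} → z ∈ xs → z ∈ xs′) × (∀ {z} → z ∈ ys → z ∈ ys′)
  split-same {xs = xs} {xs′} disj x x′ y y′ h =
    (λ z∈ → [ id , (λ z∈′ → ⊥-elim (disj (x z∈) (y′ z∈′))) ]′ (∈-++⁻ xs′ (h (∈-++⁺ˡ z∈)))) ,
    (λ z∈ → [ (λ z∈′ → ⊥-elim (disj (x′ z∈′) (y z∈))) , id ]′ (∈-++⁻ xs′ (h (∈-++⁺ʳ xs z∈))))

  drop-head : ∀ {v} {xs ys : List V} → v ∉ xs → (∀ {z} → z ∈ v ∷ xs → z ∈ v ∷ ys) → ∀ {z} → z ∈ xs → z ∈ ys
  drop-head v∉ h z∈ with h (there z∈)
  ... | here refl = ⊥-elim (v∉ z∈)
  ... | there z∈′ = z∈′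

  kept-injective : ∀ {t} → Unique (verts t) → (p q : Pruning t) →
                   (∀ {z} → z ∈ kept p → z ∈ kept q) → (∀ {z} → z ∈ kept q → z ∈ kept p) → p ≡ q
  kept-injective u none none h h′ = refl
  kept-injective u none leaf h h′ = case h′ (here refl) of λ ()
  kept-injective u none (node _ _) h h′ = case h′ (here refl) of λ ()
  kept-injective u leaf none h h′ = case h (here refl) of λ ()
  kept-injective u leaf leaf h h′ = refl
  kept-injective u (node _ _) none h h′ = case h (here refl) of λ ()
  kept-injective {node v a b} (v∉ ∷ u) (node p q) (node p′ q′) h h′ =
    let ua , ub , disj = unique-++⁻ (verts a) u
        pq  = split-same disj (kept⊆verts p) (kept⊆verts p′) (kept⊆verts q) (kept⊆verts q′) (drop-head (v∉k p q) h)
        pq′ = split-same disj (kept⊆verts p′) (kept⊆verts p) (kept⊆verts q′) (kept⊆verts q) (drop-head (v∉k p′ q′) h′)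
    in cong₂ node (kept-injective ua p p′ (proj₁ pq) (proj₁ pq′)) (kept-injective ub q q′ (proj₂ pq) (proj₂ pq′))
    where
    v∉k : (p : Pruning a) (q : Pruning b) → v ∉ kept p ++ kept q
    v∉k p q v∈ = Allₚ.All¬⇒¬Any v∉ ([ ∈-++⁺ˡ ∘ kept⊆verts p , ∈-++⁺ʳ (verts a) ∘ kept⊆verts q ]′ (∈-++⁻ (kept p) v∈))

  keptₗ-injective : ∀ {ts} → Unique (vertsₗ ts) → (p q : All Pruning ts) →
                    (∀ {z} → z ∈ keptₗ p → z ∈ keptₗ q) → (∀ {z} → z ∈ keptₗ q → z ∈ keptₗ p) → p ≡ q
  keptₗ-injective u [] [] h h′ = refl
  keptₗ-injective {t ∷ ts} u (p ∷ ps) (q ∷ qs) h h′ =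
    let ut , us , disj = unique-++⁻ (verts t) u
        e  = split-same disj (kept⊆verts p) (kept⊆verts q) (keptₗ⊆vertsₗ ps) (keptₗ⊆vertsₗ qs) h
        e′ = split-same disj (kept⊆verts q) (kept⊆verts p) (keptₗ⊆vertsₗ qs) (keptₗ⊆vertsₗ ps) h′
    in cong₂ All._∷_ (kept-injective ut p q (proj₁ e) (proj₁ e′)) (keptₗ-injective us ps qs (proj₂ e) (proj₂ e′))

module _ {n : ℕ} {G : Graph n} where

  crossing : ∀ {R : Rel (Fin n) 0ℓ} → (∀ {x y} → R x y → Adj G x y) →
             ∀ {u} t {k x y} → Fits G u t → x ∈ verts t → y ∉ verts t → Walk R k x y → R (root t) u
  crossing R⊆ t ft x∈ y∉ [] = ⊥-elim (y∉ x∈)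
  crossing R⊆ t ft x∈ y∉ (e ∷ w) with fits-exit t ft x∈ (R⊆ e)
  ... | inj₁ x′∈         = crossing R⊆ t ft x′∈ y∉ w
  ... | inj₂ (refl , refl) = e

  module Subtree {S : Subset n} {E : EdgeSet n} (sub : IsSubtree G (S , E)) {v : Fin n} (v∈S : v ∈ₛ S) where

    edge-sym : ∀ {x y} → Edge E x y → Edge E y x
    edge-sym {x} {y} = proj₁ (proj₁ sub) x y

    edge⇒ : ∀ {x y} → Edge E x y → x ∈ₛ S × y ∈ₛ S × Adj G x y
    edge⇒ {x} {y} = proj₂ (proj₁ sub) x y

    -- The walk from `x` to `v` inside the subtree has to use the only edge that leaves `t`.
    up-edge : ∀ {u} t {x} → Fits G u t → v ∉ verts t → x ∈ verts t → x ∈ₛ S → Edge E (root t) u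
    up-edge t {x} ft v∉ x∈ x∈S = crossing (proj₂ ∘ proj₂ ∘ edge⇒) t ft x∈ v∉ (proj₂ (proj₂ (proj₂ sub) x v x∈S v∈S))

    prune : ∀ t → Pruning t
    prune (leaf x) with x ∈ₛ? S
    ... | yes _ = leaf
    ... | no _  = none
    prune (node x a b) with x ∈ₛ? S
    ... | yes _ = node (prune a) (prune b)
    ... | no _  = none

    prune-sound : ∀ t {x} → x ∈ kept (prune t) → x ∈ₛ S
    prune-sound (leaf x) p with x ∈ₛ? S
    prune-sound (leaf x) (here refl) | yes x∈ = x∈
    prune-sound (node x a b) p with x ∈ₛ? S
    prune-sound (node x a b) (here refl) | yes x∈ = x∈
    prune-sound (node x a b) (there p) | yes x∈ with ∈-++⁻ (kept (prune a)) p
    ... | inj₁ q = prune-sound a q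
    ... | inj₂ q = prune-sound b q

    prune-complete : ∀ {u} t {x} → Fits G u t → v ∉ verts t → x ∈ verts t → x ∈ₛ S → x ∈ kept (prune t)
    prune-complete (leaf x) ft v∉ (here refl) x∈S with x ∈ₛ? S
    ... | yes _ = here refl
    ... | no x∉ = ⊥-elim (x∉ x∈S)
    prune-complete (node x a b) ft v∉ y∈ y∈S with x ∈ₛ? S
    ... | no x∉ = ⊥-elim (x∉ (proj₁ (edge⇒ (up-edge (node x a b) ft v∉ y∈ y∈S))))
    prune-complete (node x a b) ft v∉ (here e) y∈S | yes _ = here e
    prune-complete (node x a b) (_ , fa , fb) v∉ (there y∈) y∈S | yes _ with ∈-++⁻ (verts a) y∈
    ... | inj₁ q = there (∈-++⁺ˡ (prune-complete a fa (v∉ ∘ there ∘ ∈-++⁺ˡ) q y∈S))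
    ... | inj₂ q = there (∈-++⁺ʳ (kept (prune a)) (prune-complete b fb (v∉ ∘ there ∘ ∈-++⁺ʳ (verts a)) q y∈S))

    pruneₗ : ∀ ts → All Pruning ts
    pruneₗ []       = []
    pruneₗ (t ∷ ts) = prune t ∷ pruneₗ ts

    pruneₗ-sound : ∀ ts {x} → x ∈ keptₗ (pruneₗ ts) → x ∈ₛ S
    pruneₗ-sound (t ∷ ts) p with ∈-++⁻ (kept (prune t)) p
    ... | inj₁ q = prune-sound t q
    ... | inj₂ q = pruneₗ-sound ts q

    pruneₗ-complete : ∀ ts {x} → All (Fits G v) ts → v ∉ vertsₗ ts → x ∈ vertsₗ ts → x ∈ₛ S → x ∈ keptₗ (pruneₗ ts)
    pruneₗ-complete (t ∷ ts) (ft ∷ fts) v∉ x∈ x∈S with ∈-++⁻ (verts t) x∈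
    ... | inj₁ q = ∈-++⁺ˡ (prune-complete t ft (v∉ ∘ ∈-++⁺ˡ) q x∈S)
    ... | inj₂ q = ∈-++⁺ʳ (kept (prune t)) (pruneₗ-complete ts fts (v∉ ∘ ∈-++⁺ʳ (verts t)) q x∈S)

    -- Subtrees of a tree are induced subgraphs: every edge of `G` lies directly above the lower of
    -- its ends, and `up-edge` puts it into `E`.
    edges-in : ∀ {u} t {x y} → Fits G u t → v ∉ verts t → x ∈ verts t → Adj G x y → x ∈ₛ S → y ∈ₛ S → Edge E x y
    edges-in (leaf x) ft v∉ (here refl) e x∈S y∈S with to ft e
    ... | here refl = up-edge (leaf x) ft v∉ (here refl) x∈S
    edges-in (node x a b) ft@(nb , fa , fb) v∉ (here refl) e x∈S y∈S with to nb e
    ... | here refl = up-edge (node x a b) ft v∉ (here refl) x∈S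
    ... | there (here refl) = edge-sym (up-edge a fa (v∉ ∘ there ∘ ∈-++⁺ˡ) (root∈verts a) y∈S)
    ... | there (there (here refl)) = edge-sym (up-edge b fb (v∉ ∘ there ∘ ∈-++⁺ʳ (verts a)) (root∈verts b) y∈S)
    edges-in (node x a b) (_ , fa , fb) v∉ (there x∈) e x∈S y∈S with ∈-++⁻ (verts a) x∈
    ... | inj₁ q = edges-in a fa (v∉ ∘ there ∘ ∈-++⁺ˡ) q e x∈S y∈S
    ... | inj₂ q = edges-in b fb (v∉ ∘ there ∘ ∈-++⁺ʳ (verts a)) q e x∈S y∈S

    module _ {ts} (B : Branches G v ts) where

      edges : ∀ {x y} → Adj G x y → x ∈ₛ S → y ∈ₛ S → Edge E x y
      edges {x} e x∈S y∈S with position B x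
      ... | inBranch t∈ o = edges-in _ (branch-fits B t∈) (root∉ B t∈) (occ⇒∈ o) e x∈S y∈S
      ... | atRoot with ∈-map⁻ root (to (Branches.nbrs B) e)
      ...   | t , t∈ , refl = edge-sym (up-edge t (branch-fits B t∈) (root∉ B t∈) (root∈verts t) y∈S)

      vertices≡ : S ≡ ⟦ v ∷ keptₗ (pruneₗ ts) ⟧
      vertices≡ = ⊆-antisym (λ x∈S → from ∈⟦⟧ (⊆₁ x∈S)) (λ x∈ → ⊆₂ (to ∈⟦⟧ x∈))
        where
        v∉ = Uniqueₚ.Unique[x∷xs]⇒x∉xs (Branches.uniq B)
        ⊆₁ : ∀ {x} → x ∈ₛ S → x ∈ v ∷ keptₗ (pruneₗ ts)
        ⊆₁ {x} x∈S with Branches.full B x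
        ... | here e   = here e
        ... | there x∈ = there (pruneₗ-complete ts (Branches.fits B) v∉ x∈ x∈S)
        ⊆₂ : ∀ {x} → x ∈ v ∷ keptₗ (pruneₗ ts) → x ∈ₛ S
        ⊆₂ (here refl) = v∈S
        ⊆₂ (there x∈) = pruneₗ-sound ts x∈

      edges≡ : E ≡ induced G S
      edges≡ = edgeSet-ext (mk⇔ (λ p → from (edge-induced G) (edge⇒ p))
        (λ p → let x∈ , y∈ , e = to (edge-induced G) p in edges e x∈ y∈))

  module _ {v : Fin n} {ts : List (LT (Fin n))} (B : Branches G v ts) where

    candidate : All Pruning ts → Subset n × EdgeSet n
    candidate ps = ⟦ v ∷ keptₗ ps ⟧ , induced G ⟦ v ∷ keptₗ ps ⟧

    module _ (ps : All Pruning ts) where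
      private
        S : Subset n
        S = ⟦ v ∷ keptₗ ps ⟧

      kept-joined : ∀ {u} t (p : Pruning t) → Fits G u t → u ∈ₛ S → (∀ {x} → x ∈ kept p → x ∈ₛ S) →
                    ∀ {x} → x ∈ kept p → Joined (Edge (induced G S)) x u
      kept-joined (leaf x) leaf ft u∈ k⊆ (here refl) = 1 , from (edge-induced G) (k⊆ (here refl) , u∈ , from ft (here refl)) ∷ []
      kept-joined (node x a b) (node p q) (nb , fa , fb) u∈ k⊆ (here refl) =
        1 , from (edge-induced G) (k⊆ (here refl) , u∈ , from nb (here refl)) ∷ []
      kept-joined (node x a b) (node p q) (nb , fa , fb) u∈ k⊆ (there y∈) =
        _ , proj₂ ([ kept-joined a p fa x∈ (k⊆ ∘ there ∘ ∈-++⁺ˡ) , kept-joined b q fb x∈ (k⊆ ∘ there ∘ ∈-++⁺ʳ (kept p)) ]′ (∈-++⁻ (kept p) y∈))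
              ∷ʳʷ from (edge-induced G) (x∈ , u∈ , from nb (here refl))
        where
        x∈ : x ∈ₛ S
        x∈ = k⊆ (here refl)

      keptₗ-joined : ∀ {us} (qs : All Pruning us) → All (Fits G v) us → (∀ {x} → x ∈ keptₗ qs → x ∈ₛ S) →
                     ∀ {x} → x ∈ keptₗ qs → Joined (Edge (induced G S)) x v
      keptₗ-joined {u ∷ us} (q ∷ qs) (fu ∷ fus) k⊆ x∈ with ∈-++⁻ (kept q) x∈
      ... | inj₁ y = kept-joined u q fu (from (∈⟦⟧ {xs = v ∷ keptₗ ps}) (here refl)) (k⊆ ∘ ∈-++⁺ˡ) y
      ... | inj₂ y = keptₗ-joined qs fus (k⊆ ∘ ∈-++⁺ʳ (kept q)) y

      candidate-subtree : IsSubtree G (candidate ps) × v ∈ₛ S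
      candidate-subtree = ((sy , λ x y e → to (edge-induced G) e) , (v , v∈) , joined) , v∈
        where
        v∈ : v ∈ₛ S
        v∈ = from (∈⟦⟧ {xs = v ∷ keptₗ ps}) (here refl)
        sy : ∀ x y → Edge (induced G S) x y → Edge (induced G S) y x
        sy x y e = let x∈ , y∈ , e′ = to (edge-induced G) e in from (edge-induced G) (y∈ , x∈ , symm G e′)
        to-v : ∀ {x} → x ∈ₛ S → Joined (Edge (induced G S)) x v
        to-v x∈ with to (∈⟦⟧ {xs = v ∷ keptₗ ps}) x∈
        ... | here refl = 0 , []
        ... | there x∈′ = keptₗ-joined ps (Branches.fits B) (from ∈⟦⟧ ∘ there) x∈′
        joined : ∀ x y → x ∈ₛ S → y ∈ₛ S → Joined (Edge (induced G S)) x y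
        joined x y x∈ y∈ = _ , proj₂ (to-v x∈) ⁀ reverse-walk (sy _ _) (proj₂ (to-v y∈))

    candidate-injective : ∀ {ps qs} → candidate ps ≡ candidate qs → ps ≡ qs
    candidate-injective {ps} {qs} eq = keptₗ-injective us ps qs
      (drop-head (v∉ ∘ keptₗ⊆vertsₗ ps) (λ z∈ → to ∈⟦⟧ (subst (_ ∈ₛ_) e (from ∈⟦⟧ z∈))))
      (drop-head (v∉ ∘ keptₗ⊆vertsₗ qs) (λ z∈ → to ∈⟦⟧ (subst (_ ∈ₛ_) (sym e) (from ∈⟦⟧ z∈))))
      where
      e  = cong proj₁ eq
      v∉ = Uniqueₚ.Unique[x∷xs]⇒x∉xs (Branches.uniq B)
      us : Unique (vertsₗ ts)
      us with _ ∷ u ← Branches.uniq B = u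

    -- A subtree through `v` is determined by its vertex set, and that set by independent prunings
    -- of the branches. So `candidate` is a bijection onto the filtered list, and the count is a
    -- product.
    f≡Fₗ : f G v ≡ Fₗ ts
    f≡Fₗ = trans (unique-length (Uniqueₚ.filter⁺ P? (candidates-unique n)) (Uniqueₚ.map⁺ candidate-injective (pruningsₗ-unique ts))
        (mk⇔ ⇒ ⇐))
      (trans (length-map candidate (pruningsₗ ts)) (length-pruningsₗ ts))
      where
      P? : U.Decidable (λ H → IsSubtree G H × v ∈ₛ proj₁ H)
      P? H = isSubtree? G H ×-dec (v ∈ₛ? proj₁ H)
      ⇒ : ∀ {H} → H ∈ filter P? (candidates n) → H ∈ map candidate (pruningsₗ ts)
      ⇒ {H} p with ∈-filter⁻ P? {xs = candidates n} p
      ... | _ , sub , v∈ = subst (_∈ map candidate (pruningsₗ ts)) (sym eq) (∈-map⁺ candidate (pruningsₗ-complete (pruneₗ ts)))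
        where
        open Subtree {S = proj₁ H} {E = proj₂ H} sub v∈
        eq : H ≡ candidate (pruneₗ ts)
        eq = cong₂ _,_ (vertices≡ B) (trans (edges≡ B) (cong (induced G) (vertices≡ B)))
      ⇐ : ∀ {H} → H ∈ map candidate (pruningsₗ ts) → H ∈ filter P? (candidates n)
      ⇐ p with ∈-map⁻ candidate p
      ... | ps , _ , refl = ∈-filter⁺ P? (candidates-complete _) (candidate-subtree ps)

-- Decomposing a tree

remove-↭ : ∀ {A : Set} {y : A} {ys} (p : y ∈ ys) → ys ↭ y ∷ remove p
remove-↭ (here refl)          = Perm.refl
remove-↭ {ys = x ∷ _} (there p) = Perm.trans (Perm.prep x (remove-↭ p)) (Perm.swap x _ Perm.refl)

length≡1 : ∀ {A : Set} {xs : List A} → length xs ≡ 1 → ∃ λ x → xs ≡ x ∷ []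
length≡1 {xs = x ∷ []} refl = x , refl

length≡2 : ∀ {A : Set} {xs : List A} → length xs ≡ 2 → ∃₂ λ x y → xs ≡ x ∷ y ∷ []
length≡2 {xs = x ∷ y ∷ []} refl = x , y , refl

module _ {n : ℕ} (G : Graph n) where

  Avoiding : Fin n → Rel (Fin n) 0ℓ
  Avoiding v x y = Adj G x y × x ≢ v × y ≢ v

  Acyclic : Set
  Acyclic = ∀ v vs → ¬ IsCycle G v vs

module _ {n : ℕ} {G : Graph n} where

  -- Otherwise the loop-erased walk from `x` to `y` closes up through `v` to a cycle.
  acyclic-avoiding : Acyclic G → ∀ {v x y} → Adj G v x → Adj G v y → Joined (Avoiding G v) x y → x ≡ y
  acyclic-avoiding ac {v} {x} {y} vx vy (_ , w) with x ≟ y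
  ... | yes x≡y = x≡y
  ... | no  x≢y with path-erase w
  ...   | xs , p = ⊥-elim (ac v xs (two p , Allₚ.¬Any⇒All¬ xs (avoids p) ∷ path-unique p , closed p))
    where
    v≢ : ∀ {z} → Adj G v z → z ≢ v
    v≢ vz refl = irrefl G refl vz
    two : ∀ {xs} → Path {R = Avoiding G v} x y xs → 2 ≤ length xs
    two [ _ ] = ⊥-elim (x≢y refl)
    two (cons _ [ _ ] _) = s≤s (s≤s z≤n)
    two (cons _ (cons _ _ _) _) = s≤s (s≤s z≤n)
    avoids : ∀ {z xs} → Path {R = Avoiding G v} z y xs → v ∉ xs
    avoids [ _ ] (here refl) = v≢ vy refl
    avoids (cons (_ , z≢v , _) p _) (here refl) = z≢v refl
    avoids (cons _ p _) (there q) = avoids p q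
    linked : ∀ {u z xs} → Path {R = Avoiding G v} z y xs → Adj G u z → Linked (Adj G) ((u ∷ xs) ∷ʳ v)
    linked [ _ ] uz = uz ∷ (symm G vy ∷ [-])
    linked (cons (e , _) p _) uz = uz ∷ linked p e
    closed : ∀ {xs} → Path {R = Avoiding G v} x y xs → Linked (Adj G) ((v ∷ xs) ∷ʳ v)
    closed p = linked p vx

  module Extract (tree : IsTree G) (r : Fin n) where

    private
      conn : Connected G
      conn = proj₁ tree
      height : Fin n → ℕ
      height x = dist G x r

    height-step : ∀ {x y} → Adj G x y → height x ≤ suc (height y)
    height-step {x} {y} e = dist-≤ G (e ∷ dist-walk G (conn y r))

    height-0 : ∀ {x} → height x ≡ 0 → x ≡ r
    height-0 {x} eq with dist G x r | dist-walk G (conn x r)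
    height-0 refl | .0 | [] = refl

    height-root : height r ≡ 0
    height-root = n≤0⇒n≡0 (dist-≤ G [])

    parent : ∀ {x h} → height x ≡ suc h → ∃ λ y → Adj G x y × height y ≡ h
    parent {x} {h} eq = go (subst (λ k → Walk (Adj G) k x r) eq (dist-walk G (conn x r)))
      where
      go : Walk (Adj G) (suc h) x r → ∃ λ y → Adj G x y × height y ≡ h
      go (e ∷ w) = _ , e , ≤-antisym (dist-≤ G w) (s≤s⁻¹ (subst (_≤ _) eq (height-step e)))

    -- Following parents, all later vertices are strictly lower than `x`, hence lower than `v`.
    low-walk : ∀ h {x v} → height x ≡ h → x ≢ v → h ≤ height v → Joined (Avoiding G v) x r
    low-walk zero eq x≢v le with height-0 eq
    ... | refl = 0 , []
    low-walk (suc h) {x} {v} eq x≢v le with parent eq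
    ... | y , e , eq′ with low-walk h eq′ (λ { refl → <-irrefl (sym eq′) le }) (≤-trans (n≤1+n h) le)
    ...   | k , w = suc k , (e , x≢v , λ { refl → <-irrefl (sym eq′) le }) ∷ w

    Avoiding-sym : ∀ {v x y} → Avoiding G v x y → Avoiding G v y x
    Avoiding-sym (e , p , q) = symm G e , q , p

    -- If `x` were not higher than `v`, both `x` and the parent `u` would reach the root avoiding
    -- `v`, which forces `x ≡ u`. This excludes equal heights as well.
    children-height : ∀ {u v x} → Adj G v u → height v ≡ suc (height u) → Adj G v x → x ≢ u → height x ≡ suc (height v)
    children-height {u} {v} {x} vu eq vx x≢u with height x ≤? height v
    ... | no  x≰v = ≤-antisym (height-step (symm G vx)) (≰⇒> x≰v)
    ... | yes x≤v = ⊥-elim (x≢u (acyclic-avoiding (proj₂ tree) vx vu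
        (_ , proj₂ (low-walk _ refl (λ { refl → irrefl G refl vx }) x≤v) ⁀
             reverse-walk Avoiding-sym (proj₂ (low-walk _ refl (λ { refl → irrefl G refl vu }) (≤-trans (n≤1+n _) (≤-reflexive (sym eq))))))))

    -- Each built branch keeps, for every vertex in it, a walk that stays above the height of the
    -- parent. Two sibling branches with a common vertex would then be joined avoiding their parent,
    -- so branches are disjoint.
    Above : ℕ → Rel (Fin n) 0ℓ
    Above m x y = Adj G x y × m < height x × m < height y

    above-height : ∀ {m x z} → m < height x → Joined (Above m) x z → m < height z
    above-height lt (_ , []) = lt
    above-height lt (_ , (_ , _ , lt′) ∷ w) = above-height lt′ (_ , w)

    above-avoiding : ∀ {v x y} → Above (height v) x y → Avoiding G v x y
    above-avoiding (e , p , q) = e , (λ { refl → <-irrefl refl p }) , (λ { refl → <-irrefl refl q })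

    above-weaken : ∀ {m m′ x y} → m ≤ m′ → Above m′ x y → Above m x y
    above-weaken le (e , p , q) = e , ≤-<-trans le p , ≤-<-trans le q

    above-same : ∀ {v x y z} → Adj G v x → Adj G v y → Joined (Above (height v)) x z → Joined (Above (height v)) y z → x ≡ y
    above-same vx vy (_ , w) (_ , w′) = acyclic-avoiding (proj₂ tree) vx vy
      (_ , walk-map above-avoiding w ⁀ reverse-walk Avoiding-sym (walk-map above-avoiding w′))

    record Built (u v : Fin n) : Set where
      field
        t     : LT (Fin n)
        root≡ : root t ≡ v
        fits  : Fits G u t
        uniq  : Unique (verts t)
        above : ∀ {x} → x ∈ verts t → Joined (Above (height u)) v x

    module _ (degs : ∀ v → v ≢ r → deg G v ≡ 1 ⊎ deg G v ≡ 3) where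

      -- Each child is one higher while `fuel` drops by one, so the bound `n ≤ fuel + height v` is
      -- kept. Heights lie below `n`, hence the fuel cannot run out.
      build : ∀ fuel {u v} → Adj G v u → height v ≡ suc (height u) → n ≤ fuel + height v → Built u v
      build zero vu eq le = ⊥-elim (<-irrefl refl (<-≤-trans (dist<n G (conn _ r)) le))
      build (suc fuel) {u} {v} vu eq le with degs v v≢r
        where
        v≢r : v ≢ r
        v≢r refl = case trans (sym height-root) eq of λ ()
      ... | inj₁ d1 with length≡1 d1
      ...   | w , adj≡ = record
        { t = leaf v
        ; root≡ = refl
        ; fits = nb
        ; uniq = [] ∷ []
        ; above = λ { (here refl) → 0 , [] } }
        where
        nb₀ : Neighbours G v (w ∷ [])
        nb₀ = subst (Neighbours G v) adj≡ (adjacents-neighbours G v)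
        nb : Neighbours G v (u ∷ [])
        nb with to nb₀ vu
        ... | here refl = nb₀
      build (suc fuel) {u} {v} vu eq le | inj₂ d3 = result
        where
        u∈ : u ∈ adjacents G v
        u∈ = to (adjacents-neighbours G v) vu
        two : ∃₂ λ x y → remove u∈ ≡ x ∷ y ∷ []
        two = length≡2 (suc-injective (trans (length-remove u∈) d3))
        x y : Fin n
        x = proj₁ two
        y = proj₁ (proj₂ two)
        σ : adjacents G v ↭ u ∷ x ∷ y ∷ []
        σ = subst (λ l → adjacents G v ↭ u ∷ l) (proj₂ (proj₂ two)) (remove-↭ u∈)
        nb : Neighbours G v (u ∷ x ∷ y ∷ [])
        nb = Neighbours-↭ {G = G} σ (adjacents-neighbours G v)
        result : Built u v
        result with Unique-resp-↭ σ (adjacents-unique G v)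
        ... | (u≢x ∷ u≢y ∷ []) ∷ (x≢y ∷ []) ∷ _ = record
          { t = node v A.t B.t
          ; root≡ = refl
          ; fits = subst₂ (λ x y → Neighbours G v (u ∷ x ∷ y ∷ [])) (sym A.root≡) (sym B.root≡) nb , A.fits , B.fits
          ; uniq = Allₚ.¬Any⇒All¬ _ v∉ ∷ Uniqueₚ.++⁺ A.uniq B.uniq λ (p , q) → x≢y (above-same vx vy (A.above p) (B.above q))
          ; above = λ { (here refl) → 0 , []
                      ; (there z∈) → [ (λ p → up vx hx (A.above p)) , (λ p → up vy hy (B.above p)) ]′ (∈-++⁻ (verts A.t) z∈) } }
          where
          vx = from nb (there (here refl))
          vy = from nb (there (there (here refl)))
          hx = children-height vu eq vx (u≢x ∘ sym)
          hy = children-height vu eq vy (u≢y ∘ sym)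
          fuel≤ : ∀ {z} → height z ≡ suc (height v) → n ≤ fuel + height z
          fuel≤ e = ≤-trans le (≤-reflexive (trans (sym (+-suc fuel (height v))) (cong (fuel +_) (sym e))))
          module A = Built (build fuel (symm G vx) hx (fuel≤ hx))
          module B = Built (build fuel (symm G vy) hy (fuel≤ hy))
          v∉ : v ∉ verts A.t ++ verts B.t
          v∉ p with ∈-++⁻ (verts A.t) p
          ... | inj₁ q = <-irrefl refl (above-height (≤-reflexive (sym hx)) (A.above q))
          ... | inj₂ q = <-irrefl refl (above-height (≤-reflexive (sym hy)) (B.above q))
          u<v : height u < height v
          u<v = ≤-reflexive (sym eq)
          up : ∀ {w z} → Adj G v w → height w ≡ suc (height v) → Joined (Above (height v)) w z → Joined (Above (height u)) v z
          up vw hw (k , p) = suc k , (vw , u<v , <-≤-trans u<v (≤-trans (n≤1+n _) (≤-reflexive (sym hw)))) ∷ walk-map (above-weaken (<⇒≤ u<v)) p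

      record Builtₗ (xs : List (Fin n)) : Set where
        field
          ts     : List (LT (Fin n))
          roots≡ : map root ts ≡ xs
          fits   : All (Fits G r) ts
          uniq   : Unique (vertsₗ ts)
          above  : ∀ {z} → z ∈ vertsₗ ts → ∃ λ x → x ∈ xs × Joined (Above (height r)) x z

      nbr-height : ∀ {x} → Adj G r x → height x ≡ suc (height r)
      nbr-height {x} rx with height x in eq
      ... | zero  = ⊥-elim (irrefl G (sym (height-0 eq)) rx)
      ... | suc h = cong suc (trans (n≤0⇒n≡0 (s≤s⁻¹ (subst₂ _≤_ eq (cong suc height-root) (height-step (symm G rx))))) (sym height-root))

      buildₗ : ∀ {xs} → Unique xs → (∀ {x} → x ∈ xs → Adj G r x) → Builtₗ xs
      buildₗ [] _ = record { ts = [] ; roots≡ = refl ; fits = [] ; uniq = [] ; above = λ () }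
      buildₗ {x ∷ xs} (x∉ ∷ u) adj = record
        { ts = B.t ∷ R.ts
        ; roots≡ = cong₂ _∷_ B.root≡ R.roots≡
        ; fits = B.fits ∷ R.fits
        ; uniq = Uniqueₚ.++⁺ B.uniq R.uniq λ (p , q) → let y , y∈ , j = R.above q in
                   All.lookup x∉ y∈ (above-same (adj (here refl)) (adj (there y∈)) (B.above p) j)
        ; above = λ z∈ → [ (λ p → x , here refl , B.above p) , (λ p → let y , y∈ , j = R.above p in y , there y∈ , j) ]′ (∈-++⁻ (verts B.t) z∈) }
        where
        module B = Built (build n (symm G (adj (here refl))) (nbr-height (adj (here refl))) (m≤m+n n _))
        module R = Builtₗ (buildₗ u (λ x∈ → adj (there x∈)))

      extract : ∃ λ ts → Branches G r ts × length ts ≡ deg G r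
      extract = R.ts , branches nb R.fits (Allₚ.¬Any⇒All¬ _ r∉ ∷ R.uniq) full , trans (sym (length-map root R.ts)) (cong length R.roots≡)
        where
        module R = Builtₗ (buildₗ (adjacents-unique G r) (from (adjacents-neighbours G r)))
        nb : Neighbours G r (map root R.ts)
        nb = subst (Neighbours G r) (sym R.roots≡) (adjacents-neighbours G r)
        r∉ : r ∉ vertsₗ R.ts
        r∉ p = let x , x∈ , j = R.above p in
          <-irrefl refl (above-height (≤-reflexive (sym (nbr-height (from (adjacents-neighbours G r) x∈)))) j)
        -- The collected vertices are closed under adjacency, so by connectedness they are all
        -- vertices.
        closed : ∀ {x y} → x ∈ r ∷ vertsₗ R.ts → Adj G x y → y ∈ r ∷ vertsₗ R.ts
        closed (here refl) e with ∈-map⁻ root (to nb e)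
        ... | t , t∈ , refl = there (∈-vertsₗ t∈ (root∈verts t))
        closed (there x∈) e with find (∈-concatMap⁻ verts {xs = R.ts} x∈)
        ... | t , t∈ , x∈t with fits-exit t (All.lookup R.fits t∈) x∈t e
        ...   | inj₁ y∈ = there (∈-vertsₗ t∈ y∈)
        ...   | inj₂ (_ , refl) = here refl
        reach : ∀ {k x y} → x ∈ r ∷ vertsₗ R.ts → Walk (Adj G) k x y → y ∈ r ∷ vertsₗ R.ts
        reach x∈ [] = x∈
        reach x∈ (e ∷ w) = reach (closed x∈ e) w
        full : ∀ x → x ∈ r ∷ vertsₗ R.ts
        full x = reach (here refl) (proj₂ (conn r x))

-- The numbers R_l and the heights of rgood trees

-- Φ d p: the number of subtrees containing the root of an rgood tree all of
-- whose leaves have depth d or d + 1 and which has p inner vertices of depth d.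
Φ : ℕ → ℕ → ℕ
Φ zero    zero    = 1
Φ zero    (suc _) = 4
Φ (suc d) p       = suc (Φ d (p ⊓ 2 ^ d)) * suc (Φ d (p ∸ 2 ^ d))

heightΦ : ℕ → ℕ → ℕ
heightΦ d zero    = d
heightΦ d (suc _) = suc d

2^d>0 : ∀ d → 0 < 2 ^ d
2^d>0 d = m^n>0 2 d

2^suc : ∀ d → 2 ^ suc d ≡ 2 ^ d + 2 ^ d
2^suc d = cong (2 ^ d +_) (+-identityʳ (2 ^ d))

-- The final segment condition seen at one vertex: the second subtree gets inner vertices of depth
-- `d` only when the first has all `2 ^ d` of them.
LeftFirst : ℕ → ℕ → ℕ → Set
LeftFirst d p q = p ≡ 2 ^ d ⊎ q ≡ 0

-- The rgood shape as a recursion, with the parameters of `Φ`. The global ordering is replaced by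
-- one condition at each node, allowed in either direction because children are unordered.
data Bal {V : Set} : ℕ → LT V → ℕ → Set where
  leaf   : ∀ {v} → Bal 0 (leaf v) 0
  cherry : ∀ {v x y} → Bal 0 (node v (leaf x) (leaf y)) 1
  node   : ∀ {v d a b p q} → Bal d a p → Bal d b q → LeftFirst d p q ⊎ LeftFirst d q p → Bal (suc d) (node v a b) (p + q)

Φ-split : ∀ d {p q} → p ≤ 2 ^ d → LeftFirst d p q → Φ (suc d) (p + q) ≡ suc (Φ d p) * suc (Φ d q)
Φ-split d {q = q} le (inj₁ refl) = cong₂ (λ x y → suc (Φ d x) * suc (Φ d y)) (m≥n⇒m⊓n≡n (m≤m+n _ q)) (m+n∸m≡n (2 ^ d) q)
Φ-split d {p} le (inj₂ refl) = cong₂ (λ x y → suc (Φ d x) * suc (Φ d y))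
  (trans (m≤n⇒m⊓n≡m (≤-trans (≤-reflexive (+-identityʳ p)) le)) (+-identityʳ p))
  (m≤n⇒m∸n≡0 (≤-trans (≤-reflexive (+-identityʳ p)) le))

Φ-positive : ∀ d p → 1 ≤ Φ d p
Φ-positive zero    zero    = ≤-refl
Φ-positive zero    (suc p) = s≤s z≤n
Φ-positive (suc d) p       = s≤s z≤n

-- A complete tree has two parameter pairs: the last level full at `d`, or empty at `suc d`.
Φ-full : ∀ d → Φ d (2 ^ d) ≡ Φ (suc d) 0
Φ-full zero    = refl
Φ-full (suc d) = trans (cong (Φ (suc d)) (2^suc d)) (trans (Φ-split d {2 ^ d} ≤-refl (inj₁ refl))
  (trans (cong₂ (λ x y → suc x * suc y) (Φ-full d) (Φ-full d))
    (sym (Φ-split (suc d) {0} {0} z≤n (inj₂ refl)))))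

private
  -- Since x′ is at least 2x + 2, the right side is at least (2x + 3)(1 + y) + 2. This exceeds 2(1 +
  -- x)(1 + y) + 2 by 1 + y, and the missing 2 is there because y is positive.
  double-left : ∀ x x′ y → 1 ≤ y → 2 * (x + 2) ≤ x′ + 2 → 2 * (suc x * suc y + 2) ≤ suc x′ * suc y + 2
  double-left x x′ y 1≤y le = begin
    2 * (suc x * suc y + 2)                    ≡⟨ solve 2 (λ x y → con 2 :* ((con 1 :+ x) :* (con 1 :+ y) :+ con 2)
                                                  := (con 2 :* (con 1 :+ x)) :* (con 1 :+ y) :+ con 2 :+ con 1 :+ con 1) refl x y ⟩
    2 * suc x * suc y + 2 + 1 + 1              ≤⟨ +-monoʳ-≤ (2 * suc x * suc y + 2 + 1) 1≤y ⟩
    2 * suc x * suc y + 2 + 1 + y              ≡⟨ solve 2 (λ x y → con 2 :* (con 1 :+ x) :* (con 1 :+ y) :+ con 2 :+ con 1 :+ y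
                                                  := (con 2 :* x :+ con 3) :* (con 1 :+ y) :+ con 2) refl x y ⟩
    (2 * x + 3) * suc y + 2                    ≤⟨ +-monoˡ-≤ 2 (*-monoˡ-≤ (suc y) le′) ⟩
    suc x′ * suc y + 2 ∎
    where
    open ≤-Reasoning
    le′ : 2 * x + 3 ≤ suc x′
    le′ = s≤s⁻¹ (s≤s⁻¹ (subst₂ _≤_ (solve 1 (λ x → con 1 :+ (con 2 :* (x :+ con 2)) := con 2 :+ (con 2 :* x :+ con 3)) refl x)
                                   (solve 1 (λ x → con 1 :+ (x :+ con 2) := con 3 :+ x) refl x′) (s≤s le)))

-- Turning a leaf of depth `d` into a cherry raises its count from 1 to 4, which doubles the count
-- plus 2 exactly; `double-left` carries this up to the root.
Φ-step : ∀ d p → p < 2 ^ d → 2 * (Φ d p + 2) ≤ Φ d (suc p) + 2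
Φ-step zero zero lt = ≤-refl
Φ-step zero (suc p) (s≤s ())
Φ-step (suc d) p lt with p <? 2 ^ d
... | yes p< = subst₂ (λ x y → 2 * (x + 2) ≤ y + 2) (split p (<⇒≤ p<)) (split (suc p) p<)
                 (double-left (Φ d p) (Φ d (suc p)) (Φ d 0) (Φ-positive d 0) (Φ-step d p p<))
  where
  split : ∀ p → p ≤ 2 ^ d → suc (Φ d p) * suc (Φ d 0) ≡ Φ (suc d) p
  split p le = trans (sym (Φ-split d {p} le (inj₂ refl))) (cong (Φ (suc d)) (+-identityʳ p))
... | no p≮ = subst₂ (λ x y → 2 * (x + 2) ≤ y + 2)
                (trans (*-comm (suc (Φ d q)) _) (trans (sym (Φ-split d ≤-refl (inj₁ refl))) (cong (Φ (suc d)) eq)))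
                (trans (*-comm (suc (Φ d (suc q))) _) (trans (sym (Φ-split d ≤-refl (inj₁ refl))) (cong (Φ (suc d)) (trans (+-suc _ q) (cong suc eq)))))
                (double-left (Φ d q) (Φ d (suc q)) (Φ d (2 ^ d)) (Φ-positive d (2 ^ d)) (Φ-step d q q<))
  where
  q : ℕ
  q = p ∸ 2 ^ d
  eq : 2 ^ d + q ≡ p
  eq = m+[n∸m]≡n (≮⇒≥ p≮)
  q< : q < 2 ^ d
  q< = +-cancelˡ-< (2 ^ d) q (2 ^ d) (subst₂ _<_ (sym eq) (2^suc d) lt)

module _ {V : Set} where

  bal-≤ : ∀ {d} {t : LT V} {p} → Bal d t p → p ≤ 2 ^ d
  bal-≤ leaf   = z≤n
  bal-≤ cherry = ≤-refl
  bal-≤ {suc d} (node x y _) = ≤-trans (+-mono-≤ (bal-≤ x) (bal-≤ y)) (≤-reflexive (sym (2^suc d)))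

  bal-inner : ∀ {d} {t : LT V} {p} → Bal d t p → suc (inner t) ≡ 2 ^ d + p
  bal-inner leaf   = refl
  bal-inner cherry = refl
  bal-inner {suc d} {node v a b} (node {p = p} {q} x y _) = begin
    suc (suc (inner a + inner b))     ≡⟨ cong suc (+-suc (inner a) (inner b)) ⟨
    suc (inner a) + suc (inner b)     ≡⟨ cong₂ _+_ (bal-inner x) (bal-inner y) ⟩
    (2 ^ d + p) + (2 ^ d + q)         ≡⟨ solve 3 (λ e p q → (e :+ p) :+ (e :+ q) := (e :+ e) :+ (p :+ q)) refl (2 ^ d) p q ⟩
    (2 ^ d + 2 ^ d) + (p + q)         ≡⟨ cong (_+ (p + q)) (2^suc d) ⟨
    2 ^ suc d + (p + q)               ∎
    where
    open ≡-Reasoning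

  bal-F : ∀ {d} {t : LT V} {p} → Bal d t p → F t ≡ Φ d p
  bal-F leaf   = refl
  bal-F cherry = refl
  bal-F {suc d} (node {p = p} {q} x y (inj₁ l)) = trans (cong₂ (λ x y → suc x * suc y) (bal-F x) (bal-F y)) (sym (Φ-split d (bal-≤ x) l))
  bal-F {suc d} (node {p = p} {q} x y (inj₂ l)) = trans (cong₂ (λ x y → suc x * suc y) (bal-F x) (bal-F y))
    (trans (*-comm (suc (Φ d p)) _) (trans (sym (Φ-split d (bal-≤ y) l)) (cong (Φ (suc d)) (+-comm q p))))

  heightΦ-⊔ : ∀ d p q → suc (heightΦ d p ⊔ heightΦ d q) ≡ heightΦ (suc d) (p + q)
  heightΦ-⊔ d zero    zero    = cong suc (⊔-idem d)
  heightΦ-⊔ d zero    (suc q) = cong suc (m≤n⇒m⊔n≡n (n≤1+n d))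
  heightΦ-⊔ d (suc p) zero    = cong suc (m≥n⇒m⊔n≡m (n≤1+n d))
  heightΦ-⊔ d (suc p) (suc q) = cong suc (⊔-idem (suc d))

  bal-ht : ∀ {d} {t : LT V} {p} → Bal d t p → ht t ≡ heightΦ d p
  bal-ht leaf   = refl
  bal-ht cherry = refl
  bal-ht (node {p = p} {q} x y _) = trans (cong₂ (λ x y → suc (x ⊔ y)) (bal-ht x) (bal-ht y)) (heightΦ-⊔ _ p q)

bal-map : ∀ {V W : Set} (g : V → W) {d t p} → Bal d t p → Bal d (mapLT g t) p
bal-map g leaf         = leaf
bal-map g cherry       = cherry
bal-map g (node x y l) = node (bal-map g x) (bal-map g y) l

private
  next : ℕ × ℕ → ℕ × ℕ
  next (d , p) with suc p <? 2 ^ d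
  ... | yes _ = d , suc p
  ... | no  _ = suc d , 0

-- The parameters (d , p) with p < 2 ^ d of the rgood tree with i inner vertices.
params : ℕ → ℕ × ℕ
params zero    = 0 , 0
params (suc i) = next (params i)

-- R i is R_{2i+1}, and H i is the height of the rgood tree on 2i + 1 vertices.
R H : ℕ → ℕ
R i = uncurry Φ (params i)
H i = uncurry heightΦ (params i)

params-spec : ∀ i → let d , p = params i in suc i ≡ 2 ^ d + p × p < 2 ^ d
params-spec zero = refl , z<s
params-spec (suc i) with params i | params-spec i
... | d , p | eq , lt with suc p <? 2 ^ d
...   | yes lt′ = trans (cong suc eq) (sym (+-suc (2 ^ d) p)) , lt′
...   | no  ≮   = trans (cong suc eq) (trans (sym (+-suc (2 ^ d) p)) (trans (cong (2 ^ d +_) (≤-antisym lt (≮⇒≥ ≮)))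
                    (trans (sym (2^suc d)) (sym (+-identityʳ (2 ^ suc d)))))) , 2^d>0 (suc d)

R-step : ∀ i → 2 * (R i + 2) ≤ R (suc i) + 2
R-step i with params i | params-spec i
... | d , p | eq , lt with suc p <? 2 ^ d
...   | yes lt′ = Φ-step d p lt
...   | no  ≮   = subst (λ x → 2 * (Φ d p + 2) ≤ x + 2) (trans (cong (Φ d) (≤-antisym lt (≮⇒≥ ≮))) (Φ-full d)) (Φ-step d p lt)

heightΦ-bounds : ∀ d p → d ≤ heightΦ d p × heightΦ d p ≤ suc d
heightΦ-bounds d zero    = ≤-refl , n≤1+n d
heightΦ-bounds d (suc p) = n≤1+n d , ≤-refl

H-step : ∀ i → H i ≤ H (suc i) × H (suc i) ≤ suc (H i)
H-step i with params i
... | d , p with suc p <? 2 ^ d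
...   | yes _ = proj₂ (heightΦ-bounds d p) , s≤s (proj₁ (heightΦ-bounds d p))
...   | no  _ = proj₂ (heightΦ-bounds d p) , s≤s (proj₁ (heightΦ-bounds d p))

2^-inverse : ∀ d e {p q} → p < 2 ^ d → q < 2 ^ e → 2 ^ d + p ≡ 2 ^ e + q → d ≡ e
2^-inverse d e {p} {q} p< q< eq with <-cmp d e
... | tri≈ _ d≡e _ = d≡e
... | tri< d<e _ _ = ⊥-elim (<-irrefl eq (<-≤-trans (+-monoʳ-< (2 ^ d) p<) (≤-trans (≤-reflexive (sym (2^suc d)))
                       (≤-trans (^-monoʳ-≤ 2 d<e) (m≤m+n _ q)))))
... | tri> _ _ e<d = ⊥-elim (<-irrefl (sym eq) (<-≤-trans (+-monoʳ-< (2 ^ e) q<) (≤-trans (≤-reflexive (sym (2^suc e)))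
                       (≤-trans (^-monoʳ-≤ 2 e<d) (m≤m+n _ p)))))

canonical-< : ∀ {i d p} → p < 2 ^ d → suc i ≡ 2 ^ d + p → params i ≡ (d , p)
canonical-< {i} {d} {p} p< eq with params i | params-spec i
... | e , q | eq′ , q< with 2^-inverse d e p< q< (trans (sym eq) eq′)
...   | refl = cong (d ,_) (+-cancelˡ-≡ (2 ^ d) q p (trans (sym eq′) eq))

-- `params` always chooses `p < 2 ^ d`; at the boundary `Φ-full` changes to the other description of
-- the complete tree. Thus count and height of a `Bal` tree depend only on its number of inner
-- vertices.
canonical : ∀ {i d p} → p ≤ 2 ^ d → suc i ≡ 2 ^ d + p → R i ≡ Φ d p × H i ≡ heightΦ d p
canonical {i} {d} {p} le eq with m≤n⇒m<n∨m≡n le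
... | inj₁ p< = cong (uncurry Φ) (canonical-< {d = d} p< eq) , cong (uncurry heightΦ) (canonical-< {d = d} p< eq)
... | inj₂ refl = trans (cong (uncurry Φ) c) (sym (Φ-full d)) , trans (cong (uncurry heightΦ) c) (sym (full-heightΦ (2^d>0 d)))
  where
  c : params i ≡ (suc d , 0)
  c = canonical-< {d = suc d} (2^d>0 (suc d)) (trans eq (trans (sym (2^suc d)) (sym (+-identityʳ _))))
  full-heightΦ : ∀ {q} → 0 < q → heightΦ d q ≡ suc d
  full-heightΦ z<s = refl

module _ {V : Set} where

  bal-R : ∀ {d} {t : LT V} {p} → Bal d t p → F t ≡ R (inner t)
  bal-R {d} B = trans (bal-F B) (sym (proj₁ (canonical {d = d} (bal-≤ B) (bal-inner B))))

  bal-H : ∀ {d} {t : LT V} {p} → Bal d t p → ht t ≡ H (inner t)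
  bal-H {d} B = trans (bal-ht B) (sym (proj₂ (canonical {d = d} (bal-≤ B) (bal-inner B))))

-- The shape of rgood trees

bal-inner-vertex : ∀ {V : Set} {d} {t : LT V} {p} → Bal d t p →
                   p ≡ 0 ⊎ ∃ λ v → ∃₂ λ x y → Occ t d (node v (leaf x) (leaf y))
bal-inner-vertex leaf   = inj₁ refl
bal-inner-vertex cherry = inj₂ (_ , _ , _ , here)
bal-inner-vertex (node x y _) with bal-inner-vertex x | bal-inner-vertex y
... | inj₂ (_ , _ , _ , o) | _ = inj₂ (_ , _ , _ , left o)
... | inj₁ _ | inj₂ (_ , _ , _ , o) = inj₂ (_ , _ , _ , right o)
... | inj₁ refl | inj₁ refl = inj₁ refl

bal-leaf : ∀ {V : Set} {d} {t : LT V} {p} → Bal d t p → p ≡ 2 ^ d ⊎ ∃ λ v → Occ t d (leaf v)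
bal-leaf leaf   = inj₂ (_ , here)
bal-leaf cherry = inj₁ refl
bal-leaf {d = suc d} (node x y _) with bal-leaf x | bal-leaf y
... | inj₂ (_ , o) | _ = inj₂ (_ , left o)
... | inj₁ _ | inj₂ (_ , o) = inj₂ (_ , right o)
... | inj₁ refl | inj₁ refl = inj₁ (sym (2^suc d))

Fin1-unique : (x y : Fin 1) → x ≡ y
Fin1-unique Fin.zero Fin.zero = refl

data RgoodBranches {V : Set} : List (LT V) → Set where
  single : RgoodBranches []
  pair   : ∀ {a b d p q} → Bal d a p → Bal d b q → LeftFirst d p q → RgoodBranches (a ∷ b ∷ [])

module RgoodShape {n : ℕ} {G : Graph n} {r : Fin n} (rg : IsRgood G r) where

  open IsRgood rg
  open Rooted G r
  open Ordering (proj₁ orderable)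

  record At (k : ℕ) (t : LT (Fin n)) : Set where
    constructor at-level
    field
      u       : Fin n
      fits    : Fits G u t
      u-level : suc (height u) ≡ k
      levels  : ∀ {i s} → Occ t i s → height (root s) ≡ k + i

  at-left : ∀ {k v a b} → At k (node v a b) → At (suc k) a
  at-left {k} {v} (at-level u (_ , fa , _) _ lv) = at-level v fa (cong suc (trans (lv here) (+-identityʳ k)))
    (λ {i} o → trans (lv (left o)) (+-suc k i))

  at-right : ∀ {k v a b} → At k (node v a b) → At (suc k) b
  at-right {k} {v} (at-level u (_ , _ , fb) _ lv) = at-level v fb (cong suc (trans (lv here) (+-identityʳ k)))
    (λ {i} o → trans (lv (right o)) (+-suc k i))

  at-root : ∀ {k t} → At k t → height (root t) ≡ k
  at-root {k} A = trans (At.levels A here) (+-identityʳ k)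

  at-occ : ∀ {k t i s} → At k t → Occ t i s → At (k + i) s
  at-occ {k} {t} A here = subst (λ j → At j t) (sym (+-identityʳ k)) A
  at-occ {k} {s = s} A (left {j = j} o) = subst (λ i → At i s) (sym (+-suc k j)) (at-occ (at-left A) o)
  at-occ {k} {s = s} A (right {j = j} o) = subst (λ i → At i s) (sym (+-suc k j)) (at-occ (at-right A) o)

  parent-left : ∀ {k v a b} → At k (node v a b) → Parent v (root a)
  parent-left A = from (proj₁ (At.fits A)) (there (here refl)) , trans (at-root (at-left A)) (cong suc (sym (at-root A)))

  parent-right : ∀ {k v a b} → At k (node v a b) → Parent v (root b)
  parent-right A = from (proj₁ (At.fits A)) (there (there (here refl))) , trans (at-root (at-right A)) (cong suc (sym (at-root A)))

  leaf-pendant : ∀ {k v} → At k (leaf v) → Pendant G v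
  leaf-pendant A = deg≡length G ([] ∷ []) (At.fits A)

  level≤ecc : ∀ {k t} → At k t → k ≤ ecc G r
  level≤ecc A = ≤-trans (≤-reflexive (sym (at-root A))) (dist≤ecc G _ r)

  module Order (k : ℕ) where
    open IsStrictTotalOrder (linear k) public using (compare; irrefl)

  ≺-distinct : ∀ {k u v} → height u ≡ suc k → height v ≡ suc k → u ≺ v → u ≢ v
  ≺-distinct {k} hu hv u≺v eq = Order.irrefl k {_ , hu} {_ , hv} eq u≺v

  -- `respects` hands the order down level by level, so a comparison of two roots orders the two
  -- subtrees as blocks.
  ≺-occ : ∀ {k i t₁ t₂ s₁ s₂} → At (suc k) t₁ → At (suc k) t₂ → Occ t₁ i s₁ → Occ t₂ i s₂ →
          root t₁ ≺ root t₂ → root s₁ ≺ root s₂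
  ≺-occ A₁ A₂ here here lt = lt
  ≺-occ {k} {suc i} {node v₁ _ _} {node v₂ _ _} A₁ A₂ o₁ o₂ lt = go o₁ o₂
    where
    below : ∀ {c₁ c₂} → At (suc (suc k)) c₁ → At (suc (suc k)) c₂ → Parent v₁ (root c₁) → Parent v₂ (root c₂) →
            root c₁ ≺ root c₂
    below B₁ B₂ p₁ p₂ = from (respects (trans (at-root B₁) (sym (at-root B₂))) p₁ p₂
      (≺-distinct (at-root A₁) (at-root A₂) lt)) lt
    go : ∀ {s₁ s₂} → Occ (node v₁ _ _) (suc i) s₁ → Occ (node v₂ _ _) (suc i) s₂ → root s₁ ≺ root s₂
    go (left o₁)  (left o₂)  = ≺-occ (at-left A₁) (at-left A₂) o₁ o₂ (below (at-left A₁) (at-left A₂) (parent-left A₁) (parent-left A₂))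
    go (left o₁)  (right o₂) = ≺-occ (at-left A₁) (at-right A₂) o₁ o₂ (below (at-left A₁) (at-right A₂) (parent-left A₁) (parent-right A₂))
    go (right o₁) (left o₂)  = ≺-occ (at-right A₁) (at-left A₂) o₁ o₂ (below (at-right A₁) (at-left A₂) (parent-right A₁) (parent-left A₂))
    go (right o₁) (right o₂) = ≺-occ (at-right A₁) (at-right A₂) o₁ o₂ (below (at-right A₁) (at-right A₂) (parent-right A₁) (parent-right A₂))

  -- If t₁ precedes t₂, the final segment of parents meets t₁ only if it contains all of t₂.
  ≺-first : ∀ {k d t₁ t₂ p q} → At (suc k) t₁ → At (suc k) t₂ → suc (suc k + d) ≡ ecc G r →
            Bal d t₁ p → Bal d t₂ q → root t₁ ≺ root t₂ → LeftFirst d q p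
  ≺-first {k} {d} A₁ A₂ eq B₁ B₂ lt with bal-inner-vertex B₁ | bal-leaf B₂
  ... | inj₁ p≡0 | _         = inj₂ p≡0
  ... | _        | inj₁ full = inj₁ full
  ... | inj₂ (x , y , z , o₁) | inj₂ (w , o₂) = ⊥-elim (childless (proj₂ orderable x w
        (trans (cong suc (At.levels A₁ o₁)) eq) (trans (cong suc (At.levels A₂ o₂)) eq)
        (y , leaf-pendant (at-left C₁) , trans (at-root (at-left C₁)) eq , parent-left C₁) (≺-occ A₁ A₂ o₁ o₂ lt)))
    where
    C₁ = at-occ A₁ o₁
    C₂ = at-occ A₂ o₂
    childless : ¬ HighestParent w
    childless (v , _ , _ , adj , hv) with to (At.fits C₂) adj
    ... | here refl = <-irrefl (trans (at-root C₂) (sym (At.u-level C₂))) (s≤s (≤-trans (n≤1+n _) (≤-reflexive (sym hv))))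

  siblings : ∀ {k d t₁ t₂ p q} → At (suc k) t₁ → At (suc k) t₂ → root t₁ ≢ root t₂ → suc (suc k + d) ≡ ecc G r →
             Bal d t₁ p → Bal d t₂ q → LeftFirst d p q ⊎ LeftFirst d q p
  siblings {k} A₁ A₂ t₁≢t₂ eq B₁ B₂ with Order.compare k (_ , at-root A₁) (_ , at-root A₂)
  ... | tri< lt _ _ = inj₂ (≺-first A₁ A₂ eq B₁ B₂ lt)
  ... | tri≈ _ e _  = ⊥-elim (t₁≢t₂ e)
  ... | tri> _ _ gt = inj₁ (≺-first A₂ A₁ eq B₂ B₁ gt)

  module _ {w : Fin n} (w-pendant : Pendant G w) (w-highest : height w ≡ ecc G r) where

    leaf-level : ∀ {k v} → At k (leaf v) → ecc G r ≤ suc k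
    leaf-level {k} {v} A = subst₂ (λ i j → i ≤ suc j) w-highest (at-root A) (balanced w v w-pendant (leaf-pendant A))

    top-leaf : ∀ {k t} → At k t → k ≡ ecc G r → ∃ λ v → t ≡ leaf v
    top-leaf {t = leaf v} A eq = v , refl
    top-leaf {t = node _ _ _} A refl = ⊥-elim (<-irrefl refl (level≤ecc (at-left A)))

    -- The next-to-highest level has depth `d` inside `t`. Balance (`leaf-level`) forbids leaves
    -- above it, and vertices just below it are leaves by `top-leaf`; `siblings` turns the ordering
    -- into the condition of `Bal`.
    shape : ∀ d {k t} → At (suc k) t → Unique (verts t) → suc (suc k + d) ≡ ecc G r → ∃ λ p → Bal d t p
    shape zero {t = leaf _} A u eq = 0 , leaf
    shape zero {k} {node v a b} A u eq
      with top-leaf (at-left A) (trans (cong (suc ∘ suc) (sym (+-identityʳ k))) eq)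
         | top-leaf (at-right A) (trans (cong (suc ∘ suc) (sym (+-identityʳ k))) eq)
    ... | _ , refl | _ , refl = 1 , cherry
    shape (suc d) {k} {leaf v} A u eq = ⊥-elim (<-irrefl refl (≤-trans (s≤s (s≤s (m≤m+n (suc k) d)))
      (≤-trans (≤-reflexive (trans (cong (suc ∘ suc) (sym (+-suc k d))) eq)) (leaf-level A))))
    shape (suc d) {k} {node v a b} A (_ ∷ u) eq with unique-++⁻ (verts a) u
    ... | ua , ub , disj with shape d (at-left A) ua eq′ | shape d (at-right A) ub eq′
      where
      eq′ : suc (suc (suc k) + d) ≡ ecc G r
      eq′ = trans (cong (suc ∘ suc) (sym (+-suc k d))) eq
    ...   | p , B₁ | q , B₂ = p + q , node B₁ B₂ (siblings (at-left A) (at-right A)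
              (λ e → disj (root∈verts a) (subst (_∈ verts b) (sym e) (root∈verts b)))
              (trans (cong (suc ∘ suc) (sym (+-suc k d))) eq) B₁ B₂)

    pair-shape : ∀ {a b} → At 1 a → At 1 b → Unique (verts a) → Unique (verts b) → root a ≢ root b →
                 ∀ h → ecc G r ≡ suc h → ∃ λ d → ∃₂ λ p q → Bal d a p × Bal d b q × (LeftFirst d p q ⊎ LeftFirst d q p)
    pair-shape A B ua ub a≢b zero eq with top-leaf A (sym eq) | top-leaf B (sym eq)
    ... | _ , refl | _ , refl = 0 , 0 , 0 , leaf , leaf , inj₁ (inj₂ refl)
    pair-shape A B ua ub a≢b (suc d) eq with shape d A ua (sym eq) | shape d B ub (sym eq)
    ... | p , Ba | q , Bb = d , p , q , Ba , Bb , siblings A B a≢b (sym eq) Ba Bb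

  rgood-branches : ∃ λ ts → Branches G r ts × RgoodBranches ts
  rgood-branches with rootedBinary
  ... | tree , inj₁ refl with Extract.extract tree r (λ v v≢r → ⊥-elim (v≢r (Fin1-unique v r)))
  ...   | []     , B , _ = [] , B , single
  ...   | t ∷ ts , B , _ = ⊥-elim (root∉ B (here refl) (subst (_∈ verts t) (Fin1-unique (root t) r) (root∈verts t)))
  rgood-branches | tree , inj₂ (d2 , ds) with Extract.extract tree r (λ v v≢r → ds v v≢r)
  ... | ts , B , len with length≡2 {xs = ts} (trans len d2)
  ...   | a , b , refl = ordered
    where
    at-1 : ∀ {t} → t ∈ a ∷ b ∷ [] → At 1 t
    at-1 t∈ = at-level r (branch-fits B t∈) (cong suc (n≤0⇒n≡0 (dist-≤ G []))) (λ o → dist-root B t∈ o)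
    ha = at-1 (here refl)
    hb = at-1 (there (here refl))
    uab : Unique (verts a) × Unique (verts b ++ []) × (∀ {z} → z ∈ verts a → z ∉ verts b ++ [])
    uab with _ ∷ u ← Branches.uniq B = unique-++⁻ (verts a) u
    a≢b : root a ≢ root b
    a≢b e = proj₂ (proj₂ uab) (root∈verts a) (subst (_∈ verts b ++ []) (sym e) (∈-++⁺ˡ (root∈verts b)))
    ecc≡ : ecc G r ≡ suc (ht a ⊔ ht b)
    ecc≡ = ≤-antisym (ecc-≤ B (s≤s (m≤m⊔n _ _) ∷ s≤s (m≤n⊔m (ht a) _) ∷ []))
      sup
      where
      sup : suc (ht a ⊔ ht b) ≤ ecc G r
      sup with ⊔-sel (ht a) (ht b)
      ... | inj₁ e = subst (λ m → suc m ≤ ecc G r) (sym e) (ecc-≥ B (here refl))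
      ... | inj₂ e = subst (λ m → suc m ≤ ecc G r) (sym e) (ecc-≥ B (there (here refl)))
    highest : ∃ λ w → Pendant G w × height w ≡ ecc G r
    highest with ⊔-sel (ht a) (ht b) | deepest a | deepest b
    ... | inj₁ e | w , o | _ = w , leaf-pendant (at-occ ha o) , trans (At.levels ha o) (sym (trans ecc≡ (cong suc e)))
    ... | inj₂ e | _ | w , o = w , leaf-pendant (at-occ hb o) , trans (At.levels hb o) (sym (trans ecc≡ (cong suc e)))
    ordered : ∃ λ ts → Branches G r ts × RgoodBranches ts
    ordered with highest
    ... | w , wp , wh with pair-shape wp wh ha hb (proj₁ uab) (proj₁ (unique-++⁻ (verts b) (proj₁ (proj₂ uab)))) a≢b _ ecc≡
    ...   | d , p , q , Ba , Bb , inj₁ l = _ , B , pair Ba Bb l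
    ...   | d , p , q , Ba , Bb , inj₂ l = _ , permute (Perm.swap a b Perm.refl) B , pair Bb Ba l

-- Existence of rgood trees

double-half : ∀ m {q} → q ≡ ⌊ m /2⌋ → m ≡ q + q ⊎ m ≡ suc (q + q)
double-half zero          refl = inj₁ refl
double-half (suc zero)    refl = inj₂ refl
double-half (suc (suc m)) refl = Sum.map (λ e → cong suc (trans (cong suc e) (sym (+-suc _ _))))
                                         (λ e → cong suc (trans (cong suc e) (cong suc (sym (+-suc _ _))))) (double-half m refl)

-- The numbering of a binary heap: the children of p are 2p + 1 and 2p + 2.
Child : ℕ → ℕ → Set
Child p c = suc p ≡ ⌊ suc c /2⌋

child-cases : ∀ {p c} → Child p c → c ≡ suc (p + p) ⊎ c ≡ suc (suc (p + p))
child-cases {p} {c} e = Sum.map f₁ f₂ (double-half (suc c) e)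
  where
  f₁ : suc c ≡ suc p + suc p → c ≡ suc (p + p)
  f₁ e = trans (suc-injective e) (+-suc p p)
  f₂ : suc c ≡ suc (suc p + suc p) → c ≡ suc (suc (p + p))
  f₂ e = trans (suc-injective e) (cong suc (+-suc p p))

child₁ : ∀ p → Child p (suc (p + p))
child₁ p = cong suc (n≡⌊n+n/2⌋ p)

child₂ : ∀ p → Child p (suc (suc (p + p)))
child₂ p = cong suc (n≡⌈n+n/2⌉ p)

child-> : ∀ {p c} → Child p c → p < c
child-> {p} {c} e with child-cases {p} {c} e
... | inj₁ refl = s≤s (m≤m+n p p)
... | inj₂ refl = s≤s (m≤n⇒m≤1+n (m≤m+n p p))

child-unique : ∀ {p q c} → Child p c → Child q c → p ≡ q
child-unique e e′ = suc-injective (trans e (sym e′))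

child-mono : ∀ {p q c d} → Child p c → Child q d → c ≤ d → p ≤ q
child-mono e e′ le = s≤s⁻¹ (subst₂ _≤_ (sym e) (sym e′) (⌊n/2⌋-mono (s≤s le)))

level : ℕ → ℕ
level c = ⌊log₂ suc c ⌋

level-mono : ∀ {c d} → c ≤ d → level c ≤ level d
level-mono le = ⌊log₂⌋-mono-≤ (s≤s le)

level-child : ∀ {p c} → Child p c → level c ≡ suc (level p)
level-child {p} {suc c} e = sym (trans (cong suc (trans (cong ⌊log₂_⌋ e) (⌊log₂⌊n/2⌋⌋≡⌊log₂n⌋∸1 (suc (suc c)))))
  (m+[n∸m]≡n {1} (⌊log₂⌋-mono-≤ {2} {suc (suc c)} (s≤s (s≤s z≤n)))))

level-0 : ∀ {c} → level c ≡ 0 → c ≡ 0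
level-0 {zero} _ = refl
level-0 {suc c} e = ⊥-elim (<-irrefl (sym e) (⌊log₂⌋-mono-≤ {2} {suc (suc c)} (s≤s (s≤s z≤n))))

-- The binary heap on 2i + 1 vertices, whose inner vertices are those numbered below `i`. `Exceeds`
-- asserts an rgood tree of the given size, so its failure bounds `R` only because such a tree
-- exists.
module Heap (i : ℕ) where

  private
    n : ℕ
    n = suc (2 * i)

  HeapAdj : Rel (Fin n) 0ℓ
  HeapAdj x y = Child (toℕ x) (toℕ y) ⊎ Child (toℕ y) (toℕ x)

  heap : Graph n
  heap = record
    { Adj = HeapAdj
    ; adj? = λ x y → (suc (toℕ x) ≟ℕ ⌊ suc (toℕ y) /2⌋) ⊎-dec (suc (toℕ y) ≟ℕ ⌊ suc (toℕ x) /2⌋)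
    ; symm = Sum.swap
    ; irrefl = λ { refl → [ <-irrefl refl ∘ child-> , <-irrefl refl ∘ child-> ]′ } }

  top : Fin n
  top = Fin.zero

  private
    fin≡ : ∀ {x y : Fin n} {k} → toℕ x ≡ k → toℕ y ≡ k → x ≡ y
    fin≡ e e′ = toℕ-injective (trans e (sym e′))

    smaller : ∀ {x y} → HeapAdj x y → toℕ x < toℕ y → Child (toℕ x) (toℕ y)
    smaller (inj₁ c) lt = c
    smaller (inj₂ c) lt = ⊥-elim (<-asym lt (child-> c))

    smaller-unique : ∀ {x y z} → HeapAdj x z → HeapAdj y z → toℕ x < toℕ z → toℕ y < toℕ z → x ≡ y
    smaller-unique {x} {y} {z} e e′ lt lt′ = toℕ-injective (child-unique {c = toℕ z} (smaller e lt) (smaller e′ lt′))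

    compare : ∀ {x y} → HeapAdj x y → toℕ x < toℕ y ⊎ toℕ y < toℕ x
    compare (inj₁ c) = inj₁ (child-> c)
    compare (inj₂ c) = inj₂ (child-> c)

    parent : ∀ (x : Fin n) → x ≢ top → ∃ λ (p : Fin n) → Child (toℕ p) (toℕ x)
    parent Fin.zero x≢ = ⊥-elim (x≢ refl)
    parent x@(Fin.suc y) _ = fromℕ< p<n , cong suc (toℕ-fromℕ< p<n)
      where
      p<n : ⌊ toℕ y /2⌋ < n
      p<n = ≤-<-trans (⌊n/2⌋≤n (toℕ y)) (<-trans (n<1+n _) (toℕ<n x))

  -- Once a path goes down the heap it keeps going down, since only one
  -- neighbour of a vertex is above it.
  down : ∀ x y ys z → Linked HeapAdj (x ∷ y ∷ ys ∷ʳ z) → Unique (x ∷ y ∷ ys) → All (z ≢_) (x ∷ y ∷ ys) →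
         toℕ x < toℕ y → toℕ x < toℕ z × ∃ λ p → p ∈ y ∷ ys × HeapAdj p z × toℕ p < toℕ z
  down x y [] z (xy ∷ yz ∷ _) u (z≢x ∷ _) lt with compare yz
  ... | inj₁ y<z = <-trans lt y<z , y , here refl , yz , y<z
  ... | inj₂ z<y = ⊥-elim (z≢x (smaller-unique (Sum.swap yz) xy z<y lt))
  down x y (w ∷ ys) z (xy ∷ l@(yw ∷ _)) ((_ ∷ x≢w ∷ _) ∷ u) (_ ∷ zs) lt with compare yw
  ... | inj₂ w<y = ⊥-elim (x≢w (smaller-unique xy (Sum.swap yw) lt w<y))
  ... | inj₁ y<w with down y w ys z l u zs y<w
  ...   | y<z , p , p∈ , e = <-trans lt y<z , p , there p∈ , e

  up-or-down : ∀ x y ys z → Linked HeapAdj (x ∷ y ∷ ys ∷ʳ z) → Unique (x ∷ y ∷ ys) → All (z ≢_) (x ∷ y ∷ ys) →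
               toℕ z < toℕ x ⊎ ∃ λ p → p ∈ y ∷ ys × HeapAdj p z × toℕ p < toℕ z
  up-or-down x y ys z l@(xy ∷ _) u zs with compare xy
  ... | inj₁ x<y = inj₂ (proj₂ (down x y ys z l u zs x<y))
  up-or-down x y [] z (_ ∷ yz ∷ _) u zs | inj₂ y<x with compare yz
  ... | inj₁ y<z = inj₂ (y , here refl , yz , y<z)
  ... | inj₂ z<y = inj₁ (<-trans z<y y<x)
  up-or-down x y (w ∷ ys) z (_ ∷ l) (_ ∷ u) (_ ∷ zs) | inj₂ y<x with up-or-down y w ys z l u zs
  ... | inj₁ z<y = inj₁ (<-trans z<y y<x)
  ... | inj₂ (p , p∈ , e) = inj₂ (p , there p∈ , e)

  -- Only one neighbour of a vertex has a smaller number. A cycle leaving `v` for a child would have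
  -- to descend forever or turn back to `v` at once; one leaving for the parent of `v` would have to
  -- come back through that same parent.
  heap-acyclic : Acyclic heap
  heap-acyclic v (x ∷ y ∷ ys) (_ , v≢ ∷ u@(x≢ ∷ _) , vx ∷ l@(xy ∷ _)) with compare vx
  heap-acyclic v (x ∷ y ∷ ys) (_ , v≢@(_ ∷ v≢y ∷ _) ∷ u , vx ∷ l@(xy ∷ _)) | inj₁ v<x with compare xy
  ... | inj₁ x<y = <-asym v<x (proj₁ (down x y ys v l u v≢ x<y))
  ... | inj₂ y<x = v≢y (smaller-unique vx (Sum.swap xy) v<x y<x)
  heap-acyclic v (x ∷ y ∷ ys) (_ , v≢ ∷ u@(x≢ ∷ _) , vx ∷ l) | inj₂ x<v with up-or-down x y ys v l u v≢
  ... | inj₁ v<x = <-asym v<x x<v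
  ... | inj₂ (p , p∈ , pv , p<v) = All.lookup x≢ p∈ (smaller-unique (Sum.swap vx) pv x<v p<v)
  heap-acyclic v [] (() , _)
  heap-acyclic v (_ ∷ []) (s≤s () , _)

  level-walk : ∀ k (x : Fin n) → level (toℕ x) ≡ k → Walk HeapAdj k x top
  level-walk zero x eq = subst (λ y → Walk HeapAdj 0 x y) (toℕ-injective (level-0 eq)) []
  level-walk (suc k) x eq with parent x (λ { refl → case eq of λ () })
  ... | p , c = inj₂ c ∷ level-walk k p (suc-injective (trans (sym (level-child {c = toℕ x} c)) eq))

  level-≤ : ∀ {k x} → Walk HeapAdj k x top → level (toℕ x) ≤ k
  level-≤ [] = z≤n
  level-≤ {x = x} (_∷_ {y = y} e w) = ≤-trans (step e) (s≤s (level-≤ w))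
    where
    step : HeapAdj x y → level (toℕ x) ≤ suc (level (toℕ y))
    step (inj₁ c) = m≤n⇒m≤1+n (level-mono (<⇒≤ (child-> c)))
    step (inj₂ c) = ≤-reflexive (level-child {c = toℕ x} c)

  heap-connected : Connected heap
  heap-connected x y = _ , level-walk _ x refl ⁀ reverse-walk Sum.swap (level-walk _ y refl)

  heap-dist : ∀ x → dist heap x top ≡ level (toℕ x)
  heap-dist x = ≤-antisym (dist-≤ heap (level-walk _ x refl)) (level-≤ (dist-walk heap (heap-connected x top)))

  module _ (x : Fin n) (x<i : toℕ x < i) where

    private
      2x<2i : toℕ x + toℕ x < 2 * i
      2x<2i = subst (toℕ x + toℕ x <_) (cong (i +_) (sym (+-identityʳ i))) (+-mono-< x<i x<i)
      2x+2≤2i : suc (suc (toℕ x + toℕ x)) ≤ 2 * i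
      2x+2≤2i = subst₂ _≤_ (cong suc (+-suc (toℕ x) (toℕ x))) (cong (i +_) (sym (+-identityʳ i))) (+-mono-≤ x<i x<i)

    left-child right-child : Fin n
    left-child  = fromℕ< (s≤s 2x<2i)
    right-child = fromℕ< (s≤s 2x+2≤2i)

    toℕ-left : toℕ left-child ≡ suc (toℕ x + toℕ x)
    toℕ-left = toℕ-fromℕ< (s≤s 2x<2i)

    toℕ-right : toℕ right-child ≡ suc (suc (toℕ x + toℕ x))
    toℕ-right = toℕ-fromℕ< (s≤s 2x+2≤2i)

    left-is-child : Child (toℕ x) (toℕ left-child)
    left-is-child = subst (Child (toℕ x)) (sym toℕ-left) (child₁ (toℕ x))

    right-is-child : Child (toℕ x) (toℕ right-child)
    right-is-child = subst (Child (toℕ x)) (sym toℕ-right) (child₂ (toℕ x))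

    children : ∀ {y} → Child (toℕ x) (toℕ y) → y ∈ left-child ∷ right-child ∷ []
    children {y} c with child-cases {c = toℕ y} c
    ... | inj₁ e = here (fin≡ e toℕ-left)
    ... | inj₂ e = there (here (fin≡ e toℕ-right))

    left≢right : left-child ≢ right-child
    left≢right e = m≢1+m+n _ {0} (trans (sym toℕ-left) (trans (cong toℕ e) (trans toℕ-right (cong suc (sym (+-identityʳ _))))))

    inner-deg-top : x ≡ top → deg heap x ≡ 2
    inner-deg-top refl = deg≡length heap ((left≢right ∷ []) ∷ [] ∷ []) (mk⇔ [ children , (λ ()) ]′
      (λ { (here refl) → inj₁ left-is-child ; (there (here refl)) → inj₁ right-is-child }))

    inner-deg : x ≢ top → deg heap x ≡ 3
    inner-deg x≢ with parent x x≢
    ... | p , c = deg≡length heap ((p≢ left-is-child ∷ p≢ right-is-child ∷ []) ∷ (left≢right ∷ []) ∷ [] ∷ [])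
        (mk⇔ [ there ∘ children , (λ c′ → here (toℕ-injective (child-unique {c = toℕ x} c′ c))) ]′
          (λ { (here refl) → inj₂ c ; (there (here refl)) → inj₁ left-is-child ; (there (there (here refl))) → inj₁ right-is-child }))
      where
      p≢ : ∀ {y} → Child (toℕ x) (toℕ y) → p ≢ y
      p≢ {y} c′ refl = <-asym (child-> c) (child-> c′)

  no-children : ∀ {x y : Fin n} → ¬ toℕ x < i → ¬ Child (toℕ x) (toℕ y)
  no-children {x} {y} x≮i c = <-irrefl refl (<-≤-trans lt (s≤s⁻¹ (toℕ<n y)))
    where
    i≤x = ≮⇒≥ x≮i
    lt : 2 * i < toℕ y
    lt with child-cases {c = toℕ y} c
    ... | inj₁ e = ≤-trans (s≤s (+-mono-≤ i≤x (≤-trans (≤-reflexive (+-identityʳ i)) i≤x))) (≤-reflexive (sym e))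
    ... | inj₂ e = ≤-trans (s≤s (m≤n⇒m≤1+n (+-mono-≤ i≤x (≤-trans (≤-reflexive (+-identityʳ i)) i≤x)))) (≤-reflexive (sym e))

  outer-deg : ∀ x → x ≢ top → ¬ toℕ x < i → deg heap x ≡ 1
  outer-deg x x≢ x≮i with parent x x≢
  ... | p , c = deg≡length heap ([] ∷ []) (mk⇔ [ (λ c′ → ⊥-elim (no-children {x} x≮i c′)) , (λ c′ → here (toℕ-injective (child-unique {c = toℕ x} c′ c))) ]′
                  λ { (here refl) → inj₂ c })

  pendant-outer : ∀ {x} → Pendant heap x → ¬ toℕ x < i
  pendant-outer {x} px x<i with x ≟ top
  ... | yes e  = case trans (sym px) (inner-deg-top x x<i e) of λ ()
  ... | no x≢  = case trans (sym px) (inner-deg x x<i x≢) of λ ()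

  open Rooted heap top

  parent⇒child : ∀ {p c} → Parent p c → Child (toℕ p) (toℕ c)
  parent⇒child (inj₁ e , _) = e
  parent⇒child {p} {c} (inj₂ e , h) = ⊥-elim (<-irrefl h (≤-trans (≤-reflexive (cong suc (trans (heap-dist c) refl)))
    (≤-trans (s≤s (level-mono (<⇒≤ (child-> e)))) (≤-reflexive (cong suc (sym (heap-dist p)))))))

  child⇒parent : ∀ {p c} → Child (toℕ p) (toℕ c) → Parent p c
  child⇒parent {p} {c} e = inj₁ e , trans (heap-dist c) (trans (level-child {c = toℕ c} e) (cong suc (sym (heap-dist p))))

  -- A heap fills its last level from the left, so the order is reversed to
  -- make the parents of the last level a final segment.
  ordering : Ordering
  ordering = record
    { _≺_ = λ x y → toℕ y < toℕ x
    ; linear = λ k → On.isStrictTotalOrder proj₁ (Flip.isStrictTotalOrder <-isStrictTotalOrder)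
    ; respects = λ {u} {v} {p} {q} _ pu qv p≢q → mk⇔
        (λ v<u → ≤∧≢⇒< (child-mono {c = toℕ v} {toℕ u} (parent⇒child qv) (parent⇒child pu) (<⇒≤ v<u)) (λ e → p≢q (toℕ-injective (sym e))))
        (λ q<p → ≰⇒> λ u≤v → <⇒≱ q<p (child-mono {c = toℕ u} {toℕ v} (parent⇒child pu) (parent⇒child qv) u≤v)) }

  final-segment : FinalSegment ordering
  final-segment u w hu hw (v , pv , hv , par) w<u = c , pendant , hc , child⇒parent ch
    where
    w<i : toℕ w < i
    w<i = ≰⇒> λ i≤w → no-children {u} (λ u<i → <-asym w<u (<-≤-trans u<i i≤w)) (parent⇒child par)
    c = left-child w w<i
    ch = left-is-child w w<i
    hc : height c ≡ ecc heap top
    hc = trans (proj₂ (child⇒parent ch)) hw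
    c≢top : c ≢ top
    c≢top e = case trans (sym (toℕ-left w w<i)) (cong toℕ e) of λ ()
    pendant : Pendant heap c
    pendant = outer-deg c c≢top λ c<i → <-irrefl refl (≤-trans
      (≤-reflexive (trans (cong suc (sym hc)) (sym (proj₂ (child⇒parent (left-is-child c c<i)))))) (dist≤ecc heap (left-child c c<i) top))

  heap-rgood : IsRgood heap top
  heap-rgood = record
    { rootedBinary = (heap-connected , heap-acyclic) , size
    ; balanced = bal
    ; orderable = ordering , final-segment }
    where
    size : n ≡ 1 ⊎ (deg heap top ≡ 2 × (∀ v → v ≢ top → deg heap v ≡ 1 ⊎ deg heap v ≡ 3))
    size with toℕ top <? i
    ... | no 0≮i = inj₁ (cong (λ i → suc (2 * i)) (n≤0⇒n≡0 (≮⇒≥ 0≮i)))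
    ... | yes 0<i = inj₂ (inner-deg-top top 0<i refl , λ v v≢ → case toℕ v <? i of λ
          { (yes v<i) → inj₂ (inner-deg v v<i v≢) ; (no v≮i) → inj₁ (outer-deg v v≢ v≮i) })
    bal : ∀ u v → Pendant heap u → Pendant heap v → height u ≤ suc (height v)
    bal u v pu pv = begin
      height u                               ≡⟨ heap-dist u ⟩
      level (toℕ u)                          ≤⟨ level-mono {toℕ u} (≤-trans (s≤s⁻¹ (toℕ<n u)) (≤-trans 2i≤ (n≤1+n _))) ⟩
      level (suc (toℕ v + toℕ v))            ≡⟨ level-child {c = suc (toℕ v + toℕ v)} (child₁ (toℕ v)) ⟩
      suc (level (toℕ v))                    ≡⟨ cong suc (heap-dist v) ⟨
      suc (height v)                         ∎
      where
      open ≤-Reasoning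
      i≤v = ≮⇒≥ (pendant-outer {v} pv)
      2i≤ : 2 * i ≤ toℕ v + toℕ v
      2i≤ = +-mono-≤ i≤v (≤-trans (≤-reflexive (+-identityʳ i)) i≤v)

-- Local maxima of f, caterpillars and identifications

module _ {n : ℕ} {G : Graph n} where

  f-tripod : ∀ {r a b c} → Branches G r (a ∷ b ∷ c ∷ []) → f G r ≡ suc (F a) * (suc (F b) * suc (F c))
  f-tripod {a = a} {b} {c} B = trans (f≡Fₗ B) (cong (λ x → suc (F a) * (suc (F b) * x)) (*-identityʳ (suc (F c))))

  f-child : ∀ {r v a₁ a₂ b c} → Branches G r (node v a₁ a₂ ∷ b ∷ c ∷ []) →
            f G v ≡ F (node v a₁ a₂) * suc (suc (F b) * suc (F c))
  f-child {a₁ = a₁} {a₂} B = trans (f-tripod (reroot B)) (sym (*-assoc (suc (F a₁)) (suc (F a₂)) _))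

  F-left : ∀ {V : Set} {v} (a b : LT V) → F a ≤ F (node v a b)
  F-left a b = ≤-trans (n≤1+n (F a)) (m≤m*n (suc (F a)) (suc (F b)))

  private
    swap-< : ∀ {x m} → x < m → x * suc m < suc x * m
    swap-< {x} {m} lt = subst (_< suc x * m) (sym (*-suc x m)) (+-monoˡ-< (x * m) lt)
    swap-≤ : ∀ {x m} → x ≤ m → x * suc m ≤ suc x * m
    swap-≤ {x} {m} le = subst (_≤ suc x * m) (sym (*-suc x m)) (+-monoˡ-≤ (x * m) le)

  -- Crossing the edge from r to the root v of a replaces (1 + F a) M by
  -- F a (1 + M), where M counts the subtrees containing r and avoiding a.
  descend-≤ : ∀ a {r b c} → Branches G r (a ∷ b ∷ c ∷ []) → F a ≤ suc (F b) * suc (F c) →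
              ∀ {x} → x ∈ verts a → f G x ≤ f G r
  descend-≤ (leaf v) {r} {b} {c} B le (here refl) = subst₂ _≤_ (sym (trans (f≡Fₗ (reroot-leaf B)) (*-comm (suc M) 1))) (sym (f-tripod B)) (swap-≤ {1} {M} (s≤s z≤n))
    where M = suc (F b) * suc (F c)
  descend-≤ (node v a₁ a₂) B le (here refl) = subst₂ _≤_ (sym (f-child B)) (sym (f-tripod B)) (swap-≤ le)
  descend-≤ (node v a₁ a₂) {r} {b} {c} B le (there x∈) with ∈-++⁻ (verts a₁) x∈
  ... | inj₁ p = ≤-trans (descend-≤ a₁ (reroot B) le₁ p) (descend-≤ (node v a₁ a₂) B le (here refl))
    where
    -- The condition passes to the children of `a`: the side ahead only shrinks and the side behind
    -- only grows.
    le₁ : F a₁ ≤ suc (F a₂) * suc (F (node r b c))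
    le₁ = ≤-trans (≤-trans (F-left {v = v} a₁ a₂) le) (≤-trans (n≤1+n _) (m≤n*m (suc (F (node r b c))) (suc (F a₂))))
  ... | inj₂ p = ≤-trans (descend-≤ a₂ (swap₁₂ (reroot B)) le₂ p) (descend-≤ (node v a₁ a₂) B le (here refl))
    where
    le₂ : F a₂ ≤ suc (F a₁) * suc (F (node r b c))
    le₂ = ≤-trans (≤-trans (≤-trans (F-left {v = v} a₂ a₁) (≤-reflexive (*-comm (suc (F a₂)) (suc (F a₁))))) le)
                  (≤-trans (n≤1+n _) (m≤n*m (suc (F (node r b c))) (suc (F a₁))))

  descend-< : ∀ a {r b c} → Branches G r (a ∷ b ∷ c ∷ []) → F a < suc (F b) * suc (F c) →
              ∀ {x} → x ∈ verts a → f G x < f G r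
  descend-< (leaf v) {r} {b} {c} B lt (here refl) = subst₂ _<_ (sym (trans (f≡Fₗ (reroot-leaf B)) (*-comm (suc M) 1))) (sym (f-tripod B)) (swap-< lt)
    where M = suc (F b) * suc (F c)
  descend-< (node v a₁ a₂) {r} {b} {c} B lt {x} x∈ = ≤-<-trans (below x∈) (subst₂ _<_ (sym (f-child B)) (sym (f-tripod B)) (swap-< lt))
    where
    M = F (node r b c)
    le₁ : F a₁ ≤ suc (F a₂) * suc M
    le₁ = ≤-trans (≤-trans (F-left {v = v} a₁ a₂) (<⇒≤ lt)) (≤-trans (n≤1+n _) (m≤n*m (suc M) (suc (F a₂))))
    le₂ : F a₂ ≤ suc (F a₁) * suc M
    le₂ = ≤-trans (≤-trans (≤-trans (F-left {v = v} a₂ a₁) (≤-reflexive (*-comm (suc (F a₂)) (suc (F a₁))))) (<⇒≤ lt))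
                  (≤-trans (n≤1+n _) (m≤n*m (suc M) (suc (F a₁))))
    below : x ∈ verts (node v a₁ a₂) → f G x ≤ f G v
    below (here refl) = ≤-refl
    below (there q) with ∈-++⁻ (verts a₁) q
    ... | inj₁ p = descend-≤ a₁ (reroot B) le₁ p
    ... | inj₂ p = descend-≤ a₂ (swap₁₂ (reroot B)) le₂ p

  core : ∀ {r a b c} → Branches G r (a ∷ b ∷ c ∷ []) → F a ≤ suc (F b) * suc (F c) →
         F b ≤ suc (F a) * suc (F c) → F c ≤ suc (F a) * suc (F b) → Core G r
  core {r} {a} {b} {c} B la lb lc x with position B x
  ... | atRoot = ≤-refl
  ... | inBranch (here refl) o = descend-≤ a B la (occ⇒∈ o)
  ... | inBranch (there (here refl)) o = descend-≤ b (swap₁₂ B) lb (occ⇒∈ o)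
  ... | inBranch (there (there (here refl))) o = descend-≤ c (to-front B) lc (occ⇒∈ o)

-- The number c_k of the overview, in the recursive form in which `Cat` produces it; `C≡` gives the
-- closed form.
C : ℕ → ℕ
C zero    = 1
C (suc k) = 2 * suc (C k)

data Cat {V : Set} : ℕ → LT V → Set where
  tip   : ∀ {v} → Cat 0 (leaf v)
  consˡ : ∀ {k v w t} → Cat k t → Cat (suc k) (node v (leaf w) t)
  consʳ : ∀ {k v w t} → Cat k t → Cat (suc k) (node v t (leaf w))

module _ {V : Set} where

  cat-F : ∀ {k} {t : LT V} → Cat k t → F t ≡ C k
  cat-F tip = refl
  cat-F (consˡ c) = cong (λ x → 2 * suc x) (cat-F c)
  cat-F {suc k} (consʳ {t = t} c) = trans (*-comm (suc (F t)) 2) (cong (λ x → 2 * suc x) (cat-F c))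

  cat-ht : ∀ {k} {t : LT V} → Cat k t → ht t ≡ k
  cat-ht tip = refl
  cat-ht (consˡ c) = cong suc (cat-ht c)
  cat-ht (consʳ {t = t} c) = cong suc (trans (⊔-identityʳ (ht t)) (cat-ht c))

  cat-inner : ∀ {k} {t : LT V} → Cat k t → inner t ≡ k
  cat-inner tip = refl
  cat-inner (consˡ c) = cong suc (cat-inner c)
  cat-inner (consʳ {t = t} c) = cong suc (trans (+-identityʳ (inner t)) (cat-inner c))

cat-map : ∀ {V W : Set} (g : V → W) {k t} → Cat k t → Cat k (mapLT g t)
cat-map g tip       = tip
cat-map g (consˡ c) = consˡ (cat-map g c)
cat-map g (consʳ c) = consʳ (cat-map g c)

module _ {n : ℕ} {G : Graph n} where

  same-branch : ∀ {ts : List (LT (Fin n))} {s t x} → Unique (vertsₗ ts) → s ∈ ts → t ∈ ts → x ∈ verts s → x ∈ verts t → s ≡ t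
  same-branch u (here refl) (here refl) _ _ = refl
  same-branch {s ∷ ts} u (here refl) (there t∈) x∈s x∈t = ⊥-elim (proj₂ (proj₂ (unique-++⁻ (verts s) u)) x∈s (∈-vertsₗ t∈ x∈t))
  same-branch {t ∷ ts} u (there s∈) (here refl) x∈s x∈t = ⊥-elim (proj₂ (proj₂ (unique-++⁻ (verts t) u)) x∈t (∈-vertsₗ s∈ x∈s))
  same-branch {t ∷ ts} u (there s∈) (there t∈) x∈s x∈t = same-branch (proj₁ (proj₂ (unique-++⁻ (verts t) u))) s∈ t∈ x∈s x∈t

  module _ {v : Fin n} {ts : List (LT (Fin n))} (B : Branches G v ts) where

    stay : ∀ {t x y} → t ∈ ts → x ∈ verts t → Adj G x y → y ≢ v → y ∈ verts t
    stay {t} t∈ x∈ e y≢v with fits-exit t (branch-fits B t∈) x∈ e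
    ... | inj₁ y∈ = y∈
    ... | inj₂ (_ , y≡v) = ⊥-elim (y≢v y≡v)

    stay-path : ∀ {t x xs} → t ∈ ts → x ∈ verts t → Linked (Adj G) (x ∷ xs) → v ∉ xs → ∀ {y} → y ∈ x ∷ xs → y ∈ verts t
    stay-path t∈ x∈ l v∉ (here refl) = x∈
    stay-path t∈ x∈ (e ∷ l) v∉ (there y∈) = stay-path t∈ (stay t∈ x∈ e (λ { refl → v∉ (here refl) })) l (v∉ ∘ there) y∈

    TwoBranches : List (Fin n) → Set
    TwoBranches xs = ∃₂ λ t t′ → t ∈ ts × t′ ∈ ts × (∀ {y} → y ∈ xs → y ≡ v ⊎ y ∈ verts t ⊎ y ∈ verts t′)

    after : ∀ {t} xs → t ∈ ts → Linked (Adj G) (v ∷ xs) → v ∉ xs → ∃ λ t′ → t′ ∈ ts × (∀ {y} → y ∈ xs → y ∈ verts t′)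
    after [] t∈ l v∉ = _ , t∈ , λ ()
    after (x ∷ xs) t∈ (_ ∷ l) v∉ with position B x
    ... | atRoot = ⊥-elim (v∉ (here refl))
    ... | inBranch t′∈ o = _ , t′∈ , stay-path t′∈ (occ⇒∈ o) l (v∉ ∘ there)

    two-branches : ∀ {t} x xs → t ∈ ts → x ∈ verts t → Linked (Adj G) (x ∷ xs) → Unique (x ∷ xs) →
                   ∃ λ t′ → t′ ∈ ts × (∀ {y} → y ∈ x ∷ xs → y ≡ v ⊎ y ∈ verts t ⊎ y ∈ verts t′)
    two-branches x [] t∈ x∈ l u = _ , t∈ , λ { (here refl) → inj₂ (inj₁ x∈) }
    two-branches x (y ∷ ys) t∈ x∈ (e ∷ l) (_ ∷ u) with y ≟ v
    ... | yes refl = let t′ , t′∈ , h = after ys t∈ l (Uniqueₚ.Unique[x∷xs]⇒x∉xs u) in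
          t′ , t′∈ , λ { (here refl) → inj₂ (inj₁ x∈) ; (there (here refl)) → inj₁ refl ; (there (there p)) → inj₂ (inj₂ (h p)) }
    ... | no y≢v = let t′ , t′∈ , h = two-branches y ys t∈ (stay t∈ x∈ e y≢v) l u in
          t′ , t′∈ , λ { (here refl) → inj₂ (inj₁ x∈) ; (there p) → h p }

    -- Changing from one branch to another requires passing `v`, and a path does so at most once.
    path-two-branches : ∀ {t xs} → t ∈ ts → IsPath G xs → TwoBranches xs
    path-two-branches {xs = []} t∈ _ = _ , _ , t∈ , t∈ , λ ()
    path-two-branches {xs = x ∷ xs} t∈ (l , u) with position B x
    ... | inBranch s∈ o = let t′ , t′∈ , h = two-branches x xs s∈ (occ⇒∈ o) l u in _ , t′ , s∈ , t′∈ , h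
    ... | atRoot = let t′ , t′∈ , h = after xs t∈ l (Uniqueₚ.Unique[x∷xs]⇒x∉xs u) in
          _ , t′ , t∈ , t′∈ , λ { (here refl) → inj₁ refl ; (there p) → inj₂ (inj₂ (h p)) }

  module Caterpillar (vs : List (Fin n)) (path : IsPath G vs) (dominating : ∀ v → v ∉ vs → Any (Adj G v) vs) where

    -- The child `root a` is on the path or adjacent to a vertex of it, and all its neighbours lie
    -- in the branch. So three branches that are not single leaves would all meet the path, against
    -- `path-two-branches`.
    meets : ∀ {u w a b} → Fits G u (node w a b) → ∃ λ x → x ∈ vs × x ∈ verts (node w a b)
    meets {w = w} {a} (_ , fa , _) with Any.any? (root a ≟_) vs
    ... | yes x∈ = root a , x∈ , there (∈-++⁺ˡ (root∈verts a))
    ... | no x∉ with find (dominating (root a) x∉)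
    ...   | y , y∈ , e with fits-exit a fa (root∈verts a) e
    ...     | inj₁ y∈a = y , y∈ , there (∈-++⁺ˡ y∈a)
    ...     | inj₂ (_ , refl) = y , y∈ , here refl

    no-tripod : ∀ {v a a₁ a₂ b b₁ b₂ c c₁ c₂} → ¬ Branches G v (node a a₁ a₂ ∷ node b b₁ b₂ ∷ node c c₁ c₂ ∷ [])
    no-tripod {v} {a} {a₁} {a₂} {b} {b₁} {b₂} {c} {c₁} {c₂} B with path-two-branches B (here refl) path
    ... | t , t′ , t∈ , t′∈ , h = pigeon (in-one (here refl)) (in-one (there (here refl))) (in-one (there (there (here refl))))
      where
      A₁ = node a a₁ a₂
      A₂ = node b b₁ b₂
      A₃ = node c c₁ c₂
      us : Unique (vertsₗ (A₁ ∷ A₂ ∷ A₃ ∷ []))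
      us with _ ∷ u ← Branches.uniq B = u
      in-one : ∀ {w x y} → node w x y ∈ A₁ ∷ A₂ ∷ A₃ ∷ [] → node w x y ≡ t ⊎ node w x y ≡ t′
      in-one s∈ with meets (branch-fits B s∈)
      ... | x , x∈vs , x∈ with h x∈vs
      ...   | inj₁ refl = ⊥-elim (root∉ B s∈ x∈)
      ...   | inj₂ (inj₁ x∈t) = inj₁ (same-branch us s∈ t∈ x∈ x∈t)
      ...   | inj₂ (inj₂ x∈t′) = inj₂ (same-branch us s∈ t′∈ x∈ x∈t′)
      disj = unique-++⁻ (verts A₁) us
      disj₂ = unique-++⁻ (verts A₂) (proj₁ (proj₂ disj))
      12≢ : A₁ ≢ A₂
      12≢ refl = proj₂ (proj₂ disj) (here refl) (here refl)
      13≢ : A₁ ≢ A₃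
      13≢ refl = proj₂ (proj₂ disj) (here refl) (∈-++⁺ʳ (verts A₂) (here refl))
      23≢ : A₂ ≢ A₃
      23≢ refl = proj₂ (proj₂ disj₂) (here refl) (here refl)
      pigeon : A₁ ≡ t ⊎ A₁ ≡ t′ → A₂ ≡ t ⊎ A₂ ≡ t′ → A₃ ≡ t ⊎ A₃ ≡ t′ → ⊥
      pigeon (inj₁ p) (inj₁ q) _ = 12≢ (trans p (sym q))
      pigeon (inj₁ p) (inj₂ q) (inj₁ r) = 13≢ (trans p (sym r))
      pigeon (inj₁ p) (inj₂ q) (inj₂ r) = 23≢ (trans q (sym r))
      pigeon (inj₂ p) (inj₂ q) _ = 12≢ (trans p (sym q))
      pigeon (inj₂ p) (inj₁ q) (inj₂ r) = 13≢ (trans p (sym r))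
      pigeon (inj₂ p) (inj₁ q) (inj₁ r) = 23≢ (trans q (sym r))

    cat-branch : ∀ t {u p q} → Branches G u (t ∷ p ∷ q ∷ []) → ∃ λ k → Cat k t
    cat-branch (leaf v) B = 0 , tip
    cat-branch (node v (leaf w) b) B =
      let k , c = cat-branch b (swap₁₂ (reroot B)) in suc k , consˡ c
    cat-branch (node v a@(node _ _ _) (leaf w)) B = let k , c = cat-branch a (reroot B) in suc k , consʳ c
    cat-branch (node v (node _ _ _) (node _ _ _)) B = ⊥-elim (no-tripod (reroot B))

  ecc-child : ∀ u {r c d} → Branches G r (u ∷ c ∷ d ∷ []) → suc (suc (ht c ⊔ ht d)) ≤ ecc G (root u)
  ecc-child (leaf v)     B = ecc-≥ (reroot-leaf B) (here refl)
  ecc-child (node _ _ _) B = ecc-≥ (reroot B) (there (there (here refl)))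

  -- Moving from `r` into `a` increases the distance to everything outside `a`. Maximality therefore
  -- makes `a` strictly deeper than `b`, and by symmetry `b` strictly deeper than `a`.
  maxEcc-not-tripod : ∀ {r a b c} → MaxEcc G r → ¬ Branches G r (a ∷ b ∷ c ∷ [])
  maxEcc-not-tripod {r} {a} {b} {c} me B = <-asym (longer B) (longer (swap₁₂ B))
    where
    longer : ∀ {a b c} → Branches G r (a ∷ b ∷ c ∷ []) → ht b < ht a
    longer {a} {b} {c} B = ≤-<-trans (m≤m⊔n (ht b) (ht c)) (≰⇒> λ ha≤ → <-irrefl refl (≤-trans (ecc-child a B)
      (≤-trans (me (root a)) (ecc-≤ B (s≤s ha≤ ∷ s≤s (m≤m⊔n _ _) ∷ s≤s (m≤n⊔m (ht b) _) ∷ [])))))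

  maxEcc-beyond : ∀ {e v z} c₁ c₂ d → MaxEcc G e → Branches G v (node z c₁ c₂ ∷ d ∷ leaf e ∷ []) → ¬ ecc G e ≤ suc (suc (ht d))
  maxEcc-beyond c₁ c₂ d me B le = <-irrefl refl (≤-trans (s≤s (s≤s (≤-trans (s≤s (m≤m⊔n (ht d) 0)) (m≤n⊔m (ht c₂) _))))
    (≤-trans (ecc-child c₁ (reroot B)) (≤-trans (me (root c₁)) le)))

  -- If both branches beyond `v` were inner, a child of the root of the shallower one would be at
  -- distance 2 from `v`, while `e` is at distance 1; its distance to the deepest leaf of the other
  -- branch would beat `ecc G e`.
  maxEcc-leaf : ∀ {e v a b} → MaxEcc G e → Branches G e (node v a b ∷ []) → (∃ λ w → a ≡ leaf w) ⊎ (∃ λ w → b ≡ leaf w)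
  maxEcc-leaf {a = leaf w} me B = inj₁ (w , refl)
  maxEcc-leaf {a = node _ _ _} {leaf w} me B = inj₂ (w , refl)
  maxEcc-leaf {e} {v} {a@(node _ a₁ a₂)} {b@(node _ b₁ b₂)} me B with ≤-total (ht a) (ht b)
  ... | inj₁ a≤b = ⊥-elim (maxEcc-beyond a₁ a₂ b me (reroot₁ B) (ecc-≤ B (s≤s (s≤s (⊔-lub a≤b ≤-refl)) ∷ [])))
  ... | inj₂ b≤a = ⊥-elim (maxEcc-beyond b₁ b₂ a me (swap₁₂ (reroot₁ B)) (ecc-≤ B (s≤s (s≤s (⊔-lub ≤-refl b≤a)) ∷ [])))

length≡3 : ∀ {A : Set} {xs : List A} → length xs ≡ 3 → ∃₂ λ x y → ∃ λ z → xs ≡ x ∷ y ∷ z ∷ []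
length≡3 {xs = x ∷ y ∷ z ∷ []} refl = x , y , z , refl

binary-deg : ∀ {n} {G : Graph n} → IsBinary G → ∀ v → deg G v ≡ 1 ⊎ deg G v ≡ 3
binary-deg {G = G} (_ , inner-deg) v with deg G v ≟ℕ 1
... | yes d1 = inj₁ d1
... | no ¬d1 = inj₂ (inner-deg v ¬d1)

caterpillar-branch : ∀ {n} {G : Graph n} {e} → IsBinaryCaterpillar G → MaxEcc G e →
                     ∃₂ λ k t → Cat k t × Branches G e (t ∷ [])
caterpillar-branch {G = G} {e} (bin , vs , path , dom) me
  with Extract.extract (proj₁ bin) e (λ v _ → binary-deg {G = G} bin v)
... | ts , B , len with binary-deg {G = G} bin e
...   | inj₂ d3 with length≡3 {xs = ts} (trans len d3)
...     | _ , _ , _ , refl = ⊥-elim (maxEcc-not-tripod me B)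
caterpillar-branch {G = G} {e} (bin , vs , path , dom) me | ts , B , len | inj₁ d1 with length≡1 {xs = ts} (trans len d1)
... | leaf v , refl = 0 , leaf v , tip , B
... | node v a b , refl with maxEcc-leaf me B
...   | inj₁ (w , refl) = let k , c = cat-branch b (swap₁₂ (reroot₁ B))
                          in suc k , _ , consˡ c , B
  where open Caterpillar vs path dom
...   | inj₂ (w , refl) = let k , c = cat-branch a (reroot₁ B) in suc k , _ , consʳ c , B
  where open Caterpillar vs path dom

module _ {k n : ℕ} {A : Graph k} {T : Graph n} (g : Fin k → Fin n) where

  fits-map : ∀ {u} t → (∀ {x xs} → x ∈ verts t → Neighbours A x xs → Neighbours T (g x) (map g xs)) →
             Fits A u t → Fits T (g u) (mapLT g t)
  fits-map (leaf v) h nb = h (here refl) nb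
  fits-map {u} (node v a b) h (nb , fa , fb) =
    subst₂ (λ x y → Neighbours T (g v) (g u ∷ x ∷ y ∷ [])) (sym (root-map g a)) (sym (root-map g b)) (h (here refl) nb) ,
    fits-map a (h ∘ there ∘ ∈-++⁺ˡ) fa , fits-map b (h ∘ there ∘ ∈-++⁺ʳ (verts a)) fb

  fitsₗ-map : ∀ {u} ts → (∀ {x xs} → x ∈ vertsₗ ts → Neighbours A x xs → Neighbours T (g x) (map g xs)) →
              All (Fits A u) ts → All (Fits T (g u)) (map (mapLT g) ts)
  fitsₗ-map [] h [] = []
  fitsₗ-map (t ∷ ts) h (f ∷ fs) = fits-map t (h ∘ ∈-++⁺ˡ) f ∷ fitsₗ-map ts (h ∘ ∈-++⁺ʳ (verts t)) fs

module _ {V W : Set} (g : V → W) where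

  roots-map : ∀ ts → map root (map (mapLT g) ts) ≡ map g (map root ts)
  roots-map []       = refl
  roots-map (t ∷ ts) = cong₂ _∷_ (root-map g t) (roots-map ts)

  vertsₗ-map : ∀ ts → vertsₗ (map (mapLT g) ts) ≡ map g (vertsₗ ts)
  vertsₗ-map []       = refl
  vertsₗ-map (t ∷ ts) = trans (cong₂ _++_ (verts-map g t) (vertsₗ-map ts)) (sym (map-++ g (verts t) (vertsₗ ts)))

-- Only the identified vertex receives neighbours from both trees. All other neighbour lists are
-- carried over by `ι` or `κ`, so the branches at the two vertices are just listed together.
glue : ∀ {k l n} {A : Graph k} {a} {B : Graph l} {b} {T : Graph n} (I : IsIdentification A a B b T) →
       let open IsIdentification I in ∀ {ts us} → Branches A a ts → Branches B b us →
       Branches T (ι a) (map (mapLT ι) ts ++ map (mapLT κ) us)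
glue {A = A} {a} {B} {b} {T} I {ts} {us} (branches nbA fA (a∉ ∷ uA) flA) (branches nbB fB (b∉ ∷ uB) flB) = branches
  (subst (Neighbours T (ι a)) (sym roots≡) nb)
  (Allₚ.++⁺ (fitsₗ-map ι ts (λ x∈ → nbι (λ { refl → Allₚ.All¬⇒¬Any a∉ x∈ })) fA)
            (subst (λ r → All (Fits T r) _) (sym ιa≡κb) (fitsₗ-map κ us (λ y∈ → nbκ (λ { refl → Allₚ.All¬⇒¬Any b∉ y∈ })) fB)))
  (subst (λ l → Unique (ι a ∷ l)) (sym verts≡) (Allₚ.¬Any⇒All¬ _ r∉ ∷ Uniqueₚ.++⁺ (Uniqueₚ.map⁺ ι-inj uA) (Uniqueₚ.map⁺ κ-inj uB) disj))
  (λ z → subst (λ l → z ∈ ι a ∷ l) (sym verts≡) (full z))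
  where
  open IsIdentification I
  ιa≡κb : ι a ≡ κ b
  ιa≡κb = from (meet a b) (refl , refl)
  roots≡ : map root (map (mapLT ι) ts ++ map (mapLT κ) us) ≡ map ι (map root ts) ++ map κ (map root us)
  roots≡ = trans (map-++ root (map (mapLT ι) ts) (map (mapLT κ) us)) (cong₂ _++_ (roots-map ι ts) (roots-map κ us))
  verts≡ : vertsₗ (map (mapLT ι) ts ++ map (mapLT κ) us) ≡ map ι (vertsₗ ts) ++ map κ (vertsₗ us)
  verts≡ = trans (concatMap-++ verts (map (mapLT ι) ts) (map (mapLT κ) us)) (cong₂ _++_ (vertsₗ-map ι ts) (vertsₗ-map κ us))
  nbι : ∀ {x xs} → x ≢ a → Neighbours A x xs → Neighbours T (ι x) (map ι xs)
  nbι {x} {xs} x≢a nbx {z} = mk⇔ ⇒ ⇐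
    where
    ⇒ : Adj T (ι x) z → z ∈ map ι xs
    ⇒ e with to (edges (ι x) z) e
    ... | inj₁ (x₁ , x₂ , p , refl , e′) with ι-inj p
    ...   | refl = ∈-map⁺ ι (to nbx e′)
    ⇒ e | inj₂ (y₁ , _ , p , _ , _) = ⊥-elim (x≢a (proj₁ (to (meet x y₁) (sym p))))
    ⇐ : z ∈ map ι xs → Adj T (ι x) z
    ⇐ p with ∈-map⁻ ι p
    ... | x₂ , x₂∈ , refl = from (edges (ι x) _) (inj₁ (x , x₂ , refl , refl , from nbx x₂∈))
  nbκ : ∀ {y ys} → y ≢ b → Neighbours B y ys → Neighbours T (κ y) (map κ ys)
  nbκ {y} {ys} y≢b nby {z} = mk⇔ ⇒ ⇐
    where
    ⇒ : Adj T (κ y) z → z ∈ map κ ys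
    ⇒ e with to (edges (κ y) z) e
    ... | inj₂ (y₁ , y₂ , p , refl , e′) with κ-inj p
    ...   | refl = ∈-map⁺ κ (to nby e′)
    ⇒ e | inj₁ (x₁ , _ , p , _ , _) = ⊥-elim (y≢b (proj₂ (to (meet x₁ y) p)))
    ⇐ : z ∈ map κ ys → Adj T (κ y) z
    ⇐ p with ∈-map⁻ κ p
    ... | y₂ , y₂∈ , refl = from (edges (κ y) _) (inj₂ (y , y₂ , refl , refl , from nby y₂∈))
  nb : Neighbours T (ι a) (map ι (map root ts) ++ map κ (map root us))
  nb {z} = mk⇔ ⇒ ⇐
    where
    ⇒ : Adj T (ι a) z → z ∈ map ι (map root ts) ++ map κ (map root us)
    ⇒ e with to (edges (ι a) z) e
    ... | inj₁ (x₁ , x₂ , p , refl , e′) with ι-inj p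
    ...   | refl = ∈-++⁺ˡ (∈-map⁺ ι (to nbA e′))
    ⇒ e | inj₂ (y₁ , y₂ , p , refl , e′) with κ-inj (trans p ιa≡κb)
    ...   | refl = ∈-++⁺ʳ (map ι (map root ts)) (∈-map⁺ κ (to nbB e′))
    ⇐ : z ∈ map ι (map root ts) ++ map κ (map root us) → Adj T (ι a) z
    ⇐ p with ∈-++⁻ (map ι (map root ts)) p
    ... | inj₁ q with ∈-map⁻ ι q
    ...   | x , x∈ , refl = from (edges (ι a) _) (inj₁ (a , x , refl , refl , from nbA x∈))
    ⇐ p | inj₂ q with ∈-map⁻ κ q
    ...   | y , y∈ , refl = from (edges (ι a) _) (inj₂ (b , y , sym ιa≡κb , refl , from nbB y∈))
  disj : ∀ {z} → z ∈ map ι (vertsₗ ts) × z ∈ map κ (vertsₗ us) → ⊥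
  disj (p , q) with ∈-map⁻ ι p | ∈-map⁻ κ q
  ... | x , x∈ , refl | y , y∈ , e with to (meet x y) e
  ...   | refl , refl = Allₚ.All¬⇒¬Any a∉ x∈
  r∉ : ι a ∉ map ι (vertsₗ ts) ++ map κ (vertsₗ us)
  r∉ p with ∈-++⁻ (map ι (vertsₗ ts)) p
  ... | inj₁ q with ∈-map⁻ ι q
  ...   | x , x∈ , e with ι-inj e
  ...     | refl = Allₚ.All¬⇒¬Any a∉ x∈
  r∉ p | inj₂ q with ∈-map⁻ κ q
  ...   | y , y∈ , e with κ-inj (trans (sym ιa≡κb) e)
  ...     | refl = Allₚ.All¬⇒¬Any b∉ y∈
  full : ∀ z → z ∈ ι a ∷ map ι (vertsₗ ts) ++ map κ (vertsₗ us)
  full z with cover z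
  ... | inj₁ (x , refl) with flA x
  ...   | here refl = here refl
  ...   | there x∈ = there (∈-++⁺ˡ (∈-map⁺ ι x∈))
  full z | inj₂ (y , refl) with flB y
  ...   | here refl = here (sym ιa≡κb)
  ...   | there y∈ = there (∈-++⁺ʳ (map ι (vertsₗ ts)) (∈-map⁺ κ y∈))

-- Crg trees

C+2 : ∀ k → C k + 2 ≡ 3 * 2 ^ k
C+2 zero    = refl
C+2 (suc k) = trans (solve 1 (λ c → con 2 :* (con 1 :+ c) :+ con 2 := con 2 :* (c :+ con 2)) refl (C k))
  (trans (cong (2 *_) (C+2 k)) (solve 1 (λ e → con 2 :* (con 3 :* e) := con 3 :* (con 2 :* e)) refl (2 ^ k)))

C≡ : ∀ k → 3 * 2 ^ k ∸ 2 ≡ C k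
C≡ k = trans (cong (_∸ 2) (sym (C+2 k))) (m+n∸n≡m (C k) 2)

C-positive : ∀ k → 1 ≤ C k
C-positive zero    = ≤-refl
C-positive (suc k) = s≤s z≤n

C-shift : ∀ k j → C (k + j) + 2 ≡ 2 ^ j * (C k + 2)
C-shift k j = trans (C+2 (k + j)) (trans (cong (3 *_) (^-distribˡ-+-* 2 k j))
  (trans (solve 2 (λ x y → con 3 :* (x :* y) := y :* (con 3 :* x)) refl (2 ^ k) (2 ^ j)) (cong (2 ^ j *_) (sym (C+2 k)))))

R-shift : ∀ i j → 2 ^ j * (R i + 2) ≤ R (i + j) + 2
R-shift i zero    = ≤-reflexive (trans (*-identityˡ (R i + 2)) (cong (λ x → R x + 2) (sym (+-identityʳ i))))
R-shift i (suc j) = begin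
  2 * 2 ^ j * (R i + 2)     ≡⟨ *-assoc 2 (2 ^ j) (R i + 2) ⟩
  2 * (2 ^ j * (R i + 2))   ≤⟨ *-monoʳ-≤ 2 (R-shift i j) ⟩
  2 * (R (i + j) + 2)       ≤⟨ R-step (i + j) ⟩
  R (suc (i + j)) + 2       ≡⟨ cong (λ x → R x + 2) (+-suc i j) ⟨
  R (i + suc j) + 2         ∎
  where open ≤-Reasoning

H-shift : ∀ i j → H i ≤ H (i + j) × H (i + j) ≤ H i + j
H-shift i zero rewrite +-identityʳ i | +-identityʳ (H i) = ≤-refl , ≤-refl
H-shift i (suc j) with H-shift i j | H-step (i + j)
... | p , q | p′ , q′ = subst (λ x → H i ≤ H x) (sym (+-suc i j)) (≤-trans p p′) ,
  subst₂ (λ x y → H x ≤ y) (sym (+-suc i j)) (sym (+-suc (H i) j)) (≤-trans q′ (s≤s q))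

H-mono : ∀ {i j} → i ≤ j → H i ≤ H j
H-mono {i} {j} le = subst (λ x → H i ≤ H x) (m+[n∸m]≡n le) (proj₁ (H-shift i (j ∸ i)))

-- `H` grows by at most one where `R + 2` at least doubles, starting from equality at 0. By `C+2`
-- this says `C (H i) ≤ R i`: an rgood tree counts at least as much as a caterpillar branch of its
-- height.
R≥2^H : ∀ i → 3 * 2 ^ H i ≤ R i + 2
R≥2^H zero    = ≤-refl
R≥2^H (suc i) = begin
  3 * 2 ^ H (suc i)     ≤⟨ *-monoʳ-≤ 3 (^-monoʳ-≤ 2 (proj₂ (H-step i))) ⟩
  3 * (2 * 2 ^ H i)     ≡⟨ solve 1 (λ e → con 3 :* (con 2 :* e) := con 2 :* (con 3 :* e)) refl (2 ^ H i) ⟩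
  2 * (3 * 2 ^ H i)     ≤⟨ *-monoʳ-≤ 2 (R≥2^H i) ⟩
  2 * (R i + 2)         ≤⟨ R-step i ⟩
  R (suc i) + 2         ∎
  where open ≤-Reasoning

Φ-mono : ∀ d {p q} → p ≤ q → q ≤ 2 ^ d → Φ d p ≤ Φ d q
Φ-mono d {p} {q} p≤q q≤ = subst (λ x → Φ d p ≤ Φ d x) (m+[n∸m]≡n p≤q) (go (q ∸ p) (≤-trans (≤-reflexive (m+[n∸m]≡n p≤q)) q≤))
  where
  go : ∀ j → p + j ≤ 2 ^ d → Φ d p ≤ Φ d (p + j)
  go zero    le = ≤-reflexive (cong (Φ d) (sym (+-identityʳ p)))
  go (suc j) le = ≤-trans (go j (≤-trans (+-monoʳ-≤ p (n≤1+n j)) le)) (subst (λ x → Φ d (p + j) ≤ Φ d x) (sym (+-suc p j))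
    (+-cancelʳ-≤ 2 _ _ (≤-trans (m≤m+n (Φ d (p + j) + 2) _) (Φ-step d (p + j) (subst (_≤ 2 ^ d) (+-suc p j) le)))))

inner≥ht : ∀ {V : Set} (t : LT V) → ht t ≤ inner t
inner≥ht (leaf _)     = z≤n
inner≥ht (node _ a b) = s≤s (⊔-lub (≤-trans (inner≥ht a) (m≤m+n _ _)) (≤-trans (inner≥ht b) (m≤n+m _ _)))

-- A longest path of a crg tree with h ≤ k + 1 has length h + k + 1 and meets
-- the root after h steps, so the center is ⌊(k + 1 - h) / 2⌋ away from the root.
offset : ℕ → ℕ → ℕ
offset k h = ⌊ suc k ∸ h /2⌋

offset-upper : ∀ {k h} → h ≤ suc k → h + (offset k h + offset k h) ≤ suc k × k ≤ h + (offset k h + offset k h)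
offset-upper {k} {h} le with double-half (suc k ∸ h) refl
... | inj₁ e = ≤-reflexive eq , ≤-trans (n≤1+n k) (≤-reflexive (sym eq))
  where eq = trans (cong (h +_) (sym e)) (m+[n∸m]≡n le)
... | inj₂ e = ≤-trans (n≤1+n _) (≤-reflexive eq) , ≤-reflexive (sym (suc-injective eq))
  where eq = trans (sym (+-suc h _)) (trans (cong (h +_) (sym e)) (m+[n∸m]≡n le))

offset-mono : ∀ {k h k′ h′} → k ≤ k′ → h′ ≤ h → offset k h ≤ offset k′ h′
offset-mono le le′ = ⌊n/2⌋-mono (∸-mono (s≤s le) le′)

offset-≥ : ∀ {k h s} → h + (s + s) ≤ suc k → s ≤ offset k h
offset-≥ {k} {h} {s} le = subst (_≤ offset k h) (sym (n≡⌊n+n/2⌋ s)) (⌊n/2⌋-mono (m+n≤o⇒m≤o∸n (s + s) (subst (_≤ suc k) (+-comm h (s + s)) le)))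

odd-length : ∀ i k → 2 * suc (i + k) ∸ suc (2 * i) ∸ 1 ≡ 2 * k
odd-length i k = cong (_∸ 1) (trans (cong (_∸ suc (2 * i)) (solve 2 (λ i k → con 2 :* (con 1 :+ (i :+ k)) := con 1 :+ con 2 :* i :+ (con 1 :+ con 2 :* k)) refl i k))
  (m+n∸m≡n (suc (2 * i)) (suc (2 * k))))

threshold : ∀ i k → 3 * 2 ^ ((2 * suc (i + k) ∸ suc (2 * i) ∸ 1) / 2) ∸ 2 ≡ C k
threshold i k = trans (cong (λ x → 3 * 2 ^ x ∸ 2) (trans (cong (_/ 2) (trans (odd-length i k) (*-comm 2 k))) (m*n/n≡m k 2))) (C≡ k)

pair-bal : ∀ {V : Set} {a b : LT V} {d p q} v → Bal d a p → Bal d b q → LeftFirst d p q → Bal (suc d) (node v a b) (p + q)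
pair-bal v x y l = node x y (inj₁ l)

-- Uniqueness of the rgood tree enters only numerically: each one has the shape `Bal`, and `bal-R`
-- determines its count.
IsR⇒R : ∀ {l x} → IsR l x → ∃ λ i → l ≡ suc (2 * i) × x ≡ R i
IsR⇒R {l} (G , r , rg , refl) with RgoodShape.rgood-branches rg
... | _ , B , single = 0 , sym (rooted-size B) , f≡Fₗ B
... | _ , B , pair {a} {b} x y o = inner t , trans (sym (rooted-size B)) (trans (cong (suc ∘ length) (cong (verts a ++_) (++-identityʳ (verts b)))) (length-verts t)) ,
    trans (f≡Fₗ B) (trans (cong (suc (F a) *_) (*-identityʳ (suc (F b)))) (bal-R (pair-bal r x y o)))
  where
  t = node r a b

R-exists : ∀ i → IsR (suc (2 * i)) (R i)
R-exists i with IsR⇒R (heap , top , heap-rgood , refl)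
  where open Heap i
... | j , e , x = heap , top , heap-rgood , trans x (cong R (sym (*-cancelˡ-≡ i j 2 (suc-injective e))))
  where open Heap i

exceeds⁺ : ∀ i k → C k < R i → Exceeds (2 * suc (i + k)) (suc (2 * i))
exceeds⁺ i k lt = R i , R-exists i , subst (_< R i) (sym (threshold i k)) lt

exceeds⁻ : ∀ i k → Exceeds (2 * suc (i + k)) (suc (2 * i)) → C k < R i
exceeds⁻ i k (x , isR , lt) with IsR⇒R isR
... | j , e , refl = subst₂ _<_ (threshold i k) (cong R (sym (*-cancelˡ-≡ i j 2 (suc-injective e)))) lt

leftFirst-Φ : ∀ {d p q} → p ≤ 2 ^ d → q ≤ 2 ^ d → LeftFirst d p q → Φ d q ≤ Φ d p
leftFirst-Φ {d} p≤ q≤ (inj₁ refl) = Φ-mono d q≤ ≤-refl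
leftFirst-Φ {d} p≤ q≤ (inj₂ refl) = Φ-mono d z≤n p≤

leftFirst-height : ∀ {d p q} → LeftFirst d p q → heightΦ d q ≤ heightΦ d p
leftFirst-height {d} {p}     (inj₂ refl) = proj₁ (heightΦ-bounds d p)
leftFirst-height {d} {p} {q} (inj₁ eq) = ≤-trans (proj₂ (heightΦ-bounds d q)) (full (subst (0 <_) (sym eq) (2^d>0 d)))
  where
  full : ∀ {x} → 0 < x → suc d ≤ heightΦ d x
  full z<s = ≤-refl

-- The rgood part consists of `r`, `a` and `b`, where `ord` makes `a` the larger one in count and
-- height; `c` is the rest of the caterpillar. The root is counted in `i`, not in `k`.
record CrgTree {n} (T : Graph n) (i k : ℕ) : Set where
  field
    {r}     : Fin n
    {a b c} : LT (Fin n)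
    {d p q} : ℕ
    br      : Branches T r (a ∷ b ∷ c ∷ [])
    bal-a   : Bal d a p
    bal-b   : Bal d b q
    ord     : LeftFirst d p q
    cat     : Cat k c
    inner≡  : inner (node r a b) ≡ i

  bal : Bal (suc d) (node r a b) (p + q)
  bal = pair-bal r bal-a bal-b ord

  F≡R : suc (F a) * suc (F b) ≡ R i
  F≡R = trans (bal-R bal) (cong R inner≡)

  ht≡H : suc (ht a ⊔ ht b) ≡ H i
  ht≡H = trans (bal-H bal) (cong H inner≡)

  F-ordered : F b ≤ F a
  F-ordered = subst₂ _≤_ (sym (bal-F bal-b)) (sym (bal-F bal-a)) (leftFirst-Φ {d} (bal-≤ bal-a) (bal-≤ bal-b) ord)

  ht-ordered : ht b ≤ ht a
  ht-ordered = subst₂ _≤_ (sym (bal-ht bal-b)) (sym (bal-ht bal-a)) (leftFirst-height {d} {p} {q} ord)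

  ht-close : ht a ≤ suc (ht b)
  ht-close = subst₂ (λ x y → x ≤ suc y) (sym (bal-ht bal-a)) (sym (bal-ht bal-b))
    (≤-trans (proj₂ (heightΦ-bounds d p)) (s≤s (proj₁ (heightΦ-bounds d q))))

  H≡ : H i ≡ suc (ht a)
  H≡ = trans (sym ht≡H) (cong suc (m≥n⇒m⊔n≡m ht-ordered))

crgTree : ∀ {n l} {T : Graph n} → 3 ≤ l → IsCrg l T →
          ∃₂ λ i k → CrgTree T i k × l ≡ suc (2 * i) × n ≡ 2 * suc (i + k)
crgTree {n} {l} {T} 3≤l crg with RgoodShape.rgood-branches (IsCrg.rgood crg) | caterpillar-branch (IsCrg.caterpillar crg) (IsCrg.maxEcc crg)
... | _ , B , single | _ = ⊥-elim (<⇒≱ 3≤l (≤-trans (≤-reflexive (sym (rooted-size B))) (s≤s z≤n)))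
... | _ , B , pair {a} {b} x y o | k , c , cat , B′ = inner t , k , record
      { br = br ; bal-a = bal-map ι x ; bal-b = bal-map ι y ; ord = o ; cat = cat-map κ cat
      ; inner≡ = cong₂ (λ x y → suc (x + y)) (inner-map ι a) (inner-map ι b) } ,
    trans (sym (rooted-size B)) (trans (cong (suc ∘ length) (cong (verts a ++_) (++-identityʳ (verts b)))) (length-verts t)) ,
    trans (sym (rooted-size br)) n≡
  where
  open IsIdentification (IsCrg.identified crg)
  t = node (IsCrg.root crg) a b
  br = glue (IsCrg.identified crg) B B′
  a′ = mapLT ι a
  b′ = mapLT ι b
  c′ = mapLT κ c
  len : ∀ {k} (g : Fin k → Fin n) u → length (verts (mapLT g u)) ≡ suc (2 * inner u)
  len g u = trans (length-verts (mapLT g u)) (cong (λ x → suc (2 * x)) (inner-map g u))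
  n≡ : suc (length (vertsₗ (a′ ∷ b′ ∷ c′ ∷ []))) ≡ 2 * suc (inner t + k)
  n≡ = begin
    suc (length (verts a′ ++ verts b′ ++ verts c′ ++ [])) ≡⟨ cong suc (trans (length-++ (verts a′)) (cong (length (verts a′) +_) (trans (length-++ (verts b′)) (cong (λ l → length (verts b′) + length l) (++-identityʳ (verts c′)))))) ⟩
    suc (length (verts a′) + (length (verts b′) + length (verts c′))) ≡⟨ cong₂ (λ x y → suc (x + y)) (len ι a) (cong₂ _+_ (len ι b) (trans (len κ c) (cong (λ x → suc (2 * x)) (cat-inner cat)))) ⟩
    suc (suc (2 * inner a) + (suc (2 * inner b) + suc (2 * k))) ≡⟨ solve 3 (λ x y z → con 1 :+ (con 1 :+ con 2 :* x :+ (con 1 :+ con 2 :* y :+ (con 1 :+ con 2 :* z))) := con 2 :* (con 1 :+ (con 1 :+ (x :+ y) :+ z))) refl (inner a) (inner b) k ⟩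
    2 * suc (inner t + k) ∎
    where open ≡-Reasoning

-- The path of the caterpillar

module _ {n : ℕ} (T : Graph n) where

  -- A vertex x of the caterpillar's path, with k inner vertices beyond it. The
  -- component of x after removing the next edge of the path has height e and
  -- g subtrees containing x.
  record Spine (x : Fin n) (k g e : ℕ) : Set where
    field
      {p q t} : LT (Fin n)
      br      : Branches T x (p ∷ q ∷ t ∷ [])
      count   : suc (F p) * suc (F q) ≡ g
      high    : suc (ht p ⊔ ht q) ≡ e
      cat     : Cat k t

    -- f does not grow from x towards p or q.
    Settled : Set
    Settled = F p ≤ suc (F q) * suc (F t) × F q ≤ suc (F p) * suc (F t)

module _ {n : ℕ} {T : Graph n} where

  -- The vertex left behind becomes a branch with count `g` next to a single leaf, whence
  -- `2 * suc g`. The condition `g ≤ C (suc k)` compares this branch with the rest at the new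
  -- vertex, so it says that `f` does not grow backwards.
  spine-step : ∀ {x k g e} (S : Spine T x (suc k) g e) → ∃ λ y → Σ (Spine T y k (2 * suc g) (suc e)) λ S′ →
               Adj T x y × (g ≤ C (suc k) → Spine.Settled S′)
  spine-step {x} {k} {g} {e} S with Spine.cat S | Spine.br S
  ... | consˡ {v = y} {w} {t′} c | B = y , record
      { p = leaf w ; q = node x p q ; t = t′
      ; br = swap₂₃ (reroot (to-front B)) ; count = cong (λ g → 2 * suc g) count ; high = cong suc high ; cat = c } ,
      from (Branches.nbrs B) (there (there (here refl))) ,
      λ le → s≤s z≤n , subst₂ _≤_ (sym count) (sym (cat-F (consˡ {v = y} {w} c))) le
    where open Spine S using (p; q; count; high)
  ... | consʳ {v = y} {w} {t′} c | B = y , record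
      { p = leaf w ; q = node x p q ; t = t′
      ; br = swap₂₃ (swap₁₂ (reroot (to-front B))) ; count = cong (λ g → 2 * suc g) count ; high = cong suc high ; cat = c } ,
      from (Branches.nbrs B) (there (there (here refl))) ,
      λ le → s≤s z≤n , subst₂ _≤_ (sym count) (sym (cat-F (consˡ {v = y} {w} c))) le
    where open Spine S using (p; q; count; high)

  spine-walk : ∀ j {x k g e} → Spine T x (j + k) g e → ∃₂ λ y g′ → Spine T y k g′ (j + e) × Walk (Adj T) j x y
  spine-walk zero S = _ , _ , S , []
  spine-walk (suc j) {x} {k} {g} {e} S with spine-step S
  ... | y , S₁ , xy , _ with spine-walk j S₁
  ...   | z , g′ , S₂ , w = z , g′ , subst (Spine T z k g′) (+-suc j e) S₂ , xy ∷ w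

  spine-ecc : ∀ {x k g e} → Spine T x k g e → e ≤ suc k → ecc T x ≤ suc k
  spine-ecc {k = k} S le = ecc-≤ br
    (≤-trans (≤-trans (s≤s (m≤m⊔n (ht p) (ht q))) (≤-reflexive high)) le ∷
     ≤-trans (≤-trans (s≤s (m≤n⊔m (ht p) (ht q))) (≤-reflexive high)) le ∷ s≤s (≤-reflexive (cat-ht cat)) ∷ [])
    where open Spine S

  spine-center : ∀ {x k g e} → Spine T x k g e → e ≤ suc k → k ≤ e → Center T x
  spine-center {x} {k} {g} {e} S le ge = [ at-p , at-q ]′ (⊔-sel (ht p) (ht q))
    where
    open Spine S
    balanced : ∀ {u v} → Branches T x (u ∷ t ∷ v ∷ []) → suc (ht u) ≡ e → suc (ht v) ≤ e → Center T x
    balanced B hu hv = center B (≤-trans (≤-reflexive hu) le ∷ s≤s (≤-reflexive (cat-ht cat)) ∷ ≤-trans hv le ∷ [])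
      (s≤s (+-mono-≤ (≤-trans ge (≤-reflexive (sym hu))) (s≤s (≤-reflexive (sym (cat-ht cat))))))
    at-p : ht p ⊔ ht q ≡ ht p → Center T x
    at-p eq = balanced (swap₂₃ br) (trans (cong suc (sym eq)) high) (≤-trans (s≤s (m≤n⊔m (ht p) (ht q))) (≤-reflexive high))
    at-q : ht p ⊔ ht q ≡ ht q → Center T x
    at-q eq = balanced (swap₂₃ (swap₁₂ br)) (trans (cong suc (sym eq)) high) (≤-trans (s≤s (m≤m⊔n (ht p) (ht q))) (≤-reflexive high))

  spine-core : ∀ {x k g e} (S : Spine T x k g e) → Spine.Settled S → C k ≤ g → Core T x
  spine-core S (sp , sq) le = core br sp sq (subst₂ _≤_ (sym (cat-F cat)) (sym count) le)
    where open Spine S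

  near : ∀ {x y k} → Center T x → Core T y → Walk (Adj T) k x y → d[C,S] T ≤ k
  near cx sy w = setDist-≤ T (center? T) (core? T) cx sy (dist-≤ T w)

  -- Here `t` is the part of the way to the center that remains when the climb stops. If it is
  -- positive, `f` drops after `j` steps: the side behind, whose count plus 2 has grown to
  -- `2 ^ j * (g + 2)`, outweighs the caterpillar ahead.
  Climbed : ℕ → ℕ → ℕ → Set
  Climbed s k g = ∃ λ t → d[C,S] T ≤ t × (t ≡ 0 ⊎ ∃ λ j → j + t ≡ s × C (t + k) + 2 < 2 ^ j * (g + 2))

  -- Walk along the path towards the center as long as f does not drop. Where f
  -- drops, or else at the center, the core is reached.
  climb : ∀ s {x k g e} (S : Spine T x (s + k) g e) → Spine.Settled S → s + e ≤ suc k → k ≤ s + e → C k + 2 ≤ 2 ^ s * (g + 2) →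
          Climbed s k g
  -- At the center `fin` reads `C k ≤ g`: `f` does not grow beyond it, so the center itself lies in
  -- the core.
  climb zero {k = k} {g} S st le ge fin =
    0 , near (spine-center S le ge) (spine-core S st (+-cancelʳ-≤ 2 _ _ (subst (C k + 2 ≤_) (*-identityˡ (g + 2)) fin))) [] , inj₁ refl
  climb (suc s) {x} {k} {g} {e} S st le ge fin = [ stop , continue ]′ (<-≤-connex (C (suc s + k)) g)
    where
    double : ∀ j → 2 ^ j * (2 * suc g + 2) ≡ 2 ^ suc j * (g + 2)
    double j = solve 2 (λ x g → x :* (con 2 :* (con 1 :+ g) :+ con 2) := con 2 :* x :* (g :+ con 2)) refl (2 ^ j) g
    stop : C (suc s + k) < g → Climbed (suc s) k g
    stop lt = let _ , _ , S′ , w = spine-walk (suc s) S in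
      suc s , near (spine-center S′ le ge) (spine-core S st (<⇒≤ lt)) (reverse-walk (symm T) w) ,
      inj₂ (0 , refl , subst (C (suc s + k) + 2 <_) (sym (*-identityˡ (g + 2))) (+-monoˡ-< 2 lt))
    continue : g ≤ C (suc s + k) → Climbed (suc s) k g
    continue g≤ =
      let _ , S′ , _ , settled = spine-step S
          t , d≤ , r = climb s S′ (settled g≤) (subst (_≤ suc k) (sym (+-suc s e)) le) (subst (k ≤_) (sym (+-suc s e)) ge)
                         (subst (C k + 2 ≤_) (sym (double s)) fin)
      in t , d≤ , Sum.map₂ (λ (j , eq , lt) → suc j , cong suc eq , subst (C (t + k) + 2 <_) (double j) lt) r

module _ {n : ℕ} {T : Graph n} where

  module Bounds {i k : ℕ} (X : CrgTree T i k) where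

    open CrgTree X

    spine : Spine T r k (R i) (H i)
    spine = record { br = br ; count = F≡R ; high = ht≡H ; cat = cat }

    F-c : F c ≡ C k
    F-c = cat-F cat

    H-positive : 1 ≤ H i
    H-positive = ≤-trans (s≤s z≤n) (≤-reflexive ht≡H)

    spine-at : ∀ s → H i + (s + s) ≤ suc k →
               ∃₂ λ x k′ → ∃ λ g → s + k′ ≡ k × s + H i ≤ suc k′ × Spine T x k′ g (s + H i) × Walk (Adj T) s r x
    spine-at s le = at (spine-walk s (subst (λ k → Spine T r k (R i) (H i)) (sym k≡) spine))
      where
      k≡ : s + (k ∸ s) ≡ k
      k≡ = m+[n∸m]≡n (s≤s⁻¹ (≤-trans (+-mono-≤ H-positive (m≤m+n s s)) le))
      le′ : s + H i ≤ suc (k ∸ s)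
      le′ = +-cancelˡ-≤ s _ _ (subst₂ _≤_ (solve 2 (λ h s → h :+ (s :+ s) := s :+ (s :+ h)) refl (H i) s)
                                          (trans (cong suc (sym k≡)) (sym (+-suc s (k ∸ s)))) le)
      at : (∃₂ λ x g → Spine T x (k ∸ s) g (s + H i) × Walk (Adj T) s r x) → _
      at (x , g , S , w) = x , k ∸ s , g , k≡ , le′ , S , w

    past-center : ∀ {k′} → offset k (H i) + k′ ≡ k → k ≤ H i + (offset k (H i) + offset k (H i)) → k′ ≤ offset k (H i) + H i
    past-center {k′} k≡ ge = +-cancelˡ-≤ s _ _ (subst₂ _≤_ (sym k≡) (solve 2 (λ h s → h :+ (s :+ s) := s :+ (s :+ h)) refl (H i) s) ge)
      where s = offset k (H i)

    at-offset : H i ≤ suc k → ∃ λ x → Center T x × Walk (Adj T) (offset k (H i)) r x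
    at-offset h≤ =
      let le , ge = offset-upper {k} {H i} h≤
          x , k′ , _ , k≡ , le′ , S , w = spine-at (offset k (H i)) le
      in x , spine-center S le′ (past-center k≡ ge) , w

    far-end : LT (Fin n)
    far-end = leaf (proj₁ (deepest c))

    far-occ : Occ c k far-end
    far-occ = subst (λ j → Occ c j far-end) (cat-ht cat) (proj₂ (deepest c))

    connected : Connected T
    connected = rooted-connected br

    core-not-in-c : C k < R i → ∀ {y} → Core T y → y ∉ verts c
    core-not-in-c lt {y} cy y∈ = <⇒≱ (descend-< c (to-front br) (subst₂ _<_ (sym F-c) (sym F≡R) lt) y∈) (cy r)

    c∈ : c ∈ a ∷ b ∷ c ∷ []
    c∈ = there (there (here refl))

    exit : ∀ {y l} → y ∉ verts c → Walk (Adj T) l (root far-end) y → suc k ≤ l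
    exit y∉ w = ≤-trans (m≤m+n _ _) (proj₂ (proj₂ (walk-exit (branch-fits br c∈) far-occ y∉ w)))

    -- The spine vertex `suc s` steps from `r` has eccentricity at most `suc k′`, hence so has each
    -- center `x`. The far end of the caterpillar is at distance `suc k`, which is `suc s + suc k′`,
    -- from `r` and at least that from everything outside `c`. So `x` lies in `c`, at distance at
    -- least `suc s` from `r`.
    center-far : ∀ {s} → H i + (suc s + suc s) ≤ suc k → ∀ {x} → Center T x →
                 ∃₂ λ j u → Occ c j u × root u ≡ x × s ≤ j
    center-far {s} le {x} cx = far
      where
      sp = spine-at (suc s) le
      x′ = proj₁ sp
      k′ = proj₁ (proj₂ sp)
      k≡ : suc s + k′ ≡ k
      k≡ = proj₁ (proj₂ (proj₂ (proj₂ sp)))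
      ecc≤′ : ecc T x′ ≤ suc k′
      ecc≤′ = let _ , _ , _ , _ , le′ , S , _ = sp in spine-ecc S le′
      dist≤ : dist T (root far-end) x ≤ suc k′
      dist≤ = ≤-trans (dist≤ecc T (root far-end) x) (≤-trans (cx x′) ecc≤′)
      to-x : Walk (Adj T) (dist T (root far-end) x) (root far-end) x
      to-x = dist-walk T (connected (root far-end) x)
      outside : ∀ {A : Set} → x ∉ verts c → A
      outside x∉ = ⊥-elim (<⇒≱ (≤-trans (s≤s (s≤s (m≤n+m k′ s))) (≤-reflexive (cong suc k≡))) (≤-trans (exit x∉ to-x) dist≤))
      inside : ∀ {j u} → Occ c j u → root u ≡ x → s ≤ j
      inside {j} o refl = +-cancelˡ-≤ (suc (suc k′)) s j (≤-trans (≤-reflexive (cong suc (trans (cong suc (+-comm k′ s)) k≡)))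
        (≤-trans (exit (root∉ br c∈) (to-x ⁀ walk-in (branch-fits br c∈) o))
          (≤-trans (+-monoˡ-≤ (suc j) dist≤) (≤-reflexive (+-suc (suc k′) j)))))
      far : ∃₂ λ j u → Occ c j u × root u ≡ x × s ≤ j
      far with Any.any? (x ≟_) (verts c)
      ... | no x∉ = outside x∉
      ... | yes x∈ = let j , u , o , e = ∈⇒occ c x∈ in j , u , o , e , inside o e

    -- `f` is strictly smaller inside `c` than at `r`, so the core avoids `c`, while every center
    -- lies deep in `c`. Each walk between them passes `r`.
    lower : n ≡ 2 * suc (i + k) → C k < R i → offset k (H i) ≤ d[C,S] T
    lower n≡ lt = go (offset k (H i)) refl
      where
      go : ∀ s → offset k (H i) ≡ s → s ≤ d[C,S] T
      go zero    _  = z≤n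
      go (suc s) eq = setDist-≥ T (center? T) (core? T) s≤n apart
        where
        h≤ : H i ≤ suc k
        h≤ = ≮⇒≥ λ h> → case trans (sym eq) (cong ⌊_/2⌋ (m≤n⇒m∸n≡0 (<⇒≤ h>))) of λ ()
        le : H i + (suc s + suc s) ≤ suc k
        le = subst (λ s → H i + (s + s) ≤ suc k) eq (proj₁ (offset-upper {k} {H i} h≤))
        -- `setDist` takes a minimum that includes the default `n`, so the bound must be at most
        -- `n`.
        s≤n : suc s ≤ n
        s≤n = ≤-trans (≤-trans (m≤m+n (suc s) (suc s)) (≤-trans (m≤n+m _ (H i)) le))
                (≤-trans (s≤s (m≤n+m k i)) (≤-trans (m≤m+n _ _) (≤-reflexive (sym n≡))))
        apart : ∀ {x y} → Center T x → Core T y → suc s ≤ dist T x y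
        apart {x} {y} cx cy =
          let j , u , o , e , s≤j = center-far le cx
              w = subst (λ z → Walk (Adj T) (dist T x y) z y) (sym e) (dist-walk T (connected x y))
          in ≤-trans (s≤s s≤j) (≤-trans (m≤m+n _ _) (proj₂ (proj₂ (walk-exit (branch-fits br c∈) o (core-not-in-c lt cy) w))))

    R-below : R i ≤ C k → H i ≤ k
    R-below le = ≮⇒≥ λ k<h → <⇒≱ (*-monoʳ-< 3 (^-monoʳ-< 2 (s≤s (s≤s z≤n)) k<h))
      (≤-trans (R≥2^H i) (≤-trans (+-monoˡ-≤ 2 le) (≤-reflexive (C+2 k))))

    settled : R i ≤ C k → Spine.Settled spine
    settled R≤ = ≤-trans (≤-trans (≤-trans (n≤1+n (F a)) (m≤m*n (suc (F a)) (suc (F b)))) big) (m≤n*m (suc (F c)) (suc (F b))) ,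
                 ≤-trans (≤-trans (≤-trans (n≤1+n (F b)) (m≤n*m (suc (F b)) (suc (F a)))) big) (m≤n*m (suc (F c)) (suc (F a)))
      where
      big : suc (F a) * suc (F b) ≤ suc (F c)
      big = m≤n⇒m≤1+n (subst₂ _≤_ (sym F≡R) (sym F-c) R≤)

    climb-bound : R i ≤ C k → ∃ λ t → d[C,S] T ≤ t ×
                  (t ≡ 0 ⊎ ∃₂ λ j k′ → j + t ≡ offset k (H i) × offset k (H i) + k′ ≡ k × C (t + k′) + 2 < 2 ^ j * (R i + 2))
    climb-bound R≤ =
      let t , d≤ , r = climb s (proj₁ start) (proj₂ start) (proj₁ (proj₂ (proj₂ (proj₂ (proj₂ sp))))) (past-center k≡ (proj₂ off)) fin
      in t , d≤ , Sum.map₂ (λ (j , eq , lt) → j , k′ , eq , k≡ , lt) r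
      where
      s = offset k (H i)
      off : H i + (s + s) ≤ suc k × k ≤ H i + (s + s)
      off = offset-upper {k} {H i} (m≤n⇒m≤1+n (R-below R≤))
      sp = spine-at s (proj₁ off)
      k′ : ℕ
      k′ = proj₁ (proj₂ sp)
      k≡ : s + k′ ≡ k
      k≡ = proj₁ (proj₂ (proj₂ (proj₂ sp)))
      start : Σ (Spine T r (s + k′) (R i) (H i)) Spine.Settled
      start = subst (λ k → Σ (Spine T r k (R i) (H i)) Spine.Settled) (sym k≡) (spine , settled R≤)
      -- At the center the caterpillar ahead has height `k′`, at most `s + H i`, and by `R≥2^H` the
      -- `s` doublings bring the side behind up to its count.
      fin : C k′ + 2 ≤ 2 ^ s * (R i + 2)
      fin = begin
        C k′ + 2                 ≡⟨ C+2 k′ ⟩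
        3 * 2 ^ k′               ≤⟨ *-monoʳ-≤ 3 (^-monoʳ-≤ 2 (past-center k≡ (proj₂ off))) ⟩
        3 * 2 ^ (s + H i)        ≡⟨ cong (3 *_) (^-distribˡ-+-* 2 s (H i)) ⟩
        3 * (2 ^ s * 2 ^ H i)    ≡⟨ solve 2 (λ x y → con 3 :* (x :* y) := x :* (con 3 :* y)) refl (2 ^ s) (2 ^ H i) ⟩
        2 ^ s * (3 * 2 ^ H i)    ≤⟨ *-monoʳ-≤ (2 ^ s) (R≥2^H i) ⟩
        2 ^ s * (R i + 2)        ∎
        where open ≤-Reasoning

-- Comparing crg trees

sum-mono : ∀ {a b c d} → a + b ≡ c + d → a ≤ c → d ≤ b
sum-mono eq a≤c = ≮⇒≥ λ b<d → <-irrefl eq (+-mono-≤-< a≤c b<d)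

R-mono : ∀ {i j} → i ≤ j → R i ≤ R j
R-mono {i} {j} le = +-cancelʳ-≤ 2 _ _ (begin
  R i + 2                     ≤⟨ m≤n*m (R i + 2) (2 ^ (j ∸ i)) {{>-nonZero (2^d>0 (j ∸ i))}} ⟩
  2 ^ (j ∸ i) * (R i + 2)     ≤⟨ R-shift i (j ∸ i) ⟩
  R (i + (j ∸ i)) + 2         ≡⟨ cong (λ x → R x + 2) (m+[n∸m]≡n le) ⟩
  R j + 2                     ∎)
  where open ≤-Reasoning

C-mono : ∀ {k l} → k ≤ l → C k ≤ C l
C-mono {k} {l} le = +-cancelʳ-≤ 2 _ _ (subst₂ _≤_ (sym (C+2 k)) (sym (C+2 l)) (*-monoʳ-≤ 3 (^-monoʳ-≤ 2 le)))

-- A child of `a` counts at most as much as the complete tree with parameters `(d , 2 ^ d)`. That is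
-- the tree with parameters `(suc d , 0)`, which `b` reaches at least. Hence `f` does not grow from
-- the root of `a` to its children.
child-F : ∀ {V : Set} {d v p q} {a₁ a₂ b : LT V} → Bal d (node v a₁ a₂) p → Bal d b q → F a₁ ≤ F b × F a₂ ≤ F b
child-F {b = b} cherry y = F-positive b , F-positive b
child-F {b = b} (node {d = d} x₁ x₂ _) y = below x₁ , below x₂
  where
  below : ∀ {t p} → Bal d t p → F t ≤ F b
  below x = subst₂ _≤_ (sym (bal-F x)) (sym (bal-F y))
    (≤-trans (Φ-mono d (bal-≤ x) ≤-refl) (≤-trans (≤-reflexive (Φ-full d)) (Φ-mono (suc d) z≤n (bal-≤ y))))

private
  -- With b at least 3y - 2, right side minus left side is at least (y - 1)(c - 1).
  threshold-≤ : ∀ y b c → 1 ≤ y → 1 ≤ c → y * 3 ≤ b + 2 → 2 * y * (c + 2) ≤ suc b * suc c + 2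
  threshold-≤ (suc y) b (suc c) _ _ le = begin
    2 * suc y * (suc c + 2)                 ≤⟨ m≤m+n _ (y * c) ⟩
    2 * suc y * (suc c + 2) + y * c         ≡⟨ solve 2 (λ y c → con 2 :* (con 1 :+ y) :* (con 1 :+ c :+ con 2) :+ y :* c
                                               := (con 3 :* y :+ con 2) :* (con 2 :+ c) :+ con 2) refl y c ⟩
    (3 * y + 2) * suc (suc c) + 2           ≤⟨ +-monoˡ-≤ 2 (*-monoˡ-≤ (suc (suc c)) le′) ⟩
    suc b * suc (suc c) + 2                 ∎
    where
    open ≤-Reasoning
    le′ : 3 * y + 2 ≤ suc b
    le′ = s≤s⁻¹ (subst₂ _≤_ (solve 1 (λ y → (con 1 :+ y) :* con 3 := con 1 :+ (con 3 :* y :+ con 2)) refl y)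
                            (solve 1 (λ b → b :+ con 2 := con 2 :+ b) refl b) le)

module _ {n : ℕ} {T : Graph n} where

  child-core : ∀ {r v a₁ a₂ b c d p q} → Branches T r (node v a₁ a₂ ∷ b ∷ c ∷ []) →
               Bal d (node v a₁ a₂) p → Bal d b q → suc (F b) * suc (F c) ≤ F (node v a₁ a₂) → Core T v
  child-core {r} {a₁ = a₁} {a₂} {b} {c} B x y le = core (reroot B)
    (≤-trans (≤-trans (proj₁ (child-F x y)) b≤) (m≤n*m (suc M) (suc (F a₂))))
    (≤-trans (≤-trans (proj₂ (child-F x y)) b≤) (m≤n*m (suc M) (suc (F a₁)))) le
    where
    M = F (node r b c)
    b≤ : F b ≤ suc M
    b≤ = ≤-trans (n≤1+n (F b)) (≤-trans (m≤m*n (suc (F b)) (suc (F c))) (n≤1+n M))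

  child-center : ∀ {r v a₁ a₂ b c} → Branches T r (node v a₁ a₂ ∷ b ∷ c ∷ []) →
                 let h = ht (node v a₁ a₂) in suc (ht b) ≤ h → h ≤ suc (ht b) → suc (ht c) ≤ h → Center T v
  child-center {r} {v} {a₁} {a₂} {b} {c} B b< a≤ c< = [ (λ e → go B₁ e (m≤n⊔m (ht a₁) (ht a₂))) , (λ e → go B₂ e (m≤m⊔n (ht a₁) (ht a₂))) ]′ (⊔-sel (ht a₁) (ht a₂))
    where
    u = node r b c
    m = ht a₁ ⊔ ht a₂
    B₁ : Branches T v (u ∷ a₁ ∷ a₂ ∷ [])
    B₁ = permute (Perm.trans (Perm.prep a₁ (Perm.swap a₂ u Perm.refl)) (Perm.swap a₁ u Perm.refl)) (reroot B)
    B₂ : Branches T v (u ∷ a₂ ∷ a₁ ∷ [])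
    B₂ = permute (Perm.prep u (Perm.swap a₁ a₂ Perm.refl)) B₁
    go : ∀ {s t} → Branches T v (u ∷ s ∷ t ∷ []) → m ≡ ht s → ht t ≤ m → Center T v
    go {s} B′ e le = center B′ (s≤s (s≤s (⊔-lub (s≤s⁻¹ b<) (s≤s⁻¹ c<))) ∷ s≤s (m≤n⇒m≤1+n (≤-reflexive (sym e))) ∷ s≤s (m≤n⇒m≤1+n le) ∷ [])
      (s≤s (≤-trans (≤-reflexive (+-comm (suc m) (suc (suc m)))) (+-mono-≤ (s≤s (≤-trans a≤ (s≤s (m≤m⊔n (ht b) (ht c))))) (s≤s (≤-reflexive e)))))

  module Exceeding {i k : ℕ} (X : CrgTree T i k) where

    open CrgTree X
    open Bounds X

    root-center : suc k ≤ H i → Center T r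
    root-center le = center br (s≤s ≤-refl ∷ s≤s ht-ordered ∷ ≤-trans (s≤s (≤-reflexive (cat-ht cat))) (≤-trans le (≤-reflexive H≡)) ∷ [])
      (s≤s (≤-trans (≤-reflexive (+-suc (ht a) (ht a))) (≤-trans (+-monoʳ-≤ (suc (ht a)) ht-close) ≤-refl)))

    upper-root : F a ≤ suc (F b) * suc (F c) → C k ≤ R i → d[C,S] T ≤ offset k (H i)
    upper-root a≤ C≤ = [ inside , (λ le → ≤-trans (near {T = T} (root-center le) root-core []) z≤n) ]′ (≤-total (H i) (suc k))
      where
      root-core : Core T r
      root-core = core br a≤ (≤-trans F-ordered (≤-trans (n≤1+n (F a)) (m≤m*n (suc (F a)) (suc (F c))))) (subst₂ _≤_ (sym F-c) (sym F≡R) C≤)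
      inside : H i ≤ suc k → d[C,S] T ≤ offset k (H i)
      inside le = let x , cx , w = at-offset le in near {T = T} cx root-core (reverse-walk (symm T) w)

    -- If f grows from the root to its larger subtree a, then R for a already
    -- exceeds the threshold, which bounds l by the size of a.
    child-exceeds : suc (F b) * suc (F c) < F a → C (k + suc (inner b)) < R (inner a)
    -- If `a` alone were the rgood part, then `b` and the root would go to the caterpillar, adding
    -- `suc (inner b)` inner vertices to its `k`.
    child-exceeds lt = <-≤-trans (s≤s (+-cancelʳ-≤ 2 _ _ (begin
      C (k + suc (inner b)) + 2           ≡⟨ C-shift k (suc (inner b)) ⟩
      -- Since `R 0 + 2` is 3, `R-shift 0` bounds `R (inner b) + 2` below by three times
      -- `2 ^ inner b`.
      2 * 2 ^ inner b * (C k + 2)         ≤⟨ threshold-≤ (2 ^ inner b) (F b) (C k) (2^d>0 (inner b)) (C-positive k)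
                                               (subst (λ x → 2 ^ inner b * 3 ≤ x + 2) (sym (bal-R bal-b)) (R-shift 0 (inner b))) ⟩
      suc (F b) * suc (C k) + 2           ≡⟨ cong (λ x → suc (F b) * suc x + 2) F-c ⟨
      suc (F b) * suc (F c) + 2           ∎))) (≤-trans lt (≤-reflexive (bal-R bal-a)))
      where open ≤-Reasoning

    -- The core contains the root of `a`, one step farther from the center than `r`. Against this
    -- `k′` is larger than `k` by at least one and `h′` smaller than `H i` by at least one; together
    -- they raise the offset by at least one.
    upper-child : suc (F b) * suc (F c) < F a → ∀ {k′ h′} → k + suc (inner b) ≤ k′ → h′ ≤ ht a → d[C,S] T ≤ offset k′ h′
    upper-child lt {k′} {h′} k≤ h≤ = split a refl
      where
      split : ∀ t → a ≡ t → d[C,S] T ≤ offset k′ h′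
      split (leaf v) e = ⊥-elim (<⇒≱ lt (≤-trans (≤-reflexive (cong F e)) (s≤s z≤n)))
      split (node v a₁ a₂) e = [ outside , inside ]′ (<-≤-connex (suc k) (H i))
        where
        br′ : Branches T r (node v a₁ a₂ ∷ b ∷ c ∷ [])
        br′ = subst (λ t → Branches T r (t ∷ b ∷ c ∷ [])) e br
        rv : Adj T r v
        rv = from (Branches.nbrs br′) (here refl)
        v-core : Core T v
        v-core = child-core br′ (subst (λ t → Bal d t p) e bal-a) bal-b (<⇒≤ (subst (λ t → suc (F b) * suc (F c) < F t) e lt))
        inside : H i ≤ suc k → d[C,S] T ≤ offset k′ h′
        inside le = let x , cx , w = at-offset le in ≤-trans (near {T = T} cx v-core (reverse-walk (symm T) w ∷ʳʷ rv)) (offset-≥ {k′} {h′} bound)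
          where
          s = offset k (H i)
          bound : h′ + (suc s + suc s) ≤ suc k′
          bound = begin
            h′ + (suc s + suc s)      ≤⟨ +-monoˡ-≤ (suc s + suc s) h≤ ⟩
            ht a + (suc s + suc s)    ≡⟨ solve 2 (λ h s → h :+ (con 1 :+ s :+ (con 1 :+ s)) := con 1 :+ (con 1 :+ h :+ (s :+ s))) refl (ht a) s ⟩
            suc (suc (ht a) + (s + s)) ≡⟨ cong (λ h → suc (h + (s + s))) H≡ ⟨
            suc (H i + (s + s))       ≤⟨ s≤s (proj₁ (offset-upper {k} {H i} le)) ⟩
            suc (suc k)               ≤⟨ s≤s (≤-trans (s≤s (m≤m+n k (inner b))) (≤-trans (≤-reflexive (sym (+-suc k (inner b)))) k≤)) ⟩
            suc k′                    ∎
            where open ≤-Reasoning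
        outside : suc k < H i → d[C,S] T ≤ offset k′ h′
        outside k< = [ shallow , deep ]′ (<-≤-connex (ht b) (ht a))
          where
          k<a : suc k ≤ ht a
          k<a = s≤s⁻¹ (≤-trans k< (≤-reflexive H≡))
          shallow : ht b < ht a → d[C,S] T ≤ offset k′ h′
          shallow b<a = ≤-trans (near {T = T} (child-center br′ (subst (λ t → suc (ht b) ≤ ht t) e b<a) (subst (λ t → ht t ≤ suc (ht b)) e ht-close)
            (subst (λ t → suc (ht c) ≤ ht t) e (≤-trans (s≤s (≤-reflexive (cat-ht cat))) k<a))) v-core []) z≤n
          -- Here `r` is a center and its neighbour `v` is in the core, so an offset of 1 is needed.
          -- It comes from `b`, which has at least as many inner vertices as its height and
          -- therefore lengthens `k′` enough.
          deep : ht a ≤ ht b → d[C,S] T ≤ offset k′ h′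
          deep a≤b = ≤-trans (near {T = T} (root-center (<⇒≤ k<)) v-core (rv ∷ [])) (offset-≥ {k′} {h′} {1} (begin
            h′ + 2                    ≡⟨ +-comm h′ 2 ⟩
            suc (suc h′)              ≤⟨ s≤s (s≤s (≤-trans h≤ (≤-trans a≤b (inner≥ht b)))) ⟩
            suc (suc (inner b))       ≤⟨ s≤s (≤-trans (m≤n+m (suc (inner b)) k) k≤) ⟩
            suc k′                    ∎))
            where open ≤-Reasoning

-- R + 2 at least doubles with each of the g steps from m up to l - 2, where it
-- does not exceed the threshold; hence f cannot drop within the first g steps
-- of the climb.
climb-offset : ∀ {i k kₗ g j k′ t} → k ≡ suc g + kₗ → H i ≤ suc k → R (i + g) ≤ C (suc kₗ) →
               j + t ≡ offset k (H i) → offset k (H i) + k′ ≡ k → C (t + k′) + 2 < 2 ^ j * (R i + 2) →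
               t ≤ offset kₗ (H (i + suc g))
climb-offset {i} {k} {kₗ} {g} {j} {k′} {t} k≡ h≤ R≤ s≡ eq lt = offset-≥ {kₗ} {H (i + suc g)} (+-cancelʳ-≤ (suc g) _ _ (begin
  -- Going from i to `i + suc g` may raise the height by `suc g` and shortens the caterpillar by
  -- `suc g`; each loss is paid by one of the two copies of `j`.
  H (i + suc g) + (t + t) + suc g       ≤⟨ +-mono-≤ (+-monoˡ-≤ (t + t) (proj₂ (H-shift i (suc g)))) g<j ⟩
  H i + suc g + (t + t) + j             ≤⟨ +-monoˡ-≤ j (+-monoˡ-≤ (t + t) (+-monoʳ-≤ (H i) g<j)) ⟩
  H i + j + (t + t) + j                 ≡⟨ solve 3 (λ h j t → h :+ j :+ (t :+ t) :+ j := h :+ (j :+ t :+ (j :+ t))) refl (H i) j t ⟩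
  H i + (j + t + (j + t))               ≡⟨ cong (λ s → H i + (s + s)) s≡ ⟩
  H i + (s + s)                         ≤⟨ proj₁ (offset-upper {k} {H i} h≤) ⟩
  suc k                                 ≡⟨ cong suc (trans k≡ (+-comm (suc g) kₗ)) ⟩
  suc kₗ + suc g                        ∎))
  where
  open ≤-Reasoning
  s = offset k (H i)
  g<j : g < j
  g<j = ≰⇒> λ j≤g → <⇒≱ lt (begin
    2 ^ j * (R i + 2)     ≤⟨ *-monoˡ-≤ (R i + 2) (^-monoʳ-≤ 2 j≤g) ⟩
    2 ^ g * (R i + 2)     ≤⟨ R-shift i g ⟩
    R (i + g) + 2         ≤⟨ +-monoˡ-≤ 2 R≤ ⟩
    C (suc kₗ) + 2        ≤⟨ +-monoˡ-≤ 2 (C-mono (sum-mono {j} {t + k′} {g} {suc kₗ}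
                               (trans (sym (+-assoc j t k′)) (trans (cong (_+ k′) s≡) (trans eq (trans k≡ (sym (+-suc g kₗ)))))) j≤g)) ⟩
    C (t + k′) + 2        ∎)

-- Both sides are compared with `offset kₗ (H iₗ)`. Minimality is used twice when `R i` exceeds the
-- threshold, for `i` and for `inner a`; below the threshold it is used just before `iₗ`, at
-- `i + g`.
crg-≤ : ∀ {n n′} {T : Graph n} {T′ : Graph n′} {iₗ kₗ i k} → CrgTree T iₗ kₗ → CrgTree T′ i k → n ≡ 2 * suc (iₗ + kₗ) → iₗ + kₗ ≡ i + k →
        C kₗ < R iₗ → (∀ i′ k′ → i′ + k′ ≡ iₗ + kₗ → i′ < iₗ → R i′ ≤ C k′) → d[C,S] T′ ≤ d[C,S] T
crg-≤ {T = T} {T′} {iₗ} {kₗ} {i} {k} X X′ n≡ sum exc minimal =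
  ≤-trans ([ exceeding , below ]′ (<-≤-connex (C k) (R i))) (Bounds.lower X n≡ exc)
  where
  open CrgTree X′
  open Bounds X′
  open Exceeding X′
  first : ∀ {i′ k′} → iₗ + kₗ ≡ i′ + k′ → C k′ < R i′ → iₗ ≤ i′
  first {i′} {k′} eq lt = ≮⇒≥ λ i′< → <⇒≱ lt (minimal i′ k′ (sym eq) i′<)
  exceeding : C k < R i → d[C,S] T′ ≤ offset kₗ (H iₗ)
  exceeding lt = [ at-child , at-root ]′ (<-≤-connex (suc (F b) * suc (F c)) (F a))
    where
    i≥ : iₗ ≤ i
    i≥ = first sum lt
    at-root : F a ≤ suc (F b) * suc (F c) → d[C,S] T′ ≤ offset kₗ (H iₗ)
    at-root a≤ = ≤-trans (upper-root a≤ (<⇒≤ lt)) (offset-mono {k} {H i} {kₗ} {H iₗ} (sum-mono sum i≥) (H-mono i≥))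
    at-child : suc (F b) * suc (F c) < F a → d[C,S] T′ ≤ offset kₗ (H iₗ)
    at-child big = upper-child big (sum-mono eq le) (≤-trans (H-mono le) (≤-reflexive (sym (bal-H bal-a))))
      where
      eq : iₗ + kₗ ≡ inner a + (k + suc (inner b))
      eq = trans sum (trans (cong (_+ k) (sym inner≡)) (solve 3 (λ a b k → con 1 :+ (a :+ b) :+ k := a :+ (k :+ (con 1 :+ b))) refl (inner a) (inner b) k))
      le : iₗ ≤ inner a
      le = first eq (child-exceeds big)
  below : R i ≤ C k → d[C,S] T′ ≤ offset kₗ (H iₗ)
  below R≤ = let t , d≤ , r = climb-bound R≤ in ≤-trans d≤ ([ (λ t≡0 → ≤-trans (≤-reflexive t≡0) z≤n) , (λ (j , k′ , s≡ , eq , lt) → bound s≡ eq lt) ]′ r)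
    where
    i<iₗ : i < iₗ
    i<iₗ = ≰⇒> λ iₗ≤i → <⇒≱ exc (≤-trans (R-mono iₗ≤i) (≤-trans R≤ (C-mono (sum-mono sum iₗ≤i))))
    g : ℕ
    g = iₗ ∸ suc i
    iₗ≡ : iₗ ≡ i + suc g
    iₗ≡ = trans (sym (m+[n∸m]≡n i<iₗ)) (sym (+-suc i g))
    k≡ : k ≡ suc g + kₗ
    k≡ = +-cancelˡ-≡ i _ _ (trans (sym sum) (trans (cong (_+ kₗ) iₗ≡) (+-assoc i (suc g) kₗ)))
    R-prev : R (i + g) ≤ C (suc kₗ)
    R-prev = minimal (i + g) (suc kₗ) (trans (+-suc (i + g) kₗ) (cong (_+ kₗ) (trans (sym (+-suc i g)) (sym iₗ≡))))
               (≤-reflexive (trans (sym (+-suc i g)) (sym iₗ≡)))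
    bound : ∀ {j k′ t} → j + t ≡ offset k (H i) → offset k (H i) + k′ ≡ k → C (t + k′) + 2 < 2 ^ j * (R i + 2) → t ≤ offset kₗ (H iₗ)
    bound {j} {k′} {t} s≡ eq lt = subst (λ x → t ≤ offset kₗ (H x)) (sym iₗ≡)
      (climb-offset {i} {k} {kₗ} {g} {j} {k′} {t} k≡ (m≤n⇒m≤1+n (R-below R≤)) R-prev s≡ eq lt)

odd : ∀ i → 2 ∤ suc (2 * i)
odd i (divides q e) = even≢odd q i (trans (*-comm 2 q) (sym e))

exceeds⇒3≤ : ∀ {n l} → 2 ∤ l → Exceeds n l → 3 ≤ l
exceeds⇒3≤ {n} {zero} ∤ _ = ⊥-elim (∤ (divides 0 refl))
exceeds⇒3≤ {n} {suc zero} ∤ (x , isR , lt) with IsR⇒R isR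
... | zero , _ , refl = ⊥-elim (<⇒≱ lt (≤-trans (C-positive ((n ∸ 1 ∸ 1) / 2)) (≤-reflexive (sym (C≡ ((n ∸ 1 ∸ 1) / 2))))))
exceeds⇒3≤ {n} {suc (suc zero)} ∤ _ = ⊥-elim (∤ (divides 1 refl))
exceeds⇒3≤ {n} {suc (suc (suc l))} ∤ _ = s≤s (s≤s (s≤s z≤n))

theorem3p9 : ∀ (n : ℕ) → 12 ≤ n → 2 ∣ n →
    ∀ (l : ℕ) → IsSmallestOdd (Exceeds n) l →
    ∀ (T : Graph n) → IsCrg l T →
    ∀ (m : ℕ) → 2 ∤ m → 3 ≤ m → m < n →
    ∀ (T' : Graph n) → IsCrg m T' →
    d[C,S] T' ≤ d[C,S] T
theorem3p9 n _ _ l (l-odd , exc , least-l) T crg m _ 3≤m _ T' crg' =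
  compare (crgTree (exceeds⇒3≤ l-odd exc) crg) (crgTree 3≤m crg')
  where
  compare : (∃₂ λ i k → CrgTree T i k × l ≡ suc (2 * i) × n ≡ 2 * suc (i + k)) →
            (∃₂ λ i k → CrgTree T' i k × m ≡ suc (2 * i) × n ≡ 2 * suc (i + k)) → d[C,S] T' ≤ d[C,S] T
  compare (iₗ , kₗ , X , l≡ , n≡) (i , k , X′ , _ , n≡′) = crg-≤ X X′ n≡ (suc-injective (*-cancelˡ-≡ _ _ 2 (trans (sym n≡) n≡′)))
    (exceeds⁻ iₗ kₗ (subst₂ Exceeds n≡ l≡ exc)) minimal
    where
    minimal : ∀ i′ k′ → i′ + k′ ≡ iₗ + kₗ → i′ < iₗ → R i′ ≤ C k′
    minimal i′ k′ eq i′< = ≮⇒≥ λ lt → least-l (suc (2 * i′)) (odd i′) (subst (suc (2 * i′) <_) (sym l≡) (s≤s (*-monoʳ-< 2 i′<)))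
      (subst (λ n → Exceeds n (suc (2 * i′))) (trans (cong (λ s → 2 * suc s) eq) (sym n≡)) (exceeds⁺ i′ k′ lt))
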